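{- Fix a constant $\alpha>0$. Let $\sigma=\sigma(n)\ge 2$ be a non-decreasing integer function of $n$ with $\sigma\le O(n)$, and let $k=k(n)\ge 0$ be an integer function of $n$ with $k=o(\log_\sigma n)$. For any string $T[1,n]$ over the alphabet $\{1,2,\ldots,\sigma\}$ and any LZ-like parsing $T=P_1P_2\cdots P_c$ with $c\le\frac{\alpha n}{\log_\sigma n}$, the rightmost encoding of the parsing in which every pair $(d_j,\ell_j)$ corresponding to a copying phrase takes $\log d_j+O(1+\log\log d_j+\log\ell_j)$ bits occupies at most $nH_k(T)+o(n\log\sigma)$ bits. (The $o(n\log\sigma)$ term is as $n\to\infty$, uniformly over $T$ and over such parsings.)
   Context: All logarithms are base 2 unless stated otherwise; $\log\log d$ is read as $0$ when $d=1$. $T[i]$ is the $i$th symbol of $T$ and $T[i,j]=T[i]T[i+1]\cdots T[j]$. The constants hidden in the $O(\cdot)$ of the encoding are fixed absolute constants. Empirical entropy. $H_0(T)=\sum_{c}\frac{n_c}{n}\log\frac{n}{n_c}$, where $c$ ranges over the alphabet, $n_c$ is the number of occurrences of symbol $c$ in $T[1,n]$, and terms with $n_c=0$ are $0$. For a string $W$, $T_W$ is the concatenation of all symbols immediately following occurrences of $W$ in $T$ (e.g. $T_{ab}=aac$ for $T=abababc$). $H_k(T)=\sum_{W\in\Sigma^k}\frac{|T_W|}{n}H_0(T_W)$, where $\Sigma=\{1,\ldots,\sigma\}$ (empty $T_W$ contributes $0$). LZ-like parsing. A factorization $T=P_1P_2\cdots P_c$ into non-empty phrases in which each phrase $P_j$,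 starting at position $i=|P_1\cdots P_{j-1}|+1$, is either a copying phrase, meaning that $P_j$ has an occurrence in $T$ starting at a position smaller than $i$ (overlaps allowed; such an occurrence is a source of $P_j$), or a literal phrase, meaning that $P_j=T[i]$ is a single symbol that does not occur in $T[1,i-1]$. No maximality (greedy choice) of phrases is required. Encoding. Each copying phrase $P_j$ is encoded by a pair $(d_j,\ell_j)$ with $\ell_j=|P_j|$ and $d_j\ge1$ such that $P_j$ is a prefix of $T[|P_1\cdots P_{j-1}|-d_j+1,n]$, i.e. $d_j$ is the distance from the start of $P_j$ to the start of its source. Each literal phrase $c$ is encoded as a pair $(c,0)$ storing the symbol $c$ as an integer, taking $\log\sigma+O(1+\log\log\sigma)$ bits. The encoding is rightmost if all $d_j$ are minimized, i.e. the rightmost possible earlier-starting occurrence is chosen as the source of each copying phrase. -}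

module Defs where

open import Data.Nat.Base as ℕ using (ℕ; zero; suc)
import Data.Nat.Properties as ℕ
import Data.Nat.DivMod as ℕ
open import Data.Nat.Logarithm using (⌊log₂_⌋; ⌊log₂⌋-mono-≤; ⌊log₂[2^n]⌋≡n; ⌊log₂⌊n/2⌋⌋≡⌊log₂n⌋∸1)
open import Data.Nat.Induction using (<-rec)
open import Data.Nat.Solver using (module +-*-Solver)
import Data.Integer.Base as ℤ
import Data.Integer.Properties as ℤ
open import Data.Rational.Base as ℚ using (ℚ; mkℚ; 0ℚ; 1ℚ; ½)
import Data.Rational.Properties as ℚ
import Data.Rational.Solver as ℚ
open import Data.Rational.Unnormalised.Base as ℚᵘ using (mkℚᵘ)
import Data.Rational.Unnormalised.Properties as ℚᵘ
open import Data.Fin.Base using (Fin; toℕ)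
import Data.Fin.Properties as Fin
open import Data.List.Base
  using (List; []; _∷_; [_]; map; concat; concatMap; length; filter; foldr; take; drop; tails; lookup; allFin)
open import Data.List.Membership.Propositional using (_∉_)
open import Data.List.Relation.Unary.All using (All)
open import Data.List.Relation.Binary.Prefix.Heterogeneous using (Prefix)
open import Data.Product.Base using (∃-syntax; _×_; _,_; proj₁; proj₂)
open import Data.Sum.Base using (_⊎_; inj₁; inj₂)
open import Relation.Nullary using (yes; no)
open import Relation.Binary.PropositionalEquality
  using (_≡_; _≢_; refl; sym; trans; cong; cong₂; subst; subst₂)

abs-intro : ∀ {p q e} → p ℚ.≤ q ℚ.+ e → q ℚ.≤ p ℚ.+ e → ℚ.∣ p ℚ.- q ∣ ℚ.≤ e
abs-intro {p} {q} {e} h₁ h₂ with ℚ.∣p∣≡p∨∣p∣≡-p (p ℚ.- q)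
... | inj₁ eq = subst (ℚ._≤ e) (sym eq)
    (subst (p ℚ.- q ℚ.≤_) (solve 2 (λ q e → q :+ e :- q := e) refl q e) (ℚ.+-monoˡ-≤ (ℚ.- q) h₁))
  where open ℚ.+-*-Solver
... | inj₂ eq = subst (ℚ._≤ e) (trans (solve 2 (λ p q → q :- p := :- (p :- q)) refl p q) (sym eq))
    (subst (q ℚ.- p ℚ.≤_) (solve 2 (λ p e → p :+ e :- p := e) refl p e) (ℚ.+-monoˡ-≤ (ℚ.- p) h₂))
  where open ℚ.+-*-Solver

p≤∣p∣ : ∀ p → p ℚ.≤ ℚ.∣ p ∣
p≤∣p∣ p with ℚ.≤-total 0ℚ p
... | inj₁ 0≤p = ℚ.≤-reflexive (sym (ℚ.0≤p⇒∣p∣≡p 0≤p))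
... | inj₂ p≤0 = ℚ.≤-trans p≤0 (ℚ.0≤∣p∣ p)

abs-elimˡ : ∀ {p q e} → ℚ.∣ p ℚ.- q ∣ ℚ.≤ e → p ℚ.≤ q ℚ.+ e
abs-elimˡ {p} {q} {e} h =
  subst (ℚ._≤ q ℚ.+ e) (solve 2 (λ p q → q :+ (p :- q) := p) refl p q)
    (ℚ.+-monoʳ-≤ q (ℚ.≤-trans (p≤∣p∣ _) h))
  where open ℚ.+-*-Solver

abs-sym : ∀ p q → ℚ.∣ p ℚ.- q ∣ ≡ ℚ.∣ q ℚ.- p ∣
abs-sym p q = trans (sym (ℚ.∣-p∣≡∣p∣ (p ℚ.- q)))
  (cong ℚ.∣_∣ (solve 2 (λ p q → :- (p :- q) := q :- p) refl p q))
  where open ℚ.+-*-Solver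

abs-elimʳ : ∀ {p q e} → ℚ.∣ p ℚ.- q ∣ ℚ.≤ e → q ℚ.≤ p ℚ.+ e
abs-elimʳ {p} {q} {e} h = abs-elimˡ (subst (ℚ._≤ e) (abs-sym p q) h)

half-pos : ∀ {ε} → 0ℚ ℚ.< ε → 0ℚ ℚ.< ½ ℚ.* ε
half-pos {ε} 0<ε = ℚ.positive⁻¹ (½ ℚ.* ε) {{ℚ.pos*pos⇒pos ½ ε {{ℚ.positive 0<ε}}}}

half-+ : ∀ ε → ½ ℚ.* ε ℚ.+ ½ ℚ.* ε ≡ ε
half-+ ε = trans (sym (ℚ.*-distribʳ-+ ε ½ ½)) (ℚ.*-identityˡ ε)

-- m ÷ 0 is set to 0, so that empty strings and absent symbols contribute 0 to
-- the entropies below.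
infixl 7 _÷_
_÷_ : ℕ → ℕ → ℚ
m ÷ zero  = 0ℚ
m ÷ suc n = ℤ.+ m ℚ./ suc n

÷-mono : ∀ {a b c d} .{{_ : ℕ.NonZero b}} .{{_ : ℕ.NonZero d}} →
         a ℕ.* d ℕ.≤ c ℕ.* b → a ÷ b ℚ.≤ c ÷ d
÷-mono {a} {suc b} {c} {suc d} h = ℚ.toℚᵘ-cancel-≤
  (ℚᵘ.≤-respˡ-≃ (ℚᵘ.≃-sym (ℚ.toℚᵘ-fromℚᵘ (mkℚᵘ (ℤ.+ a) b)))
    (ℚᵘ.≤-respʳ-≃ (ℚᵘ.≃-sym (ℚ.toℚᵘ-fromℚᵘ (mkℚᵘ (ℤ.+ c) d)))
      (ℚᵘ.*≤* (subst₂ ℤ._≤_ (ℤ.pos-* a (suc d)) (ℤ.pos-* c (suc b)) (ℤ.+≤+ h)))))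

÷-cancel : ∀ {a b c d} .{{_ : ℕ.NonZero b}} .{{_ : ℕ.NonZero d}} →
           a ÷ b ℚ.≤ c ÷ d → a ℕ.* d ℕ.≤ c ℕ.* b
÷-cancel {a} {suc b} {c} {suc d} h =
  ℤ.drop‿+≤+ (subst₂ ℤ._≤_ (sym (ℤ.pos-* a (suc d))) (sym (ℤ.pos-* c (suc b)))
    (ℚᵘ.drop-*≤* (ℚᵘ.≤-respˡ-≃ (ℚ.toℚᵘ-fromℚᵘ (mkℚᵘ (ℤ.+ a) b))
      (ℚᵘ.≤-respʳ-≃ (ℚ.toℚᵘ-fromℚᵘ (mkℚᵘ (ℤ.+ c) d)) (ℚ.toℚᵘ-mono-≤ h)))))

÷-+ : ∀ a b c d .{{_ : ℕ.NonZero b}} .{{_ : ℕ.NonZero d}} →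
      a ÷ b ℚ.+ c ÷ d ≡ (a ℕ.* d ℕ.+ c ℕ.* b) ÷ (b ℕ.* d)
÷-+ a (suc b) c (suc d) = ℚ.toℚᵘ-injective
  (ℚᵘ.≃-trans (ℚ.toℚᵘ-homo-+ (a ÷ suc b) (c ÷ suc d))
  (ℚᵘ.≃-trans (ℚᵘ.+-cong (ℚ.toℚᵘ-fromℚᵘ (mkℚᵘ (ℤ.+ a) b)) (ℚ.toℚᵘ-fromℚᵘ (mkℚᵘ (ℤ.+ c) d)))
  (ℚᵘ.≃-trans (ℚᵘ.≃-reflexive (cong (λ z → mkℚᵘ z (d ℕ.+ b ℕ.* suc d)) num))
    (ℚᵘ.≃-sym (ℚ.toℚᵘ-fromℚᵘ (mkℚᵘ (ℤ.+ (a ℕ.* suc d ℕ.+ c ℕ.* suc b)) (d ℕ.+ b ℕ.* suc d)))))))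
  where
  num : (ℤ.+ a) ℤ.* (ℤ.+ suc d) ℤ.+ (ℤ.+ c) ℤ.* (ℤ.+ suc b) ≡ ℤ.+ (a ℕ.* suc d ℕ.+ c ℕ.* suc b)
  num = trans (cong₂ ℤ._+_ (sym (ℤ.pos-* a (suc d))) (sym (ℤ.pos-* c (suc b))))
              (sym (ℤ.pos-+ (a ℕ.* suc d) (c ℕ.* suc b)))

÷-positive : ∀ n .{{_ : ℕ.NonZero n}} → 0ℚ ℚ.< 1 ÷ n
÷-positive (suc n) = ℚ.positive⁻¹ (ℤ.+ 1 ℚ./ suc n) {{ℚ.normalize-pos 1 (suc n)}}

archimedean : ∀ ε → 0ℚ ℚ.< ε → ∃[ K ] 1 ÷ suc K ℚ.≤ ε
archimedean ε@(mkℚ (ℤ.+ zero)  b _) 0<ε with () ← ℚ.positive 0<ε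
archimedean ε@(mkℚ (ℤ.+ suc a) b c) _ = b ,
  subst (1 ÷ suc b ℚ.≤_) (ℚ.↥p/↧p≡p ε) (÷-mono {1} {suc b} {suc a} {suc b} (ℕ.*-monoˡ-≤ (suc b) (ℕ.s≤s (ℕ.z≤n {a}))))
archimedean ε@(mkℚ (ℤ.-[1+ a ]) b _) 0<ε with () ← ℚ.positive 0<ε

IsCauchy : (ℕ → ℚ) → Set
IsCauchy u = ∀ ε → 0ℚ ℚ.< ε → ∃[ N ] (∀ m n → N ℕ.≤ m → N ℕ.≤ n → ℚ.∣ u m ℚ.- u n ∣ ℚ.≤ ε)

record ℝ : Set where
  constructor mkℝ
  field
    seq    : ℕ → ℚ
    cauchy : IsCauchy seq

open ℝ public

infix  4 _≤ℝ_ _<ℝ_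
infixl 6 _+ℝ_
infixl 7 _*ℝ_

_≤ℝ_ : ℝ → ℝ → Set
x ≤ℝ y = ∀ ε → 0ℚ ℚ.< ε → ∃[ N ] (∀ n → N ℕ.≤ n → seq x n ℚ.≤ seq y n ℚ.+ ε)

_<ℝ_ : ℝ → ℝ → Set
x <ℝ y = ∃[ ε ] 0ℚ ℚ.< ε × ∃[ N ] (∀ n → N ℕ.≤ n → seq x n ℚ.+ ε ℚ.≤ seq y n)

fromℚ : ℚ → ℝ
fromℚ q = mkℝ (λ _ → q) λ ε 0<ε → 0 , λ _ _ _ _ →
  subst (ℚ._≤ ε) (sym (cong ℚ.∣_∣ (ℚ.+-inverseʳ q))) (ℚ.<⇒≤ 0<ε)

fromℕ : ℕ → ℝ
fromℕ n = fromℚ (ℤ.+ n ℚ./ 1)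

0ℝ 1ℝ : ℝ
0ℝ = fromℕ 0
1ℝ = fromℕ 1

_+ℝ_ : ℝ → ℝ → ℝ
seq    (x +ℝ y) n = seq x n ℚ.+ seq y n
cauchy (x +ℝ y) ε 0<ε with cauchy x (½ ℚ.* ε) (half-pos 0<ε) | cauchy y (½ ℚ.* ε) (half-pos 0<ε)
... | M , hx | N , hy = M ℕ.⊔ N , λ m n m≥ n≥ →
  let dx = hx m n (ℕ.m⊔n≤o⇒m≤o M N m≥) (ℕ.m⊔n≤o⇒m≤o M N n≥)
      dy = hy m n (ℕ.m⊔n≤o⇒n≤o M N m≥) (ℕ.m⊔n≤o⇒n≤o M N n≥)
      a = seq x m ; b = seq x n ; c = seq y m ; d = seq y n
  in begin
    ℚ.∣ (a ℚ.+ c) ℚ.- (b ℚ.+ d) ∣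
      ≡⟨ cong ℚ.∣_∣ (solve 4 (λ a b c d → a :+ c :- (b :+ d) := (a :- b) :+ (c :- d)) refl a b c d) ⟩
    ℚ.∣ (a ℚ.- b) ℚ.+ (c ℚ.- d) ∣       ≤⟨ ℚ.∣p+q∣≤∣p∣+∣q∣ (a ℚ.- b) (c ℚ.- d) ⟩
    ℚ.∣ a ℚ.- b ∣ ℚ.+ ℚ.∣ c ℚ.- d ∣     ≤⟨ ℚ.+-mono-≤ dx dy ⟩
    ½ ℚ.* ε ℚ.+ ½ ℚ.* ε                 ≡⟨ half-+ ε ⟩
    ε ∎
  where
  open ℚ.≤-Reasoning
  open ℚ.+-*-Solver

bounded : (x : ℝ) → ∃[ B ] 0ℚ ℚ.< B × ∃[ N ] (∀ n → N ℕ.≤ n → ℚ.∣ seq x n ∣ ℚ.≤ B)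
bounded x with cauchy x 1ℚ (ℚ.positive⁻¹ 1ℚ)
... | N , h = ℚ.∣ a ∣ ℚ.+ 1ℚ
            , ℚ.+-mono-≤-< (ℚ.0≤∣p∣ a) (ℚ.positive⁻¹ 1ℚ)
            , N , λ n n≥ → begin
    ℚ.∣ seq x n ∣
      ≡⟨ cong ℚ.∣_∣ (solve 2 (λ a b → b := a :+ (b :- a)) refl a (seq x n)) ⟩
    ℚ.∣ a ℚ.+ (seq x n ℚ.- a) ∣
      ≤⟨ ℚ.∣p+q∣≤∣p∣+∣q∣ a (seq x n ℚ.- a) ⟩
    ℚ.∣ a ∣ ℚ.+ ℚ.∣ seq x n ℚ.- a ∣
      ≤⟨ ℚ.+-monoʳ-≤ ℚ.∣ a ∣ (h n N n≥ ℕ.≤-refl) ⟩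
    ℚ.∣ a ∣ ℚ.+ 1ℚ ∎
  where
  a = seq x N
  open ℚ.≤-Reasoning
  open ℚ.+-*-Solver

*-mono-abs : ∀ {p q B C} → ℚ.∣ p ∣ ℚ.≤ B → ℚ.∣ q ∣ ℚ.≤ C → ℚ.∣ p ℚ.* q ∣ ℚ.≤ B ℚ.* C
*-mono-abs {p} {q} {B} {C} hp hq = begin
  ℚ.∣ p ℚ.* q ∣          ≡⟨ ℚ.∣p*q∣≡∣p∣*∣q∣ p q ⟩
  ℚ.∣ p ∣ ℚ.* ℚ.∣ q ∣    ≤⟨ ℚ.*-monoʳ-≤-nonNeg ℚ.∣ q ∣ {{ℚ.∣-∣-nonNeg q}} hp ⟩
  B ℚ.* ℚ.∣ q ∣          ≤⟨ ℚ.*-monoˡ-≤-nonNeg B {{ℚ.nonNegative (ℚ.≤-trans (ℚ.0≤∣p∣ p) hp)}} hq ⟩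
  B ℚ.* C                ∎
  where open ℚ.≤-Reasoning

*-close : ∀ {a b c d B C η} → ℚ.∣ b ∣ ℚ.≤ B → ℚ.∣ c ∣ ℚ.≤ C →
          ℚ.∣ a ℚ.- b ∣ ℚ.≤ η → ℚ.∣ c ℚ.- d ∣ ℚ.≤ η →
          ℚ.∣ a ℚ.* c ℚ.- b ℚ.* d ∣ ℚ.≤ η ℚ.* (B ℚ.+ C)
*-close {a} {b} {c} {d} {B} {C} {η} hb hc hab hcd = begin
  ℚ.∣ a ℚ.* c ℚ.- b ℚ.* d ∣
    ≡⟨ cong ℚ.∣_∣ (solve 4 (λ a b c d → a :* c :- b :* d := b :* (c :- d) :+ c :* (a :- b)) refl a b c d) ⟩
  ℚ.∣ b ℚ.* (c ℚ.- d) ℚ.+ c ℚ.* (a ℚ.- b) ∣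
    ≤⟨ ℚ.∣p+q∣≤∣p∣+∣q∣ (b ℚ.* (c ℚ.- d)) (c ℚ.* (a ℚ.- b)) ⟩
  ℚ.∣ b ℚ.* (c ℚ.- d) ∣ ℚ.+ ℚ.∣ c ℚ.* (a ℚ.- b) ∣
    ≤⟨ ℚ.+-mono-≤ (*-mono-abs {b} {c ℚ.- d} hb hcd) (*-mono-abs {c} {a ℚ.- b} hc hab) ⟩
  B ℚ.* η ℚ.+ C ℚ.* η
    ≡⟨ solve 3 (λ B C η → B :* η :+ C :* η := η :* (B :+ C)) refl B C η ⟩
  η ℚ.* (B ℚ.+ C) ∎
  where
  open ℚ.≤-Reasoning
  open ℚ.+-*-Solver

divide : ∀ ε S → 0ℚ ℚ.< ε → 0ℚ ℚ.< S → ∃[ η ] 0ℚ ℚ.< η × η ℚ.* S ≡ ε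
divide ε S 0<ε 0<S = ε ℚ.* S⁻
  , ℚ.positive⁻¹ (ε ℚ.* S⁻) {{ℚ.pos*pos⇒pos ε {{ℚ.positive 0<ε}} S⁻ {{ℚ.1/pos⇒pos S {{ℚ.positive 0<S}}}}}}
  , trans (ℚ.*-assoc ε S⁻ S) (trans (cong (ε ℚ.*_) (ℚ.*-inverseˡ S {{S≢0}})) (ℚ.*-identityʳ ε))
  where
  S≢0 : ℚ.NonZero S
  S≢0 = ℚ.pos⇒nonZero S {{ℚ.positive 0<S}}
  S⁻ : ℚ
  S⁻ = (ℚ.1/ S) {{S≢0}}

*-cauchy : ∀ x y → IsCauchy (λ n → seq x n ℚ.* seq y n)
*-cauchy x y ε 0<ε = from (bounded x) (bounded y)
  where
  from : ∃[ B ] 0ℚ ℚ.< B × ∃[ N ] (∀ n → N ℕ.≤ n → ℚ.∣ seq x n ∣ ℚ.≤ B) →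
         ∃[ C ] 0ℚ ℚ.< C × ∃[ N ] (∀ n → N ℕ.≤ n → ℚ.∣ seq y n ∣ ℚ.≤ C) →
         ∃[ N ] (∀ m n → N ℕ.≤ m → N ℕ.≤ n → ℚ.∣ seq x m ℚ.* seq y m ℚ.- seq x n ℚ.* seq y n ∣ ℚ.≤ ε)
  from (B , 0<B , K , bx) (C , 0<C , L , by) =
    close (divide ε (B ℚ.+ C) 0<ε (ℚ.+-mono-< 0<B 0<C))
    where
    close : ∃[ η ] 0ℚ ℚ.< η × η ℚ.* (B ℚ.+ C) ≡ ε →
            ∃[ N ] (∀ m n → N ℕ.≤ m → N ℕ.≤ n → ℚ.∣ seq x m ℚ.* seq y m ℚ.- seq x n ℚ.* seq y n ∣ ℚ.≤ ε)
    close (η , 0<η , η-eq) = (K ℕ.⊔ L) ℕ.⊔ (M ℕ.⊔ N) , bound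
      where
      M = proj₁ (cauchy x η 0<η)
      N = proj₁ (cauchy y η 0<η)
      bound : ∀ m n → (K ℕ.⊔ L) ℕ.⊔ (M ℕ.⊔ N) ℕ.≤ m → (K ℕ.⊔ L) ℕ.⊔ (M ℕ.⊔ N) ℕ.≤ n →
              ℚ.∣ seq x m ℚ.* seq y m ℚ.- seq x n ℚ.* seq y n ∣ ℚ.≤ ε
      bound m n m≥ n≥ = ℚ.≤-trans
        (*-close {seq x m} {seq x n} {seq y m} {seq y n}
          (bx n (ℕ.m⊔n≤o⇒m≤o K L n≥₁)) (by m (ℕ.m⊔n≤o⇒n≤o K L m≥₁))
          (proj₂ (cauchy x η 0<η) m n (ℕ.m⊔n≤o⇒m≤o M N m≥₂) (ℕ.m⊔n≤o⇒m≤o M N n≥₂))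
          (proj₂ (cauchy y η 0<η) m n (ℕ.m⊔n≤o⇒n≤o M N m≥₂) (ℕ.m⊔n≤o⇒n≤o M N n≥₂)))
        (ℚ.≤-reflexive η-eq)
        where
        m≥₁ = ℕ.m⊔n≤o⇒m≤o (K ℕ.⊔ L) (M ℕ.⊔ N) m≥
        n≥₁ = ℕ.m⊔n≤o⇒m≤o (K ℕ.⊔ L) (M ℕ.⊔ N) n≥
        m≥₂ = ℕ.m⊔n≤o⇒n≤o (K ℕ.⊔ L) (M ℕ.⊔ N) m≥
        n≥₂ = ℕ.m⊔n≤o⇒n≤o (K ℕ.⊔ L) (M ℕ.⊔ N) n≥

_*ℝ_ : ℝ → ℝ → ℝ
x *ℝ y = mkℝ (λ n → seq x n ℚ.* seq y n) (*-cauchy x y)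

-- Sequences of rational functions that extend pointwise to a function ℝ → ℝ.
UniformlyCauchy : (ℕ → ℚ → ℚ) → Set
UniformlyCauchy f = ∀ ε → 0ℚ ℚ.< ε → ∃[ δ ] 0ℚ ℚ.< δ × ∃[ N ]
  (∀ m n p q → N ℕ.≤ m → N ℕ.≤ n → ℚ.∣ p ℚ.- q ∣ ℚ.≤ δ → ℚ.∣ f m p ℚ.- f n q ∣ ℚ.≤ ε)

extend : (f : ℕ → ℚ → ℚ) → UniformlyCauchy f → ℝ → ℝ
seq    (extend f uc x) n = f n (seq x n)
cauchy (extend f uc x) ε 0<ε with uc ε 0<ε
... | δ , 0<δ , M , h with cauchy x δ 0<δ
... | N , hx = M ℕ.⊔ N , λ m n m≥ n≥ →
  h m n _ _ (ℕ.m⊔n≤o⇒m≤o M N m≥) (ℕ.m⊔n≤o⇒m≤o M N n≥)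
    (hx m n (ℕ.m⊔n≤o⇒n≤o M N m≥) (ℕ.m⊔n≤o⇒n≤o M N n≥))

⊔1-shift : ∀ {p q δ} → 0ℚ ℚ.≤ δ → p ℚ.≤ q ℚ.+ δ → p ℚ.⊔ 1ℚ ℚ.≤ (q ℚ.⊔ 1ℚ) ℚ.+ δ
⊔1-shift {p} {q} {δ} 0≤δ h = ℚ.⊔-lub
  (ℚ.≤-trans h (ℚ.+-monoˡ-≤ δ (ℚ.p≤p⊔q q 1ℚ)))
  (subst (ℚ._≤ (q ℚ.⊔ 1ℚ) ℚ.+ δ) (ℚ.+-identityʳ 1ℚ) (ℚ.+-mono-≤ (ℚ.p≤q⊔p q 1ℚ) 0≤δ))

⊔1-positive : ∀ q → ℚ.Positive (q ℚ.⊔ 1ℚ)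
⊔1-positive q = ℚ.positive (ℚ.<-≤-trans (ℚ.positive⁻¹ 1ℚ) (ℚ.p≤q⊔p q 1ℚ))

⊔1-nonZero : ∀ q → ℚ.NonZero (q ℚ.⊔ 1ℚ)
⊔1-nonZero q = ℚ.pos⇒nonZero (q ℚ.⊔ 1ℚ) {{⊔1-positive q}}

recipApprox : ℕ → ℚ → ℚ
recipApprox _ q = (ℚ.1/ (q ℚ.⊔ 1ℚ)) {{⊔1-nonZero q}}

inverse-shift : ∀ {a b a⁻ b⁻ δ} → 0ℚ ℚ.≤ a⁻ → 0ℚ ℚ.≤ b⁻ → a⁻ ℚ.≤ 1ℚ → b⁻ ℚ.≤ 1ℚ →
                a ℚ.* a⁻ ≡ 1ℚ → b ℚ.* b⁻ ≡ 1ℚ → 0ℚ ℚ.≤ δ → b ℚ.≤ a ℚ.+ δ → a⁻ ℚ.≤ b⁻ ℚ.+ δ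
inverse-shift {a} {b} {a⁻} {b⁻} {δ} 0≤a⁻ 0≤b⁻ a⁻≤1 b⁻≤1 aa⁻ bb⁻ 0≤δ h = begin
  a⁻                                 ≡⟨ ℚ.*-identityˡ a⁻ ⟨
  1ℚ ℚ.* a⁻                          ≡⟨ cong (ℚ._* a⁻) bb⁻ ⟨
  (b ℚ.* b⁻) ℚ.* a⁻                  ≡⟨ ℚ.*-assoc b b⁻ a⁻ ⟩
  b ℚ.* x                            ≤⟨ ℚ.*-monoʳ-≤-nonNeg x {{ℚ.nonNegative 0≤x}} h ⟩
  (a ℚ.+ δ) ℚ.* x                    ≡⟨ ℚ.*-distribʳ-+ x a δ ⟩
  a ℚ.* x ℚ.+ δ ℚ.* x                ≡⟨ cong (ℚ._+ δ ℚ.* x) ax ⟩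
  b⁻ ℚ.+ δ ℚ.* x                     ≤⟨ ℚ.+-monoʳ-≤ b⁻ (ℚ.*-monoˡ-≤-nonNeg δ {{ℚ.nonNegative 0≤δ}} x≤1) ⟩
  b⁻ ℚ.+ δ ℚ.* 1ℚ                    ≡⟨ cong (b⁻ ℚ.+_) (ℚ.*-identityʳ δ) ⟩
  b⁻ ℚ.+ δ                           ∎
  where
  open ℚ.≤-Reasoning
  x = b⁻ ℚ.* a⁻
  0≤x : 0ℚ ℚ.≤ x
  0≤x = subst (ℚ._≤ x) (ℚ.*-zeroʳ b⁻) (ℚ.*-monoˡ-≤-nonNeg b⁻ {{ℚ.nonNegative 0≤b⁻}} 0≤a⁻)
  x≤1 : x ℚ.≤ 1ℚ
  x≤1 = ℚ.≤-trans (ℚ.*-monoˡ-≤-nonNeg b⁻ {{ℚ.nonNegative 0≤b⁻}} a⁻≤1)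
                  (subst (ℚ._≤ 1ℚ) (sym (ℚ.*-identityʳ b⁻)) b⁻≤1)
  ax : a ℚ.* x ≡ b⁻
  ax = trans (cong (a ℚ.*_) (ℚ.*-comm b⁻ a⁻))
         (trans (sym (ℚ.*-assoc a a⁻ b⁻)) (trans (cong (ℚ._* b⁻) aa⁻) (ℚ.*-identityˡ b⁻)))

inverse≤1 : ∀ {a a⁻} → 0ℚ ℚ.≤ a⁻ → 1ℚ ℚ.≤ a → a ℚ.* a⁻ ≡ 1ℚ → a⁻ ℚ.≤ 1ℚ
inverse≤1 {a} {a⁻} 0≤a⁻ 1≤a aa⁻ =
  subst₂ ℚ._≤_ (ℚ.*-identityˡ a⁻) aa⁻ (ℚ.*-monoʳ-≤-nonNeg a⁻ {{ℚ.nonNegative 0≤a⁻}} 1≤a)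

recip-inverse : ∀ q → (q ℚ.⊔ 1ℚ) ℚ.* recipApprox 0 q ≡ 1ℚ
recip-inverse q = ℚ.*-inverseʳ (q ℚ.⊔ 1ℚ) {{⊔1-nonZero q}}

recip-nonNeg : ∀ q → 0ℚ ℚ.≤ recipApprox 0 q
recip-nonNeg q = ℚ.<⇒≤ (ℚ.positive⁻¹ (recipApprox 0 q) {{ℚ.1/pos⇒pos (q ℚ.⊔ 1ℚ) {{⊔1-positive q}}}})

recip-shift : ∀ {p q δ} → 0ℚ ℚ.≤ δ → q ℚ.≤ p ℚ.+ δ →
              recipApprox 0 p ℚ.≤ recipApprox 0 q ℚ.+ δ
recip-shift {p} {q} 0≤δ h =
  inverse-shift {p ℚ.⊔ 1ℚ} {q ℚ.⊔ 1ℚ} (recip-nonNeg p) (recip-nonNeg q)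
    (inverse≤1 (recip-nonNeg p) (ℚ.p≤q⊔p p 1ℚ) (recip-inverse p))
    (inverse≤1 (recip-nonNeg q) (ℚ.p≤q⊔p q 1ℚ) (recip-inverse q))
    (recip-inverse p) (recip-inverse q) 0≤δ (⊔1-shift {q} {p} 0≤δ h)

recip-uc : UniformlyCauchy recipApprox
recip-uc ε 0<ε = ε , 0<ε , 0 , λ m n p q _ _ h →
  abs-intro {recipApprox m p} {recipApprox n q}
    (recip-shift {p} {q} (ℚ.<⇒≤ 0<ε) (abs-elimʳ {p} {q} h))
    (recip-shift {q} {p} (ℚ.<⇒≤ 0<ε) (abs-elimˡ {p} {q} h))

-- 1 / max(x,1); it is only used as the reciprocal of reals ≥ 1.
recip : ℝ → ℝ
recip = extend recipApprox recip-uc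

log-lower : ∀ m .{{_ : ℕ.NonZero m}} → 2 ℕ.^ ⌊log₂ m ⌋ ℕ.≤ m
log-lower = <-rec (λ m → .{{_ : ℕ.NonZero m}} → 2 ℕ.^ ⌊log₂ m ⌋ ℕ.≤ m) step
  where
  open ℕ.≤-Reasoning
  step : ∀ m → (∀ {j} → j ℕ.< m → .{{_ : ℕ.NonZero j}} → 2 ℕ.^ ⌊log₂ j ⌋ ℕ.≤ j) →
         .{{_ : ℕ.NonZero m}} → 2 ℕ.^ ⌊log₂ m ⌋ ℕ.≤ m
  step 1 _ = ℕ.≤-refl
  step m@(suc (suc i)) rec = begin
    2 ℕ.^ ⌊log₂ m ⌋             ≤⟨ ℕ.^-monoʳ-≤ 2 (ℕ.m≤n+m∸n ⌊log₂ m ⌋ 1) ⟩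
    2 ℕ.^ (1 ℕ.+ (⌊log₂ m ⌋ ℕ.∸ 1)) ≡⟨ cong (λ z → 2 ℕ.* 2 ℕ.^ z) (⌊log₂⌊n/2⌋⌋≡⌊log₂n⌋∸1 m) ⟨
    2 ℕ.* 2 ℕ.^ ⌊log₂ h ⌋       ≤⟨ ℕ.*-monoʳ-≤ 2 (rec (ℕ.⌊n/2⌋<n (suc i))) ⟩
    2 ℕ.* h                     ≡⟨ cong (h ℕ.+_) (ℕ.+-identityʳ h) ⟩
    h ℕ.+ h                     ≤⟨ ℕ.+-monoʳ-≤ h (ℕ.⌊n/2⌋≤⌈n/2⌉ m) ⟩
    h ℕ.+ ℕ.⌈ m /2⌉             ≡⟨ ℕ.⌊n/2⌋+⌈n/2⌉≡n m ⟩
    m                           ∎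
    where h = ℕ.⌊ m /2⌋

log-upper : ∀ m → m ℕ.< 2 ℕ.^ suc ⌊log₂ m ⌋
log-upper m = ℕ.≰⇒> λ h → ℕ.<-irrefl refl
  (subst (ℕ._≤ ⌊log₂ m ⌋) (⌊log₂[2^n]⌋≡n (suc ⌊log₂ m ⌋)) (⌊log₂⌋-mono-≤ h))

bernoulli : ∀ D K t → K ℕ.+ t ≡ D → suc D ℕ.^ K ℕ.* t ℕ.≤ D ℕ.^ K ℕ.* D
bernoulli D zero    t refl = ℕ.≤-refl
bernoulli D (suc K) t eq = begin
  suc D ℕ.* P ℕ.* t        ≡⟨ solve 3 (λ d p t → (con 1 :+ d) :* p :* t := p :* (t :+ d :* t)) refl D P t ⟩
  P ℕ.* (t ℕ.+ D ℕ.* t)    ≤⟨ ℕ.*-monoʳ-≤ P (ℕ.+-monoˡ-≤ (D ℕ.* t) t≤D) ⟩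
  P ℕ.* (D ℕ.+ D ℕ.* t)    ≡⟨ solve 3 (λ d p t → p :* (d :+ d :* t) := d :* (p :* (con 1 :+ t))) refl D P t ⟩
  D ℕ.* (P ℕ.* suc t)      ≤⟨ ℕ.*-monoʳ-≤ D (bernoulli D K (suc t) (trans (ℕ.+-suc K t) eq)) ⟩
  D ℕ.* (D ℕ.^ K ℕ.* D)    ≡⟨ ℕ.*-assoc D (D ℕ.^ K) D ⟨
  D ℕ.* D ℕ.^ K ℕ.* D      ∎
  where
  open ℕ.≤-Reasoning
  open +-*-Solver
  P = suc D ℕ.^ K
  t≤D = subst (t ℕ.≤_) eq (ℕ.m≤n+m t (suc K))

bernoulli₂ : ∀ K .{{_ : ℕ.NonZero K}} → suc (2 ℕ.* K) ℕ.^ K ℕ.≤ 2 ℕ.* (2 ℕ.* K) ℕ.^ K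
bernoulli₂ K = ℕ.*-cancelʳ-≤ _ _ K
  (subst (suc D ℕ.^ K ℕ.* K ℕ.≤_)
    (solve 2 (λ x k → x :* (con 2 :* k) := con 2 :* x :* k) refl (D ℕ.^ K) K)
    (bernoulli D K K (cong (K ℕ.+_) (sym (ℕ.+-identityʳ K)))))
  where
  open +-*-Solver
  D = 2 ℕ.* K

ratioLog : (a b n : ℕ) .{{_ : ℕ.NonZero b}} → ℕ
ratioLog a b n = ⌊log₂ ((a ℕ.^ n) ℕ./ (b ℕ.^ n)) {{ℕ.m^n≢0 b n}} ⌋

module _ (a b n : ℕ) .{{b≢0 : ℕ.NonZero b}} where
  private instance
    bⁿ≢0 : ℕ.NonZero (b ℕ.^ n)
    bⁿ≢0 = ℕ.m^n≢0 b n

  ratioLog-lower : b ℕ.≤ a → 2 ℕ.^ ratioLog a b n ℕ.* b ℕ.^ n ℕ.≤ a ℕ.^ n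
  ratioLog-lower b≤a = ℕ.≤-trans
    (ℕ.*-monoˡ-≤ (b ℕ.^ n) (log-lower (a ℕ.^ n ℕ./ b ℕ.^ n) {{ℕ.>-nonZero (ℕ.m≥n⇒m/n>0 (ℕ.^-monoˡ-≤ n b≤a))}}))
    (ℕ.m/n*n≤m (a ℕ.^ n) (b ℕ.^ n))

  ratioLog-upper : a ℕ.^ n ℕ.≤ 2 ℕ.^ suc (ratioLog a b n) ℕ.* b ℕ.^ n
  ratioLog-upper = begin
    a ℕ.^ n                                       ≡⟨ ℕ.m≡m%n+[m/n]*n (a ℕ.^ n) (b ℕ.^ n) ⟩
    a ℕ.^ n ℕ.% b ℕ.^ n ℕ.+ q ℕ.* b ℕ.^ n         ≤⟨ ℕ.+-monoˡ-≤ (q ℕ.* b ℕ.^ n) (ℕ.<⇒≤ (ℕ.m%n<n (a ℕ.^ n) (b ℕ.^ n))) ⟩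
    suc q ℕ.* b ℕ.^ n                             ≤⟨ ℕ.*-monoˡ-≤ (b ℕ.^ n) (log-upper q) ⟩
    2 ℕ.^ suc (ratioLog a b n) ℕ.* b ℕ.^ n        ∎
    where
    open ℕ.≤-Reasoning
    q = a ℕ.^ n ℕ./ b ℕ.^ n

-- If a/b ≤ (c/d)(1 + 1/2K) then ⌊log₂(a/b)ⁿ⌋/n ≤ ⌊log₂(c/d)ᵐ⌋/m + 1/m + 1/K.
ratioLog-compare : ∀ a b c d n m K .{{_ : ℕ.NonZero b}} .{{_ : ℕ.NonZero d}} .{{_ : ℕ.NonZero K}} →
  b ℕ.≤ a → a ℕ.* d ℕ.* (2 ℕ.* K) ℕ.≤ c ℕ.* b ℕ.* suc (2 ℕ.* K) →
  ratioLog a b n ℕ.* m ℕ.* K ℕ.≤ suc (ratioLog c d m) ℕ.* n ℕ.* K ℕ.+ n ℕ.* m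
ratioLog-compare a b c d n m K b≤a h = ℕ.≮⇒≥ λ lt →
  ℕ.<⇒≱ (ℕ.^-monoʳ-< 2 (ℕ.s≤s (ℕ.s≤s ℕ.z≤n)) lt) final
  where
  open ℕ.≤-Reasoning
  open +-*-Solver
  e = ratioLog a b n
  f = suc (ratioLog c d m)
  D = 2 ℕ.* K
  X = n ℕ.* m
  instance
    D≢0 : ℕ.NonZero D
    D≢0 = ℕ.m*n≢0 2 K
    bd≢0 : ℕ.NonZero (b ℕ.^ X ℕ.* d ℕ.^ X)
    bd≢0 = ℕ.m*n≢0 (b ℕ.^ X) (d ℕ.^ X) {{ℕ.m^n≢0 b X}} {{ℕ.m^n≢0 d X}}
    Dp≢0 : ℕ.NonZero (D ℕ.^ (X ℕ.* K))
    Dp≢0 = ℕ.m^n≢0 D (X ℕ.* K)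
  pow-* : ∀ x y o → (x ℕ.* y) ℕ.^ o ≡ x ℕ.^ o ℕ.* y ℕ.^ o
  pow-* x y zero = refl
  pow-* x y (suc o) = trans (cong (x ℕ.* y ℕ.*_) (pow-* x y o))
    (solve 4 (λ x y u v → x :* y :* (u :* v) := x :* u :* (y :* v)) refl x y (x ℕ.^ o) (y ℕ.^ o))
  pow³ : ∀ x y z o → (x ℕ.* y ℕ.* z) ℕ.^ o ≡ x ℕ.^ o ℕ.* y ℕ.^ o ℕ.* z ℕ.^ o
  pow³ x y z o = trans (pow-* (x ℕ.* y) z o) (cong (ℕ._* z ℕ.^ o) (pow-* x y o))
  lower : 2 ℕ.^ (e ℕ.* m) ℕ.* b ℕ.^ X ℕ.≤ a ℕ.^ X
  lower = begin
    2 ℕ.^ (e ℕ.* m) ℕ.* b ℕ.^ X              ≡⟨ cong₂ ℕ._*_ (ℕ.^-*-assoc 2 e m) (ℕ.^-*-assoc b n m) ⟨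
    (2 ℕ.^ e) ℕ.^ m ℕ.* (b ℕ.^ n) ℕ.^ m      ≡⟨ pow-* (2 ℕ.^ e) (b ℕ.^ n) m ⟨
    (2 ℕ.^ e ℕ.* b ℕ.^ n) ℕ.^ m              ≤⟨ ℕ.^-monoˡ-≤ m (ratioLog-lower a b n b≤a) ⟩
    (a ℕ.^ n) ℕ.^ m                          ≡⟨ ℕ.^-*-assoc a n m ⟩
    a ℕ.^ X                                  ∎
  upper : c ℕ.^ X ℕ.≤ 2 ℕ.^ (f ℕ.* n) ℕ.* d ℕ.^ X
  upper = begin
    c ℕ.^ X                                  ≡⟨ cong (c ℕ.^_) (ℕ.*-comm n m) ⟩
    c ℕ.^ (m ℕ.* n)                          ≡⟨ ℕ.^-*-assoc c m n ⟨
    (c ℕ.^ m) ℕ.^ n                          ≤⟨ ℕ.^-monoˡ-≤ n (ratioLog-upper c d m) ⟩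
    (2 ℕ.^ f ℕ.* d ℕ.^ m) ℕ.^ n              ≡⟨ pow-* (2 ℕ.^ f) (d ℕ.^ m) n ⟩
    (2 ℕ.^ f) ℕ.^ n ℕ.* (d ℕ.^ m) ℕ.^ n      ≡⟨ cong₂ ℕ._*_ (ℕ.^-*-assoc 2 f n) (trans (ℕ.^-*-assoc d m n) (cong (d ℕ.^_) (ℕ.*-comm m n))) ⟩
    2 ℕ.^ (f ℕ.* n) ℕ.* d ℕ.^ X              ∎
  core : 2 ℕ.^ (e ℕ.* m) ℕ.* D ℕ.^ X ℕ.≤ 2 ℕ.^ (f ℕ.* n) ℕ.* suc D ℕ.^ X
  core = ℕ.*-cancelʳ-≤ _ _ (b ℕ.^ X ℕ.* d ℕ.^ X) (begin
    2 ℕ.^ (e ℕ.* m) ℕ.* D ℕ.^ X ℕ.* (b ℕ.^ X ℕ.* d ℕ.^ X)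
      ≡⟨ solve 4 (λ p D b d → p :* D :* (b :* d) := p :* b :* d :* D) refl (2 ℕ.^ (e ℕ.* m)) (D ℕ.^ X) (b ℕ.^ X) (d ℕ.^ X) ⟩
    2 ℕ.^ (e ℕ.* m) ℕ.* b ℕ.^ X ℕ.* d ℕ.^ X ℕ.* D ℕ.^ X
      ≤⟨ ℕ.*-monoˡ-≤ (D ℕ.^ X) (ℕ.*-monoˡ-≤ (d ℕ.^ X) lower) ⟩
    a ℕ.^ X ℕ.* d ℕ.^ X ℕ.* D ℕ.^ X
      ≡⟨ pow³ a d D X ⟨
    (a ℕ.* d ℕ.* D) ℕ.^ X
      ≤⟨ ℕ.^-monoˡ-≤ X h ⟩
    (c ℕ.* b ℕ.* suc D) ℕ.^ X
      ≡⟨ pow³ c b (suc D) X ⟩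
    c ℕ.^ X ℕ.* b ℕ.^ X ℕ.* suc D ℕ.^ X
      ≤⟨ ℕ.*-monoˡ-≤ (suc D ℕ.^ X) (ℕ.*-monoˡ-≤ (b ℕ.^ X) upper) ⟩
    2 ℕ.^ (f ℕ.* n) ℕ.* d ℕ.^ X ℕ.* b ℕ.^ X ℕ.* suc D ℕ.^ X
      ≡⟨ solve 4 (λ p D b d → p :* d :* b :* D := p :* D :* (b :* d)) refl (2 ℕ.^ (f ℕ.* n)) (suc D ℕ.^ X) (b ℕ.^ X) (d ℕ.^ X) ⟩
    2 ℕ.^ (f ℕ.* n) ℕ.* suc D ℕ.^ X ℕ.* (b ℕ.^ X ℕ.* d ℕ.^ X) ∎)
  final : 2 ℕ.^ (e ℕ.* m ℕ.* K) ℕ.≤ 2 ℕ.^ (f ℕ.* n ℕ.* K ℕ.+ X)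
  final = ℕ.*-cancelʳ-≤ _ _ (D ℕ.^ (X ℕ.* K)) (begin
    2 ℕ.^ (e ℕ.* m ℕ.* K) ℕ.* D ℕ.^ (X ℕ.* K)
      ≡⟨ cong₂ ℕ._*_ (ℕ.^-*-assoc 2 (e ℕ.* m) K) (ℕ.^-*-assoc D X K) ⟨
    (2 ℕ.^ (e ℕ.* m)) ℕ.^ K ℕ.* (D ℕ.^ X) ℕ.^ K
      ≡⟨ pow-* (2 ℕ.^ (e ℕ.* m)) (D ℕ.^ X) K ⟨
    (2 ℕ.^ (e ℕ.* m) ℕ.* D ℕ.^ X) ℕ.^ K
      ≤⟨ ℕ.^-monoˡ-≤ K core ⟩
    (2 ℕ.^ (f ℕ.* n) ℕ.* suc D ℕ.^ X) ℕ.^ K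
      ≡⟨ pow-* (2 ℕ.^ (f ℕ.* n)) (suc D ℕ.^ X) K ⟩
    (2 ℕ.^ (f ℕ.* n)) ℕ.^ K ℕ.* (suc D ℕ.^ X) ℕ.^ K
      ≡⟨ cong₂ ℕ._*_ (ℕ.^-*-assoc 2 (f ℕ.* n) K)
           (trans (ℕ.^-*-assoc (suc D) X K) (trans (cong (suc D ℕ.^_) (ℕ.*-comm X K)) (sym (ℕ.^-*-assoc (suc D) K X)))) ⟩
    2 ℕ.^ (f ℕ.* n ℕ.* K) ℕ.* (suc D ℕ.^ K) ℕ.^ X
      ≤⟨ ℕ.*-monoʳ-≤ (2 ℕ.^ (f ℕ.* n ℕ.* K)) (ℕ.^-monoˡ-≤ X (bernoulli₂ K)) ⟩
    2 ℕ.^ (f ℕ.* n ℕ.* K) ℕ.* (2 ℕ.* D ℕ.^ K) ℕ.^ X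
      ≡⟨ cong (2 ℕ.^ (f ℕ.* n ℕ.* K) ℕ.*_) (trans (pow-* 2 (D ℕ.^ K) X)
           (cong (2 ℕ.^ X ℕ.*_) (trans (ℕ.^-*-assoc D K X) (cong (D ℕ.^_) (ℕ.*-comm K X))))) ⟩
    2 ℕ.^ (f ℕ.* n ℕ.* K) ℕ.* (2 ℕ.^ X ℕ.* D ℕ.^ (X ℕ.* K))
      ≡⟨ ℕ.*-assoc (2 ℕ.^ (f ℕ.* n ℕ.* K)) (2 ℕ.^ X) (D ℕ.^ (X ℕ.* K)) ⟨
    2 ℕ.^ (f ℕ.* n ℕ.* K) ℕ.* 2 ℕ.^ X ℕ.* D ℕ.^ (X ℕ.* K)
      ≡⟨ cong (ℕ._* D ℕ.^ (X ℕ.* K)) (ℕ.^-distribˡ-+-* 2 (f ℕ.* n ℕ.* K) X) ⟨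
    2 ℕ.^ (f ℕ.* n ℕ.* K ℕ.+ X) ℕ.* D ℕ.^ (X ℕ.* K) ∎)

-- ⌊log₂ rⁿ⁺¹⌋ / (n+1), which is within 1/(n+1) of log₂ r, for r = max(q,1).
logApprox : ℕ → ℚ → ℚ
logApprox n q = ratioLog ℤ.∣ ℚ.↥ r ∣ (ℚ.↧ₙ r) (suc n) ÷ suc n
  where r = q ℚ.⊔ 1ℚ

≥1-fraction : ∀ r → 1ℚ ℚ.≤ r → r ≡ ℤ.∣ ℚ.↥ r ∣ ÷ ℚ.↧ₙ r
≥1-fraction r@(mkℚ (ℤ.+ a)      b _) _ = sym (ℚ.↥p/↧p≡p r)
≥1-fraction r@(mkℚ (ℤ.-[1+ a ]) b _) (ℚ.*≤* ())

log-shift : ∀ n m K p q → suc (2 ℕ.* K) ℕ.≤ m →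
            p ℚ.≤ q ℚ.+ 1 ÷ (2 ℕ.* (2 ℕ.* suc K)) →
            logApprox n p ℚ.≤ logApprox m q ℚ.+ 1 ÷ suc K
log-shift n m K p q m≥ h = begin
  e ÷ suc n
    ≤⟨ ÷-mono {e} {suc n} {suc f ℕ.* K₂ ℕ.+ 1 ℕ.* suc m} {suc m ℕ.* K₂} cross ⟩
  (suc f ℕ.* K₂ ℕ.+ 1 ℕ.* suc m) ÷ (suc m ℕ.* K₂)
    ≡⟨ ÷-+ (suc f) (suc m) 1 K₂ ⟨
  suc f ÷ suc m ℚ.+ 1 ÷ K₂
    ≡⟨ cong (ℚ._+ 1 ÷ K₂) split ⟩
  f ÷ suc m ℚ.+ 1 ÷ suc m ℚ.+ 1 ÷ K₂
    ≡⟨ ℚ.+-assoc (f ÷ suc m) (1 ÷ suc m) (1 ÷ K₂) ⟩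
  f ÷ suc m ℚ.+ (1 ÷ suc m ℚ.+ 1 ÷ K₂)
    ≤⟨ ℚ.+-monoʳ-≤ (f ÷ suc m) (ℚ.+-monoˡ-≤ (1 ÷ K₂) (÷-mono {1} {suc m} {1} {K₂} (ℕ.*-monoʳ-≤ 1 K₂≤m))) ⟩
  f ÷ suc m ℚ.+ (1 ÷ K₂ ℚ.+ 1 ÷ K₂)
    ≤⟨ ℚ.+-monoʳ-≤ (f ÷ suc m) halves ⟩
  f ÷ suc m ℚ.+ 1 ÷ suc K ∎
  where
  open ℚ.≤-Reasoning
  K₂ = 2 ℕ.* suc K
  D = 2 ℕ.* K₂
  δ = 1 ÷ D
  r = p ℚ.⊔ 1ℚ
  s = q ℚ.⊔ 1ℚ
  a = ℤ.∣ ℚ.↥ r ∣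
  b = ℚ.↧ₙ r
  c = ℤ.∣ ℚ.↥ s ∣
  d = ℚ.↧ₙ s
  e = ratioLog a b (suc n)
  f = ratioLog c d (suc m)
  r≡ : r ≡ a ÷ b
  r≡ = ≥1-fraction r (ℚ.p≤q⊔p p 1ℚ)
  s≡ : s ≡ c ÷ d
  s≡ = ≥1-fraction s (ℚ.p≤q⊔p q 1ℚ)
  ge1 : ∀ x y .{{_ : ℕ.NonZero y}} → 1ℚ ℚ.≤ x ÷ y → y ℕ.≤ x
  ge1 x y h = subst₂ ℕ._≤_ (ℕ.*-identityˡ y) (ℕ.*-identityʳ x) (÷-cancel {1} {1} {x} {y} h)
  b≤a : b ℕ.≤ a
  b≤a = ge1 a b (subst (1ℚ ℚ.≤_) r≡ (ℚ.p≤q⊔p p 1ℚ))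
  d≤c : d ℕ.≤ c
  d≤c = ge1 c d (subst (1ℚ ℚ.≤_) s≡ (ℚ.p≤q⊔p q 1ℚ))
  K₂≤m : K₂ ℕ.≤ suc m
  K₂≤m = ℕ.≤-trans (ℕ.≤-reflexive (ℕ.*-suc 2 K)) (ℕ.s≤s m≥)
  0≤δ : 0ℚ ℚ.≤ δ
  0≤δ = ÷-mono {0} {1} {1} {D} ℕ.z≤n
  rs : a ÷ b ℚ.≤ (c ℕ.* D ℕ.+ 1 ℕ.* d) ÷ (d ℕ.* D)
  rs = subst₂ ℚ._≤_ r≡ (trans (cong (ℚ._+ δ) s≡) (÷-+ c d 1 D)) (⊔1-shift {p} {q} 0≤δ h)
  ratio : a ℕ.* d ℕ.* D ℕ.≤ c ℕ.* b ℕ.* suc D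
  ratio = ℕR.begin
    a ℕ.* d ℕ.* D                 ℕR.≡⟨ ℕ.*-assoc a d D ⟩
    a ℕ.* (d ℕ.* D)               ℕR.≤⟨ ÷-cancel {a} {b} {c ℕ.* D ℕ.+ 1 ℕ.* d} {d ℕ.* D} rs ⟩
    (c ℕ.* D ℕ.+ 1 ℕ.* d) ℕ.* b   ℕR.≤⟨ ℕ.*-monoˡ-≤ b (ℕ.+-monoʳ-≤ (c ℕ.* D) (ℕ.*-monoʳ-≤ 1 d≤c)) ⟩
    (c ℕ.* D ℕ.+ 1 ℕ.* c) ℕ.* b   ℕR.≡⟨ solve 3 (λ c D b → (c :* D :+ con 1 :* c) :* b := c :* b :* (con 1 :+ D)) refl c D b ⟩
    c ℕ.* b ℕ.* suc D             ℕR.∎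
    where
    module ℕR = ℕ.≤-Reasoning
    open +-*-Solver
  cross : e ℕ.* (suc m ℕ.* K₂) ℕ.≤ (suc f ℕ.* K₂ ℕ.+ 1 ℕ.* suc m) ℕ.* suc n
  cross = subst₂ ℕ._≤_ (ℕ.*-assoc e (suc m) K₂)
    (solve 4 (λ f n k m → f :* n :* k :+ n :* m := (f :* k :+ con 1 :* m) :* n) refl (suc f) (suc n) K₂ (suc m))
    (ratioLog-compare a b c d (suc n) (suc m) K₂ b≤a ratio)
    where open +-*-Solver
  split : suc f ÷ suc m ≡ f ÷ suc m ℚ.+ 1 ÷ suc m
  split = trans (ℚ.≤-antisym
      (÷-mono {suc f} {suc m} {f ℕ.* suc m ℕ.+ 1 ℕ.* suc m} {suc m ℕ.* suc m} (ℕ.≤-reflexive eq))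
      (÷-mono {f ℕ.* suc m ℕ.+ 1 ℕ.* suc m} {suc m ℕ.* suc m} {suc f} {suc m} (ℕ.≤-reflexive (sym eq))))
    (sym (÷-+ f (suc m) 1 (suc m)))
    where
    open +-*-Solver
    eq = solve 2 (λ f m → (con 1 :+ f) :* (m :* m) := (f :* m :+ con 1 :* m) :* m) refl f (suc m)
  halves : 1 ÷ K₂ ℚ.+ 1 ÷ K₂ ℚ.≤ 1 ÷ suc K
  halves = subst (ℚ._≤ 1 ÷ suc K) (sym (÷-+ 1 K₂ 1 K₂))
    (÷-mono {1 ℕ.* K₂ ℕ.+ 1 ℕ.* K₂} {K₂ ℕ.* K₂} {1} {suc K} (ℕ.≤-reflexive
      (solve 1 (λ k → (con 1 :* (con 2 :* k) :+ con 1 :* (con 2 :* k)) :* k := con 1 :* ((con 2 :* k) :* (con 2 :* k))) refl (suc K))))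
    where open +-*-Solver

log-uc : UniformlyCauchy logApprox
log-uc ε 0<ε = δ , ÷-positive (2 ℕ.* (2 ℕ.* suc K)) , suc (2 ℕ.* K) , λ m n p q m≥ n≥ h →
  ℚ.≤-trans
    (abs-intro {logApprox m p} {logApprox n q}
      (log-shift m n K p q n≥ (abs-elimˡ {p} {q} h)) (log-shift n m K q p m≥ (abs-elimʳ {p} {q} h)))
    (proj₂ (archimedean ε 0<ε))
  where
  K = proj₁ (archimedean ε 0<ε)
  δ = 1 ÷ (2 ℕ.* (2 ℕ.* suc K))

-- log₂ max(x,1), i.e. the binary logarithm on [1,∞) and 0 below 1.
-- In particular log₂ (log₂ (fromℕ 1)) is 0.
log₂ : ℝ → ℝ
log₂ = extend logApprox log-uc

-- log_b n for a base b ≥ 2, so that log₂ b ≥ 1.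
logBase : ℕ → ℕ → ℝ
logBase b n = log₂ (fromℕ n) *ℝ recip (log₂ (fromℕ b))

∑ : {A : Set} → List A → (A → ℝ) → ℝ
∑ xs f = foldr (λ x s → f x +ℝ s) 0ℝ xs

-- f = o(g) for non-negative f and g
_∈o_ : (ℕ → ℝ) → (ℕ → ℝ) → Set
f ∈o g = ∀ ε → 0ℝ <ℝ ε → ∃[ N ] (∀ n → N ℕ.≤ n → f n ≤ℝ ε *ℝ g n)

-- The alphabet {1,…,σ} is represented by Fin σ, and positions are 0-based:
-- T[i+1,n] is drop i T.
Word : ℕ → Set
Word σ = List (Fin σ)

module _ {σ : ℕ} where

  occ : Fin σ → Word σ → ℕ
  occ c T = length (filter (c Fin.≟_) T)

  H₀ : Word σ → ℝ
  H₀ T = ∑ (allFin σ) λ c →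
    fromℚ (occ c T ÷ length T) *ℝ log₂ (fromℚ (length T ÷ occ c T))

  symbolAfter : Word σ → Word σ → Word σ
  symbolAfter []      []      = []
  symbolAfter []      (t ∷ _) = [ t ]
  symbolAfter (_ ∷ _) []      = []
  symbolAfter (w ∷ W) (t ∷ T) with w Fin.≟ t
  ... | yes _ = symbolAfter W T
  ... | no  _ = []

  -- T_W; overlapping occurrences of W count, and for W = [] it is T itself.
  following : Word σ → Word σ → Word σ
  following W T = concatMap (symbolAfter W) (tails T)

  words : ℕ → List (Word σ)
  words zero    = [ [] ]
  words (suc k) = concatMap (λ c → map (c ∷_) (words k)) (allFin σ)

  H : ℕ → Word σ → ℝ
  H k T = ∑ (words k) λ W →
    fromℚ (length (following W T) ÷ length T) *ℝ H₀ (following W T)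

  module _ (T : Word σ) (i : ℕ) where

    record Source (P : Word σ) (s : ℕ) : Set where
      field
        earlier : s ℕ.< i
        occurs  : Prefix _≡_ P (drop s T)

    Distance : Word σ → ℕ → Set
    Distance P d = ∃[ s ] Source P s × s ℕ.+ d ≡ i

    Copying : Word σ → Set
    Copying P = ∃[ s ] Source P s

    Literal : Fin σ → Word σ → Set
    Literal c P = P ≡ [ c ] × c ∉ take i T

  start : (Ps : List (Word σ)) → Fin (length Ps) → ℕ
  start Ps j = length (concat (take (toℕ j) Ps))

  record LZParsing (T : Word σ) : Set where
    field
      phrases  : List (Word σ)
      factors  : concat phrases ≡ T
      nonEmpty : All (_≢ []) phrases

    #phrases : ℕ
    #phrases = length phrases

    phrase : Fin #phrases → Word σ
    phrase = lookup phrases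

    position : Fin #phrases → ℕ
    position = start phrases

    field
      valid : ∀ j → Copying T (position j) (phrase j)
                  ⊎ ∃[ c ] Literal T (position j) c (phrase j)

data Code (σ : ℕ) : Set where
  copy    : (d ℓ : ℕ) → Code σ
  literal : (c : Fin σ) → Code σ

data RightmostCode {σ} (T : Word σ) (i : ℕ) (P : Word σ) : Code σ → Set where
  copy    : ∀ {d} → Distance T i P d → (∀ d′ → Distance T i P d′ → d ℕ.≤ d′) →
            RightmostCode T i P (copy d (length P))
  literal : ∀ {c} → Literal T i c P → RightmostCode T i P (literal c)

IsRightmostEncoding : ∀ {σ} {T : Word σ} (𝒫 : LZParsing T) → (Fin (LZParsing.#phrases 𝒫) → Code σ) → Set
IsRightmostEncoding {T = T} 𝒫 code = ∀ j → RightmostCode T (position j) (phrase j) (code j)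
  where open LZParsing 𝒫

-- log₂ d + O(1 + log log d + log ℓ), respectively log₂ σ + O(1 + log log σ), where
-- C is the constant hidden in the O(·).
maxBits : ∀ {σ} → ℝ → Code σ → ℝ
maxBits C (copy d ℓ) =
  log₂ (fromℕ d) +ℝ C *ℝ (1ℝ +ℝ log₂ (log₂ (fromℕ d)) +ℝ log₂ (fromℕ ℓ))
maxBits {σ} C (literal c) =
  log₂ (fromℕ σ) +ℝ C *ℝ (1ℝ +ℝ log₂ (log₂ (fromℕ σ)))

-- Give a word P the probability q(P) = u(P) / ((|P|+1)(|P|+2)), where u draws the
-- first k symbols uniformly and each later symbol with its empirical frequency in T
-- after the preceding k symbols. For a phrase P with distance d one has
-- log d = log (1/q(P)) + log (d q(P)). Each symbol of T is charged for its context
-- at most once, so Σ log (1/q(P)) ≤ n Hₖ(T) + c k log σ + Σ log ((|P|+1)(|P|+2)).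
-- For a fixed word w the rightmost distances of the phrases equal to w telescope
-- along T; counting σ for a literal, they add up to at most n + σ. Summing over w
-- weighted by q gives Σ d q(P) ≤ n + σ. The terms log (d q(P)), log |P| and
-- log log d are then bounded by log x ≤ K + x/2ᴷ for a large constant K. What
-- remains is O(cK + c k log σ) plus a small multiple of n log σ, and this is
-- o(n log σ) because c log n ≤ α n log σ and k log σ = o(log n).
--
-- The estimate is made on the m-th rational approximations of the logarithms, which
-- are additive up to an error 1/(m+1), so that the total error vanishes as m → ∞.
module Submission where

open import Defs
open import Data.Nat using (ℕ; _≤_; _*_)
open import Data.Fin using (Fin)
open import Data.List using (length; allFin)
open import Data.Product using (∃-syntax)
open import Relation.Binary.PropositionalEquality using (_≡_)

open import Algebra.Bundles using (CommutativeSemiring; CommutativeRing)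
open import Algebra.Structures using (IsCommutativeSemiring)
import Algebra.Solver.Ring.NaturalCoefficients.Default as NaturalCoefficients
import Data.Nat as ℕ
import Data.Nat.Properties as ℕ
import Data.Nat.DivMod as ℕ
import Data.Nat.Solver as ℕ
open import Data.Nat using (zero; suc; z≤n; s≤s)
open import Data.Nat.Logarithm using (⌊log₂_⌋; ⌊log₂[2^n]⌋≡n)
import Data.Integer as ℤ
import Data.Integer.Properties as ℤ
open import Data.Rational.Unnormalised.Base using (mkℚᵘ)
import Data.Rational.Unnormalised.Properties as ℚᵘ
open import Data.Rational.Base as ℚ using (ℚ; 0ℚ; 1ℚ; ½) renaming (_≤_ to _≼_)
import Data.Rational.Properties as ℚ
open import Data.Fin.Base using (toℕ) renaming (zero to fzero; suc to fsuc)
import Data.Fin.Properties as Fin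
open import Data.List.Base
  using (List; []; _∷_; [_]; _++_; map; concat; concatMap; downFrom; filter; take; drop; tails; lookup)
import Data.List.Properties as List
open import Data.List.Membership.Propositional using (_∈_; lose)
open import Data.List.Membership.Propositional.Properties using (∈-concatMap⁺; ∈-map⁺; ∈-allFin; ∈-++⁺ˡ; ∈-++⁺ʳ; ∈-downFrom⁺)
open import Data.List.Relation.Unary.Any using (here; there)
open import Data.List.Relation.Unary.All using (All; []; _∷_)
open import Data.List.Relation.Binary.Prefix.Heterogeneous using (Prefix; []; _∷_)
open import Data.Product.Base using (_×_; _,_; proj₁; proj₂)
open import Data.Sum.Base using (inj₁; inj₂)
open import Level using (0ℓ)
open import Function.Base using (_∘_; id)
open import Relation.Nullary using (Dec; yes; no; contradiction)
open import Relation.Binary.PropositionalEquality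
  using (_≢_; refl; sym; trans; cong; cong₂; subst; subst₂; module ≡-Reasoning)

-- The logarithm is clamped to 0 below 1, so it vanishes on probabilities and log (1/q) never occurs
-- as a single term. Instead an arbitrary argument y is multiplied by the factors of q one at a
-- time; a factor a/b costs log (b/a), and log (y q) is left at the end. The linear bound K + x/2ᴷ
-- takes the place of concavity of the logarithm: it turns a sum of logarithms into sums that are
-- under control, Σ |P| = n and Σ d q(P) ≤ n + σ, at the price of K per phrase. The order of the
-- choices matters. K depends only on ε, C, α and the constant in σ = O(n). Then n is taken so large
-- that K bits per phrase are negligible. Only for fixed n is the precision m increased, which
-- removes the additivity error n/(m+1); so the bound on n is uniform over texts and parsings,
-- although the precision required is not.

infixl 6 _⊕_
infixl 7 _⊗_ _⊘_

-- Arithmetic on ℚ normalises fractions, which makes comparing open terms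
-- expensive; sealing the operations keeps them as neutral terms.
opaque
  _⊕_ _⊗_ : ℚ → ℚ → ℚ
  _⊕_ = ℚ._+_
  _⊗_ = ℚ._*_

  _⊘_ : ℕ → ℕ → ℚ
  _⊘_ = _÷_

  ι : ℕ → ℚ
  ι n = n ÷ 1

  lg : ℕ → ℚ → ℚ
  lg = logApprox

opaque
  unfolding _⊕_

  ⊕-⊗-isCommutativeSemiring : IsCommutativeSemiring _≡_ _⊕_ _⊗_ 0ℚ 1ℚ
  ⊕-⊗-isCommutativeSemiring = CommutativeRing.isCommutativeSemiring ℚ.+-*-commutativeRing

⊕-⊗-commutativeSemiring : CommutativeSemiring 0ℓ 0ℓ
⊕-⊗-commutativeSemiring = record { isCommutativeSemiring = ⊕-⊗-isCommutativeSemiring }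

open CommutativeSemiring ⊕-⊗-commutativeSemiring
  using () renaming (+-identityˡ to ⊕-identityˡ; +-identityʳ to ⊕-identityʳ; zeroˡ to ⊗-zeroˡ; zeroʳ to ⊗-zeroʳ;
    *-identityˡ to ⊗-identityˡ; *-identityʳ to ⊗-identityʳ; *-assoc to ⊗-assoc; *-comm to ⊗-comm;
    +-assoc to ⊕-assoc; +-comm to ⊕-comm; distribˡ to ⊗-distribˡ-⊕; distribʳ to ⊗-distribʳ-⊕) public

module ⊕-⊗-Solver = NaturalCoefficients ⊕-⊗-commutativeSemiring

-- Fractions and their order

÷-≡ : ∀ {a b c d} .{{_ : ℕ.NonZero b}} .{{_ : ℕ.NonZero d}} → a ℕ.* d ≡ c ℕ.* b → a ÷ b ≡ c ÷ d
÷-≡ {a} {b} {c} {d} eq = ℚ.≤-antisym (÷-mono {a} {b} {c} {d} (ℕ.≤-reflexive eq))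
                                      (÷-mono {c} {d} {a} {b} (ℕ.≤-reflexive (sym eq)))

÷-* : ∀ a b c d .{{_ : ℕ.NonZero b}} .{{_ : ℕ.NonZero d}} → (a ÷ b) ℚ.* (c ÷ d) ≡ (a ℕ.* c) ÷ (b ℕ.* d)
÷-* a (suc b) c (suc d) = ℚ.toℚᵘ-injective
  (ℚᵘ.≃-trans (ℚ.toℚᵘ-homo-* (a ÷ suc b) (c ÷ suc d))
  (ℚᵘ.≃-trans (ℚᵘ.*-cong (ℚ.toℚᵘ-fromℚᵘ (mkℚᵘ (ℤ.+ a) b)) (ℚ.toℚᵘ-fromℚᵘ (mkℚᵘ (ℤ.+ c) d)))
  (ℚᵘ.≃-trans (ℚᵘ.≃-reflexive (cong (λ z → mkℚᵘ z (d ℕ.+ b ℕ.* suc d)) (sym (ℤ.pos-* a c))))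
    (ℚᵘ.≃-sym (ℚ.toℚᵘ-fromℚᵘ (mkℚᵘ (ℤ.+ (a ℕ.* c)) (d ℕ.+ b ℕ.* suc d)))))))

opaque
  unfolding _⊕_

  ⊕-mono : ∀ {a b c d} → a ≼ b → c ≼ d → a ⊕ c ≼ b ⊕ d
  ⊕-mono = ℚ.+-mono-≤

  ⊗-monoˡ : ∀ {a b c} → 0ℚ ≼ a → b ≼ c → a ⊗ b ≼ a ⊗ c
  ⊗-monoˡ {a} 0≤a = ℚ.*-monoˡ-≤-nonNeg a {{ℚ.nonNegative 0≤a}}

  ⊗-monoʳ : ∀ {a b c} → 0ℚ ≼ a → b ≼ c → b ⊗ a ≼ c ⊗ a
  ⊗-monoʳ {a} 0≤a = ℚ.*-monoʳ-≤-nonNeg a {{ℚ.nonNegative 0≤a}}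

  ι-mono : ∀ {m n} → m ≤ n → ι m ≼ ι n
  ι-mono {m} {n} m≤n = ÷-mono {m} {1} {n} {1} (ℕ.*-monoˡ-≤ 1 m≤n)

  ι-0 : ι 0 ≡ 0ℚ
  ι-0 = refl

  ι-1 : ι 1 ≡ 1ℚ
  ι-1 = refl

  ι-+ : ∀ m n → ι (m ℕ.+ n) ≡ ι m ⊕ ι n
  ι-+ m n = trans (cong ι (sym (cong₂ ℕ._+_ (ℕ.*-identityʳ m) (ℕ.*-identityʳ n)))) (sym (÷-+ m 1 n 1))

  ι-* : ∀ m n → ι (m ℕ.* n) ≡ ι m ⊗ ι n
  ι-* m n = sym (÷-* m 1 n 1)

  ι-cancel : ∀ n .{{_ : ℕ.NonZero n}} {a b} → ι n ⊗ a ≼ ι n ⊗ b → a ≼ b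
  ι-cancel (suc n) = ℚ.*-cancelˡ-≤-pos (ι (suc n)) {{ℚ.normalize-pos (suc n) 1}}

  ⊘-nonNeg : ∀ a b → 0ℚ ≼ a ⊘ b
  ⊘-nonNeg a zero    = ℚ.≤-refl
  ⊘-nonNeg a (suc b) = ÷-mono {0} {1} {a} {suc b} z≤n

  ⊘-1 : ∀ a → a ⊘ 1 ≡ ι a
  ⊘-1 a = refl

  ⊘-zero : ∀ a → a ⊘ 0 ≡ 0ℚ
  ⊘-zero a = refl

  ι⊗⊘ : ∀ a b .{{_ : ℕ.NonZero b}} → ι b ⊗ (a ⊘ b) ≡ ι a
  ι⊗⊘ a (suc b) = trans (÷-* (suc b) 1 a (suc b))
    (÷-≡ {suc b ℕ.* a} {1 ℕ.* suc b} {a} {1} (solve 2 (λ a b → b :* a :* con 1 := a :* (con 1 :* b)) refl a (suc b)))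
    where open ℕ.+-*-Solver

a≼a⊕b : ∀ {a b} → 0ℚ ≼ b → a ≼ a ⊕ b
a≼a⊕b {a} {b} 0≤b = subst (_≼ a ⊕ b) (⊕-identityʳ a) (⊕-mono (ℚ.≤-refl {a}) 0≤b)

b≼a⊕b : ∀ {a b} → 0ℚ ≼ a → b ≼ a ⊕ b
b≼a⊕b {a} {b} 0≤a = subst (_≼ a ⊕ b) (⊕-identityˡ b) (⊕-mono 0≤a (ℚ.≤-refl {b}))

⊕-nonNeg : ∀ {a b} → 0ℚ ≼ a → 0ℚ ≼ b → 0ℚ ≼ a ⊕ b
⊕-nonNeg 0≤a 0≤b = ℚ.≤-trans 0≤a (a≼a⊕b 0≤b)

⊗-nonNeg : ∀ {a b} → 0ℚ ≼ a → 0ℚ ≼ b → 0ℚ ≼ a ⊗ b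
⊗-nonNeg {a} {b} 0≤a 0≤b = subst (_≼ a ⊗ b) (⊗-zeroʳ a) (⊗-monoˡ 0≤a 0≤b)

⊗-mono : ∀ {a b c d} → 0ℚ ≼ b → 0ℚ ≼ c → a ≼ b → c ≼ d → a ⊗ c ≼ b ⊗ d
⊗-mono 0≤b 0≤c a≤b c≤d = ℚ.≤-trans (⊗-monoʳ 0≤c a≤b) (⊗-monoˡ 0≤b c≤d)

ι-nonNeg : ∀ n → 0ℚ ≼ ι n
ι-nonNeg n = subst (_≼ ι n) ι-0 (ι-mono z≤n)

ι-suc : ∀ n → ι (suc n) ≡ 1ℚ ⊕ ι n
ι-suc n = trans (ι-+ 1 n) (cong (_⊕ ι n) ι-1)

-- Binary logarithms

^-distribʳ-* : ∀ a b n → (a * b) ℕ.^ n ≡ a ℕ.^ n * b ℕ.^ n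
^-distribʳ-* a b zero    = refl
^-distribʳ-* a b (suc n) = trans (cong (a * b *_) (^-distribʳ-* a b n))
  (solve 4 (λ a b u v → a :* b :* (u :* v) := a :* u :* (b :* v)) refl a b (a ℕ.^ n) (b ℕ.^ n))
  where open ℕ.+-*-Solver

n<2^n : ∀ n → n ℕ.< 2 ℕ.^ n
n<2^n zero    = s≤s z≤n
n<2^n (suc n) = ℕ.≤-trans (ℕ.+-mono-≤ (ℕ.m^n>0 2 n) (n<2^n n))
  (ℕ.≤-reflexive (cong (2 ℕ.^ n ℕ.+_) (sym (ℕ.+-identityʳ (2 ℕ.^ n)))))

2^-reflects-< : ∀ m n → 2 ℕ.^ m ℕ.< 2 ℕ.^ n → m ℕ.< n
2^-reflects-< m n lt = ℕ.≰⇒> λ n≤m → ℕ.<⇒≱ lt (ℕ.^-monoʳ-≤ 2 n≤m)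

module _ (a b n : ℕ) .{{b≢0 : ℕ.NonZero b}} where
  private instance
    bⁿ≢0 : ℕ.NonZero (b ℕ.^ n)
    bⁿ≢0 = ℕ.m^n≢0 b n

  -- Strictness is what a comparison of floors needs: 2^e < 2^(f+1) gives e ≤ f, whereas a weak
  -- inequality would lose one unit.
  ratioLog-upper-< : a ℕ.^ n ℕ.< 2 ℕ.^ suc (ratioLog a b n) * b ℕ.^ n
  ratioLog-upper-< = begin-strict
    a ℕ.^ n                                 ≡⟨ ℕ.m≡m%n+[m/n]*n (a ℕ.^ n) (b ℕ.^ n) ⟩
    a ℕ.^ n ℕ.% b ℕ.^ n ℕ.+ q * b ℕ.^ n     <⟨ ℕ.+-monoˡ-< (q * b ℕ.^ n) (ℕ.m%n<n (a ℕ.^ n) (b ℕ.^ n)) ⟩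
    suc q * b ℕ.^ n                         ≤⟨ ℕ.*-monoˡ-≤ (b ℕ.^ n) (log-upper q) ⟩
    2 ℕ.^ suc (ratioLog a b n) * b ℕ.^ n    ∎
    where
    open ℕ.≤-Reasoning
    q = a ℕ.^ n ℕ./ b ℕ.^ n

ratioLog-mono : ∀ a b c d n .{{_ : ℕ.NonZero b}} .{{_ : ℕ.NonZero d}} → b ≤ a → a * d ≤ c * b →
                ratioLog a b n ≤ ratioLog c d n
ratioLog-mono a b c d n b≤a ad≤cb = ℕ.<⇒≤pred (2^-reflects-< e (suc f) (ℕ.*-cancelʳ-< (b ℕ.^ n * d ℕ.^ n) _ _ (begin-strict
  2 ℕ.^ e * (b ℕ.^ n * d ℕ.^ n)         ≡⟨ ℕ.*-assoc (2 ℕ.^ e) (b ℕ.^ n) (d ℕ.^ n) ⟨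
  2 ℕ.^ e * b ℕ.^ n * d ℕ.^ n           ≤⟨ ℕ.*-monoˡ-≤ (d ℕ.^ n) (ratioLog-lower a b n b≤a) ⟩
  a ℕ.^ n * d ℕ.^ n                     ≡⟨ ^-distribʳ-* a d n ⟨
  (a * d) ℕ.^ n                         ≤⟨ ℕ.^-monoˡ-≤ n ad≤cb ⟩
  (c * b) ℕ.^ n                         ≡⟨ ^-distribʳ-* c b n ⟩
  c ℕ.^ n * b ℕ.^ n                     <⟨ ℕ.*-monoˡ-< (b ℕ.^ n) {{ℕ.m^n≢0 b n}} (ratioLog-upper-< c d n) ⟩
  2 ℕ.^ suc f * d ℕ.^ n * b ℕ.^ n       ≡⟨ solve 3 (λ p b d → p :* d :* b := p :* (b :* d)) refl (2 ℕ.^ suc f) (b ℕ.^ n) (d ℕ.^ n) ⟩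
  2 ℕ.^ suc f * (b ℕ.^ n * d ℕ.^ n)     ∎)))
  where
  open ℕ.≤-Reasoning
  open ℕ.+-*-Solver
  e = ratioLog a b n
  f = ratioLog c d n

-- The two floors on the right lose less than 2 together, which for integers means at most 1.
-- Divided by the exponent, this is the additivity error of the approximate logarithm.
ratioLog-* : ∀ a b c d u v n .{{_ : ℕ.NonZero b}} .{{_ : ℕ.NonZero d}} .{{_ : ℕ.NonZero v}} →
             v ≤ u → u * (b * d) ≤ a * c * v →
             ratioLog u v n ≤ suc (ratioLog a b n ℕ.+ ratioLog c d n)
ratioLog-* a b c d u v n v≤u h = ℕ.<⇒≤pred (2^-reflects-< g (suc (suc (e ℕ.+ f))) (ℕ.*-cancelʳ-< (v ℕ.^ n * (b ℕ.^ n * d ℕ.^ n)) _ _ (begin-strict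
  2 ℕ.^ g * (v ℕ.^ n * (b ℕ.^ n * d ℕ.^ n))     ≡⟨ ℕ.*-assoc (2 ℕ.^ g) (v ℕ.^ n) (b ℕ.^ n * d ℕ.^ n) ⟨
  2 ℕ.^ g * v ℕ.^ n * (b ℕ.^ n * d ℕ.^ n)       ≤⟨ ℕ.*-monoˡ-≤ (b ℕ.^ n * d ℕ.^ n) (ratioLog-lower u v n v≤u) ⟩
  u ℕ.^ n * (b ℕ.^ n * d ℕ.^ n)                 ≡⟨ cong (u ℕ.^ n *_) (^-distribʳ-* b d n) ⟨
  u ℕ.^ n * (b * d) ℕ.^ n                       ≡⟨ ^-distribʳ-* u (b * d) n ⟨
  (u * (b * d)) ℕ.^ n                           ≤⟨ ℕ.^-monoˡ-≤ n h ⟩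
  (a * c * v) ℕ.^ n                             ≡⟨ trans (^-distribʳ-* (a * c) v n) (cong (_* v ℕ.^ n) (^-distribʳ-* a c n)) ⟩
  a ℕ.^ n * c ℕ.^ n * v ℕ.^ n                   <⟨ ℕ.*-monoˡ-< (v ℕ.^ n) {{ℕ.m^n≢0 v n}} (ℕ.*-mono-< (ratioLog-upper-< a b n) (ratioLog-upper-< c d n)) ⟩
  2 ℕ.^ suc e * b ℕ.^ n * (2 ℕ.^ suc f * d ℕ.^ n) * v ℕ.^ n
    ≡⟨ solve 5 (λ p q b d v → p :* b :* (q :* d) :* v := p :* q :* (v :* (b :* d))) refl (2 ℕ.^ suc e) (2 ℕ.^ suc f) (b ℕ.^ n) (d ℕ.^ n) (v ℕ.^ n) ⟩
  2 ℕ.^ suc e * 2 ℕ.^ suc f * (v ℕ.^ n * (b ℕ.^ n * d ℕ.^ n))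
    ≡⟨ cong (_* (v ℕ.^ n * (b ℕ.^ n * d ℕ.^ n))) (trans (sym (ℕ.^-distribˡ-+-* 2 (suc e) (suc f))) (cong (λ z → 2 ℕ.^ suc z) (ℕ.+-suc e f))) ⟩
  2 ℕ.^ suc (suc (e ℕ.+ f)) * (v ℕ.^ n * (b ℕ.^ n * d ℕ.^ n)) ∎)))
  where
  open ℕ.≤-Reasoning
  open ℕ.+-*-Solver
  e = ratioLog a b n
  f = ratioLog c d n
  g = ratioLog u v n

-- At powers of two the approximation is exact for every exponent, so bounds that pass through a
-- power of two carry no error term.
ratioLog-2^ : ∀ q n → ratioLog (2 ℕ.^ q) 1 n ≡ q * n
ratioLog-2^ q n = trans (cong ⌊log₂_⌋ (trans (ℕ./-congʳ {{ℕ.m^n≢0 1 n}} (ℕ.^-zeroˡ n))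
  (trans (ℕ.n/1≡n _) (ℕ.^-*-assoc 2 q n)))) (⌊log₂[2^n]⌋≡n (q * n))

1≼÷⇒≤ : ∀ {a b} .{{_ : ℕ.NonZero b}} → 1ℚ ≼ a ÷ b → b ≤ a
1≼÷⇒≤ {a} {b} h = subst₂ _≤_ (ℕ.*-identityˡ b) (ℕ.*-identityʳ a) (÷-cancel {1} {1} {a} {b} h)

1≼fraction⇒≤ : ∀ {r} → 1ℚ ≼ r → ℚ.↧ₙ r ≤ ℤ.∣ ℚ.↥ r ∣
1≼fraction⇒≤ {r} 1≤r = 1≼÷⇒≤ (subst (1ℚ ≼_) (≥1-fraction r 1≤r) 1≤r)

module _ (m : ℕ) where

  logApprox-mono : ∀ {x y} → x ≼ y → logApprox m x ≼ logApprox m y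
  logApprox-mono {x} {y} x≤y = ÷-mono {ratioLog a b (suc m)} {suc m} {ratioLog c d (suc m)} {suc m} (ℕ.*-monoˡ-≤ (suc m)
    (ratioLog-mono a b c d (suc m) (1≼fraction⇒≤ 1≤r)
      (÷-cancel {a} {b} {c} {d} (subst₂ _≼_ (≥1-fraction r 1≤r) (≥1-fraction s 1≤s) (ℚ.⊔-monoˡ-≤ 1ℚ x≤y)))))
    where
    r = x ℚ.⊔ 1ℚ
    s = y ℚ.⊔ 1ℚ
    1≤r = ℚ.p≤q⊔p x 1ℚ
    1≤s = ℚ.p≤q⊔p y 1ℚ
    a = ℤ.∣ ℚ.↥ r ∣
    b = ℚ.↧ₙ r
    c = ℤ.∣ ℚ.↥ s ∣
    d = ℚ.↧ₙ s

  logApprox-2^ : ∀ q {x} → x ≼ (2 ℕ.^ q) ÷ 1 → logApprox m x ≼ q ÷ 1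
  logApprox-2^ q {x} x≤ = ÷-mono {ratioLog a b (suc m)} {suc m} {q} {1} (ℕ.≤-trans (ℕ.≤-reflexive (ℕ.*-identityʳ (ratioLog a b (suc m))))
    (ℕ.≤-trans (ratioLog-mono a b (2 ℕ.^ q) 1 (suc m) (1≼fraction⇒≤ 1≤r)
      (÷-cancel {a} {b} {2 ℕ.^ q} {1} (subst (_≼ (2 ℕ.^ q) ÷ 1) (≥1-fraction r 1≤r)
        (ℚ.⊔-lub x≤ (÷-mono {1} {1} {2 ℕ.^ q} {1} (ℕ.*-monoˡ-≤ 1 (ℕ.m^n>0 2 q)))))))
      (ℕ.≤-reflexive (ratioLog-2^ q (suc m)))))
    where
    r = x ℚ.⊔ 1ℚ
    1≤r = ℚ.p≤q⊔p x 1ℚ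
    a = ℤ.∣ ℚ.↥ r ∣
    b = ℚ.↧ₙ r

  logApprox-2^-≥ : ∀ q {x} → (2 ℕ.^ q) ÷ 1 ≼ x → q ÷ 1 ≼ logApprox m x
  logApprox-2^-≥ q {x} x≥ = ÷-mono {q} {1} {ratioLog c d (suc m)} {suc m} (ℕ.≤-trans (ℕ.≤-reflexive (sym (ratioLog-2^ q (suc m))))
    (ℕ.≤-trans (ratioLog-mono (2 ℕ.^ q) 1 c d (suc m) (ℕ.m^n>0 2 q)
      (÷-cancel {2 ℕ.^ q} {1} {c} {d} (subst ((2 ℕ.^ q) ÷ 1 ≼_) (≥1-fraction s 1≤s)
        (ℚ.≤-trans x≥ (ℚ.p≤p⊔q x 1ℚ)))))
      (ℕ.≤-reflexive (sym (ℕ.*-identityʳ (ratioLog c d (suc m)))))))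
    where
    s = x ℚ.⊔ 1ℚ
    1≤s = ℚ.p≤q⊔p x 1ℚ
    c = ℤ.∣ ℚ.↥ s ∣
    d = ℚ.↧ₙ s

  -- Clamping works in favour of this direction, since max(xy,1) ≤ max(x,1) max(y,1) for x, y ≥ 0.
  -- The converse fails: for x = 4 and y = 1/4 the left side is 0.
  logApprox-* : ∀ {x y} → 0ℚ ≼ x → 0ℚ ≼ y →
                logApprox m (x ℚ.* y) ≼ logApprox m x ℚ.+ logApprox m y ℚ.+ 1 ÷ suc m
  logApprox-* {x} {y} 0≤x 0≤y = ℚ.≤-trans
    (÷-mono {g} {suc m} {suc (e ℕ.+ f)} {suc m} (ℕ.*-monoˡ-≤ (suc m)
      (ratioLog-* a b c d u v (suc m) (1≼fraction⇒≤ 1≤t)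
        (÷-cancel {u} {v} {a * c} {b * d}
          (subst₂ _≼_ (≥1-fraction t 1≤t) (trans (cong₂ ℚ._*_ (≥1-fraction r 1≤r) (≥1-fraction s 1≤s)) (÷-* a b c d))
            (ℚ.⊔-lub (*-mono 0≤r 0≤y (ℚ.p≤p⊔q x 1ℚ) (ℚ.p≤p⊔q y 1ℚ))
                     (*-mono 0≤r (ℚ.nonNegative⁻¹ 1ℚ) 1≤r 1≤s)))))))
    (ℚ.≤-reflexive (sym (trans (cong (ℚ._+ 1 ÷ suc m) (÷-+ e (suc m) f (suc m)))
      (trans (÷-+ (e * suc m ℕ.+ f * suc m) (suc m * suc m) 1 (suc m))
        (÷-≡ {(e * suc m ℕ.+ f * suc m) * suc m ℕ.+ 1 * (suc m * suc m)} {suc m * suc m * suc m} {suc (e ℕ.+ f)} {suc m}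
          (solve 3 (λ e f m → ((e :* m :+ f :* m) :* m :+ con 1 :* (m :* m)) :* m := (con 1 :+ (e :+ f)) :* (m :* m :* m)) refl e f (suc m)))))))
    where
    open ℕ.+-*-Solver
    *-mono : ∀ {a b c d} → 0ℚ ≼ b → 0ℚ ≼ c → a ≼ b → c ≼ d → a ℚ.* c ≼ b ℚ.* d
    *-mono {a} {b} {c} {d} 0≤b 0≤c a≤b c≤d = ℚ.≤-trans
      (ℚ.*-monoʳ-≤-nonNeg c {{ℚ.nonNegative 0≤c}} a≤b) (ℚ.*-monoˡ-≤-nonNeg b {{ℚ.nonNegative 0≤b}} c≤d)
    r = x ℚ.⊔ 1ℚ
    s = y ℚ.⊔ 1ℚ
    t = (x ℚ.* y) ℚ.⊔ 1ℚ
    1≤r = ℚ.p≤q⊔p x 1ℚ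
    1≤s = ℚ.p≤q⊔p y 1ℚ
    1≤t = ℚ.p≤q⊔p (x ℚ.* y) 1ℚ
    0≤r : 0ℚ ≼ r
    0≤r = ℚ.≤-trans (ℚ.nonNegative⁻¹ 1ℚ) 1≤r
    a = ℤ.∣ ℚ.↥ r ∣
    b = ℚ.↧ₙ r
    c = ℤ.∣ ℚ.↥ s ∣
    d = ℚ.↧ₙ s
    u = ℤ.∣ ℚ.↥ t ∣
    v = ℚ.↧ₙ t
    e = ratioLog a b (suc m)
    f = ratioLog c d (suc m)
    g = ratioLog u v (suc m)

  opaque
    unfolding _⊕_

    lg-mono : ∀ {x y} → x ≼ y → lg m x ≼ lg m y
    lg-mono = logApprox-mono

    lg-nonNeg : ∀ x → 0ℚ ≼ lg m x
    lg-nonNeg x = ⊘-nonNeg (ratioLog ℤ.∣ ℚ.↥ (x ℚ.⊔ 1ℚ) ∣ (ℚ.↧ₙ (x ℚ.⊔ 1ℚ)) (suc m)) (suc m)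

    lg-2^ : ∀ q {x} → x ≼ ι (2 ℕ.^ q) → lg m x ≼ ι q
    lg-2^ = logApprox-2^

    lg-2^-≥ : ∀ q {x} → ι (2 ℕ.^ q) ≼ x → ι q ≼ lg m x
    lg-2^-≥ = logApprox-2^-≥

    lg-* : ∀ {x y} → 0ℚ ≼ x → 0ℚ ≼ y → lg m (x ⊗ y) ≼ lg m x ⊕ lg m y ⊕ 1 ⊘ suc m
    lg-* = logApprox-*

nonNeg-fraction : ∀ x → 0ℚ ≼ x → x ≡ ℤ.∣ ℚ.↥ x ∣ ÷ ℚ.↧ₙ x
nonNeg-fraction x@(ℚ.mkℚ (ℤ.+ a)      b _) _ = sym (ℚ.↥p/↧p≡p x)
nonNeg-fraction x@(ℚ.mkℚ (ℤ.-[1+ a ]) b _) (ℚ.*≤* ())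

÷-⌊⌋ : ∀ a b K .{{_ : ℕ.NonZero b}} →
       ∃[ q ] (a ÷ b ≼ (2 ℕ.^ (q ℕ.+ K)) ÷ 1 × q ÷ 1 ≼ (a ÷ b) ℚ.* (1 ÷ (2 ℕ.^ K)))
÷-⌊⌋ a b K = q , ÷-mono {a} {b} {2 ℕ.^ (q ℕ.+ K)} {1} (ℕ.<⇒≤ upper)
  , subst (q ÷ 1 ≼_) (sym (÷-* a b 1 P)) (÷-mono {q} {1} {a * 1} {b * P}
      (ℕ.≤-trans (ℕ.m/n*n≤m a (b * P)) (ℕ.≤-reflexive (sym (trans (ℕ.*-identityʳ (a * 1)) (ℕ.*-identityʳ a))))))
  where
  P = 2 ℕ.^ K
  instance
    P≢0 : ℕ.NonZero P
    P≢0 = ℕ.m^n≢0 2 K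
    bP≢0 : ℕ.NonZero (b * P)
    bP≢0 = ℕ.m*n≢0 b P
  q = a ℕ./ (b * P)
  open ℕ.≤-Reasoning
  open ℕ.+-*-Solver
  upper : a * 1 ℕ.< 2 ℕ.^ (q ℕ.+ K) * b
  upper = begin-strict
    a * 1                              ≡⟨ ℕ.*-identityʳ a ⟩
    a                                  ≡⟨ ℕ.m≡m%n+[m/n]*n a (b * P) ⟩
    a ℕ.% (b * P) ℕ.+ q * (b * P)      <⟨ ℕ.+-monoˡ-< (q * (b * P)) (ℕ.m%n<n a (b * P)) ⟩
    suc q * (b * P)                    ≤⟨ ℕ.*-monoˡ-≤ (b * P) (n<2^n q) ⟩
    2 ℕ.^ q * (b * P)                  ≡⟨ solve 3 (λ q b p → q :* (b :* p) := q :* p :* b) refl (2 ℕ.^ q) b P ⟩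
    2 ℕ.^ q * P * b                    ≡⟨ cong (_* b) (ℕ.^-distribˡ-+-* 2 q K) ⟨
    2 ℕ.^ (q ℕ.+ K) * b                ∎

opaque
  unfolding _⊕_

  nonNeg-⌊⌋ : ∀ {x} K → 0ℚ ≼ x → ∃[ q ] (x ≼ ι (2 ℕ.^ (q ℕ.+ K)) × ι q ≼ x ⊗ (1 ⊘ (2 ℕ.^ K)))
  nonNeg-⌊⌋ {x} K 0≤x = subst (λ z → ∃[ q ] (z ≼ ι (2 ℕ.^ (q ℕ.+ K)) × ι q ≼ z ⊗ (1 ⊘ (2 ℕ.^ K))))
    (sym (nonNeg-fraction x 0≤x)) (÷-⌊⌋ ℤ.∣ ℚ.↥ x ∣ (ℚ.↧ₙ x) K)

-- With q = ⌊x/2ᴷ⌋ one has x < (q + 1) 2ᴷ ≤ 2^(q + K).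
lg-≼-linear : ∀ m K {x} → 0ℚ ≼ x → lg m x ≼ ι K ⊕ x ⊗ (1 ⊘ (2 ℕ.^ K))
lg-≼-linear m K {x} 0≤x = bound (nonNeg-⌊⌋ K 0≤x)
  where
  bound : ∃[ q ] (x ≼ ι (2 ℕ.^ (q ℕ.+ K)) × ι q ≼ x ⊗ (1 ⊘ (2 ℕ.^ K))) → lg m x ≼ ι K ⊕ x ⊗ (1 ⊘ (2 ℕ.^ K))
  bound (q , x≤ , q≤) = ℚ.≤-trans (lg-2^ m (q ℕ.+ K) x≤)
    (subst (_≼ ι K ⊕ x ⊗ (1 ⊘ (2 ℕ.^ K))) (trans (⊕-comm (ι K) (ι q)) (sym (ι-+ q K)))
      (⊕-mono (ℚ.≤-refl {ι K}) q≤))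

-- Finite sums of rationals

variable
  A B : Set

sum : List A → (A → ℚ) → ℚ
sum []       f = 0ℚ
sum (x ∷ xs) f = f x ⊕ sum xs f

sum-cong : ∀ (xs : List A) {f g : A → ℚ} → (∀ x → f x ≡ g x) → sum xs f ≡ sum xs g
sum-cong []       f≡g = refl
sum-cong (x ∷ xs) f≡g = cong₂ _⊕_ (f≡g x) (sum-cong xs f≡g)

sum-mono : ∀ (xs : List A) {f g : A → ℚ} → (∀ x → f x ≼ g x) → sum xs f ≼ sum xs g
sum-mono []       f≤g = ℚ.≤-refl
sum-mono (x ∷ xs) f≤g = ⊕-mono (f≤g x) (sum-mono xs f≤g)

sum-nonNeg : ∀ (xs : List A) {f : A → ℚ} → (∀ x → 0ℚ ≼ f x) → 0ℚ ≼ sum xs f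
sum-nonNeg []       0≤f = ℚ.≤-refl
sum-nonNeg (x ∷ xs) 0≤f = ⊕-nonNeg (0≤f x) (sum-nonNeg xs 0≤f)

sum-∈ : ∀ {xs : List A} {x} (f : A → ℚ) → (∀ x → 0ℚ ≼ f x) → x ∈ xs → f x ≼ sum xs f
sum-∈ {xs = y ∷ ys} f 0≤f (here refl)  = a≼a⊕b (sum-nonNeg ys 0≤f)
sum-∈ {xs = y ∷ ys} f 0≤f (there x∈ys) = ℚ.≤-trans (sum-∈ f 0≤f x∈ys) (b≼a⊕b (0≤f y))

sum-0 : ∀ (xs : List A) → sum xs (λ _ → 0ℚ) ≡ 0ℚ
sum-0 []       = refl
sum-0 (x ∷ xs) = trans (⊕-identityˡ _) (sum-0 xs)

sum-⊕ : ∀ (xs : List A) (f g : A → ℚ) → sum xs (λ x → f x ⊕ g x) ≡ sum xs f ⊕ sum xs g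
sum-⊕ []       f g = sym (⊕-identityˡ 0ℚ)
sum-⊕ (x ∷ xs) f g = trans (cong (f x ⊕ g x ⊕_) (sum-⊕ xs f g))
  (solve 4 (λ a b s t → a :+ b :+ (s :+ t) := a :+ s :+ (b :+ t)) refl (f x) (g x) (sum xs f) (sum xs g))
  where open ⊕-⊗-Solver

sum-⊗ : ∀ (xs : List A) a (f : A → ℚ) → sum xs (λ x → a ⊗ f x) ≡ a ⊗ sum xs f
sum-⊗ []       a f = sym (⊗-zeroʳ a)
sum-⊗ (x ∷ xs) a f = trans (cong (a ⊗ f x ⊕_) (sum-⊗ xs a f)) (sym (⊗-distribˡ-⊕ a (f x) (sum xs f)))

sum-const : ∀ (xs : List A) a → sum xs (λ _ → a) ≡ ι (length xs) ⊗ a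
sum-const []       a = trans (sym (⊗-zeroˡ a)) (cong (_⊗ a) (sym ι-0))
sum-const (x ∷ xs) a = trans (cong (a ⊕_) (sum-const xs a))
  (trans (solve 2 (λ a n → a :+ n :* a := (con 1 :+ n) :* a) refl a (ι (length xs)))
    (cong (_⊗ a) (sym (ι-suc (length xs)))))
  where open ⊕-⊗-Solver

sum-++ : ∀ (xs ys : List A) (f : A → ℚ) → sum (xs ++ ys) f ≡ sum xs f ⊕ sum ys f
sum-++ []       ys f = sym (⊕-identityˡ _)
sum-++ (x ∷ xs) ys f = trans (cong (f x ⊕_) (sum-++ xs ys f)) (sym (⊕-assoc (f x) (sum xs f) (sum ys f)))

sum-map : ∀ (h : A → B) (xs : List A) (f : B → ℚ) → sum (map h xs) f ≡ sum xs (λ x → f (h x))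
sum-map h []       f = refl
sum-map h (x ∷ xs) f = cong (f (h x) ⊕_) (sum-map h xs f)

sum-concatMap : ∀ (h : A → List B) (xs : List A) (f : B → ℚ) →
                sum (concatMap h xs) f ≡ sum xs (λ x → sum (h x) f)
sum-concatMap h []       f = refl
sum-concatMap h (x ∷ xs) f = trans (sum-++ (h x) (concatMap h xs) f) (cong (sum (h x) f ⊕_) (sum-concatMap h xs f))

sum-swap : ∀ (xs : List A) (ys : List B) (f : A → B → ℚ) →
           sum xs (λ x → sum ys (f x)) ≡ sum ys (λ y → sum xs (λ x → f x y))
sum-swap []       ys f = sym (sum-0 ys)
sum-swap (x ∷ xs) ys f = trans (cong (sum ys (f x) ⊕_) (sum-swap xs ys f))
  (sym (sum-⊕ ys (f x) (λ y → sum xs (λ x → f x y))))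

sum-allFin-suc : ∀ n (f : Fin (suc n) → ℚ) → sum (allFin (suc n)) f ≡ f fzero ⊕ sum (allFin n) (f ∘ fsuc)
sum-allFin-suc n f = cong (f fzero ⊕_)
  (trans (cong (λ xs → sum xs f) (sym (List.map-tabulate id fsuc))) (sum-map fsuc (allFin n) f))

indicator : {P : Set} → Dec P → ℚ → ℚ
indicator (yes _) x = x
indicator (no _)  x = 0ℚ

indicator-nonNeg : {P : Set} (P? : Dec P) {x : ℚ} → 0ℚ ≼ x → 0ℚ ≼ indicator P? x
indicator-nonNeg (yes _) 0≤x = 0≤x
indicator-nonNeg (no _)  0≤x = ℚ.≤-refl

sum-indicator : ∀ {n} (x : Fin n) (f : Fin n → ℚ) → sum (allFin n) (λ c → indicator (c Fin.≟ x) (f c)) ≡ f x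
sum-indicator {suc n} fzero    f = trans (sum-allFin-suc n (λ c → indicator (c Fin.≟ fzero) (f c)))
  (trans (cong (f fzero ⊕_) (sum-0 (allFin n))) (⊕-identityʳ _))
sum-indicator {suc n} (fsuc x) f = trans (sum-allFin-suc n (λ c → indicator (c Fin.≟ fsuc x) (f c)))
  (trans (⊕-identityˡ _) (trans (sum-cong (allFin n) same) (sum-indicator x (f ∘ fsuc))))
  where
  same : ∀ c → indicator (fsuc c Fin.≟ fsuc x) (f (fsuc c)) ≡ indicator (c Fin.≟ x) (f (fsuc c))
  same c with c Fin.≟ x
  ... | yes _ = refl
  ... | no  _ = refl

-- Real expressions at a fixed precision

infix 8 _at_

opaque
  unfolding _⊕_

  _at_ : ℝ → ℕ → ℚ
  x at m = seq x m

  at-+ℝ : ∀ x y m → (x +ℝ y) at m ≡ x at m ⊕ y at m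
  at-+ℝ x y m = refl

  at-*ℝ : ∀ x y m → (x *ℝ y) at m ≡ x at m ⊗ y at m
  at-*ℝ x y m = refl

  at-fromℚ : ∀ a b m → fromℚ (a ÷ b) at m ≡ a ⊘ b
  at-fromℚ a b m = refl

  at-fromℕ : ∀ n m → fromℕ n at m ≡ ι n
  at-fromℕ n m = refl

  at-log₂ : ∀ x m → log₂ x at m ≡ lg m (x at m)
  at-log₂ x m = refl

  at-∑ : ∀ (xs : List A) (f : A → ℝ) m → ∑ xs f at m ≡ sum xs (λ x → f x at m)
  at-∑ []       f m = refl
  at-∑ (x ∷ xs) f m = cong (seq (f x) m ℚ.+_) (at-∑ xs f m)

-- The empirical Markov model

occ-++ : ∀ {σ} (c : Fin σ) (v w : Word σ) → occ c (v ++ w) ≡ occ c v ℕ.+ occ c w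
occ-++ c v w = trans (cong length (List.filter-++ (c Fin.≟_) v w)) (List.length-++ (filter (c Fin.≟_) v))

occ-∷ : ∀ {σ} (c x : Fin σ) (w : Word σ) h → ι (occ c (x ∷ w)) ⊗ h ≡ indicator (c Fin.≟ x) h ⊕ ι (occ c w) ⊗ h
occ-∷ c x w h with c Fin.≟ x
... | yes _ = trans (cong (_⊗ h) (ι-suc (occ c w)))
                (trans (⊗-distribʳ-⊕ h 1ℚ (ι (occ c w))) (cong (_⊕ ι (occ c w) ⊗ h) (⊗-identityˡ h)))
... | no  _ = sym (⊕-identityˡ _)

sum-occ : ∀ {σ} (w : Word σ) (h : Fin σ → ℚ) → sum w h ≡ sum (allFin σ) (λ c → ι (occ c w) ⊗ h c)
sum-occ {σ} []      h = sym (trans (sum-cong (allFin σ) (λ c → trans (cong (_⊗ h c) ι-0) (⊗-zeroˡ (h c)))) (sum-0 (allFin σ)))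
sum-occ {σ} (x ∷ w) h = sym (trans (sum-cong (allFin σ) (λ c → occ-∷ c x w (h c)))
  (trans (sum-⊕ (allFin σ) (λ c → indicator (c Fin.≟ x) (h c)) (λ c → ι (occ c w) ⊗ h c))
    (cong₂ _⊕_ (sum-indicator x h) (sym (sum-occ w h)))))

-- Only an inequality, because a context that is never followed by a symbol has all frequencies 0 by
-- the convention for division by 0. The Markov chain below is therefore substochastic.
frequency-sum : ∀ {σ} (w : Word σ) → sum (allFin σ) (λ c → occ c w ⊘ length w) ≼ 1ℚ
frequency-sum {σ} []      = ℚ.≤-trans (ℚ.≤-reflexive
  (trans (sum-cong (allFin σ) (λ c → ⊘-zero (occ c []))) (sum-0 (allFin σ)))) (subst₂ _≼_ ι-0 ι-1 (ι-mono z≤n))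
frequency-sum {σ} w@(_ ∷ v) = ι-cancel (length w) (ℚ.≤-reflexive (trans
  (sym (sum-⊗ (allFin σ) (ι (length w)) (λ c → occ c w ⊘ length w)))
  (trans (sum-cong (allFin σ) (λ c → trans (ι⊗⊘ (occ c w) (length w)) (sym (⊗-identityʳ (ι (occ c w))))))
    (trans (sym (sum-occ w (λ _ → 1ℚ))) (sum-const w 1ℚ)))))

sum-allFin-const : ∀ σ a → sum (allFin σ) (λ _ → a) ≡ ι σ ⊗ a
sum-allFin-const σ a = trans (sum-const (allFin σ) a) (cong (λ n → ι n ⊗ a) (List.length-tabulate {n = σ} id))

-- The probability of w under the Markov chain of order |s| with the empirical
-- transition frequencies of T, where s is the current context and the first r
-- symbols are instead drawn uniformly.
module Markov {σ : ℕ} {{σ≢0 : ℕ.NonZero σ}} (T : Word σ) where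

  transition : Word σ → Fin σ → ℚ
  transition s c = occ c (following s T) ⊘ length (following s T)

  probability : ℕ → Word σ → Word σ → ℚ
  probability r       s []      = 1ℚ
  -- Dropping after appending slides the window; for order 0 it turns `[ c ]` back into the empty
  -- context.
  probability zero    s (c ∷ w) = transition s c ⊗ probability zero (drop 1 (s ++ [ c ])) w
  probability (suc r) s (c ∷ w) = (1 ⊘ σ) ⊗ probability r (s ++ [ c ]) w

  probability-nonNeg : ∀ r s w → 0ℚ ≼ probability r s w
  probability-nonNeg r       s []      = subst₂ _≼_ ι-0 ι-1 (ι-mono z≤n)
  probability-nonNeg zero    s (c ∷ w) = ⊗-nonNeg (⊘-nonNeg _ _) (probability-nonNeg zero _ w)
  probability-nonNeg (suc r) s (c ∷ w) = ⊗-nonNeg (⊘-nonNeg _ _) (probability-nonNeg r _ w)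

  sum-words-suc : ∀ l (f : Word σ → ℚ) → sum (words (suc l)) f ≡ sum (allFin σ) (λ c → sum (words l) (λ w → f (c ∷ w)))
  sum-words-suc l f = trans (sum-concatMap (λ c → map (c ∷_) (words l)) (allFin σ) f)
    (sum-cong (allFin σ) (λ c → sum-map (c ∷_) (words l) f))

  sum-first-symbol : ∀ {l} {f : Word σ → ℚ} (p : Fin σ → ℚ) (g : Fin σ → Word σ → ℚ) → (∀ c → 0ℚ ≼ p c) →
    (∀ c w → f (c ∷ w) ≡ p c ⊗ g c w) → (∀ c → sum (words l) (g c) ≼ 1ℚ) →
    sum (allFin σ) p ≼ 1ℚ → sum (words (suc l)) f ≼ 1ℚ
  sum-first-symbol {l} {f} p g 0≤p f≡ Σg≤1 Σp≤1 = begin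
    sum (words (suc l)) f                                       ≡⟨ sum-words-suc l f ⟩
    sum (allFin σ) (λ c → sum (words l) (λ w → f (c ∷ w)))
      ≡⟨ sum-cong (allFin σ) (λ c → trans (sum-cong (words l) (f≡ c)) (sum-⊗ (words l) (p c) (g c))) ⟩
    sum (allFin σ) (λ c → p c ⊗ sum (words l) (g c))            ≤⟨ sum-mono (allFin σ) (λ c → ⊗-monoˡ (0≤p c) (Σg≤1 c)) ⟩
    sum (allFin σ) (λ c → p c ⊗ 1ℚ)                             ≡⟨ sum-cong (allFin σ) (λ c → ⊗-identityʳ (p c)) ⟩
    sum (allFin σ) p                                            ≤⟨ Σp≤1 ⟩
    1ℚ                                                          ∎
    where open ℚ.≤-Reasoning

  probability-sum : ∀ l r s → sum (words l) (probability r s) ≼ 1ℚ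
  probability-sum zero    r       s = ℚ.≤-reflexive (⊕-identityʳ 1ℚ)
  probability-sum (suc l) zero    s = sum-first-symbol {l} (transition s) (λ c → probability zero (drop 1 (s ++ [ c ])))
    (λ c → ⊘-nonNeg _ _) (λ c w → refl) (λ c → probability-sum l zero (drop 1 (s ++ [ c ]))) (frequency-sum (following s T))
  probability-sum (suc l) (suc r) s = sum-first-symbol {l} (λ _ → 1 ⊘ σ) (λ c → probability r (s ++ [ c ]))
    (λ c → ⊘-nonNeg 1 σ) (λ c w → refl) (λ c → probability-sum l r (s ++ [ c ]))
    (ℚ.≤-reflexive (trans (sum-allFin-const σ (1 ⊘ σ)) (trans (ι⊗⊘ 1 σ) ι-1)))

symbolAfter-++ : ∀ {σ} (s : Word σ) c R → symbolAfter s (s ++ c ∷ R) ≡ [ c ]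
symbolAfter-++ []      c R = refl
symbolAfter-++ (a ∷ s) c R with a Fin.≟ a
... | yes _  = symbolAfter-++ s c R
... | no a≢a = contradiction refl a≢a

occ-symbolAfter-≤ : ∀ {σ} (s L : Word σ) c → occ c (symbolAfter s L) ≤ occ c (following s L)
occ-symbolAfter-≤ s []      c = ℕ.≤-trans (ℕ.m≤m+n _ _) (ℕ.≤-reflexive (sym (occ-++ c (symbolAfter s []) [])))
occ-symbolAfter-≤ s (x ∷ L) c = ℕ.≤-trans (ℕ.m≤m+n _ _) (ℕ.≤-reflexive (sym (occ-++ c (symbolAfter s (x ∷ L)) (following s L))))

-- Every transition met along the text has positive frequency, so its inverse can be taken in
-- `lg-split`.
occ-following : ∀ {σ} (X s : Word σ) c R → 1 ≤ occ c (following s (X ++ s ++ c ∷ R))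
occ-following []      s c R = ℕ.≤-trans (ℕ.≤-reflexive (sym one)) (occ-symbolAfter-≤ s (s ++ c ∷ R) c)
  where
  one : occ c (symbolAfter s (s ++ c ∷ R)) ≡ 1
  one = trans (cong (occ c) (symbolAfter-++ s c R)) (cong length (List.filter-accept (c Fin.≟_) {xs = []} refl))
occ-following (x ∷ X) s c R = ℕ.≤-trans (occ-following X s c R)
  (ℕ.≤-trans (ℕ.m≤n+m _ _) (ℕ.≤-reflexive (sym (occ-++ c (symbolAfter s (x ∷ X ++ s ++ c ∷ R)) (following s (X ++ s ++ c ∷ R))))))

occ≤length : ∀ {σ} (c : Fin σ) w → occ c w ≤ length w
occ≤length c w = List.length-filter (c Fin.≟_) w

∈-words : ∀ {σ} (w : Word σ) → w ∈ words (length w)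
∈-words []      = here refl
∈-words (c ∷ w) = ∈-concatMap⁺ (λ d → map (d ∷_) (words (length w))) (lose (∈-allFin c) (∈-map⁺ (c ∷_) (∈-words w)))

uncons-context : ∀ {σ} (s : Word σ) c w → ∃[ x ] (s ++ c ∷ w ≡ x ∷ (drop 1 (s ++ [ c ]) ++ w))
uncons-context []      c w = c , refl
uncons-context (a ∷ s) c w = a , cong (a ∷_) (sym (List.++-assoc s [ c ] w))

length-shift : ∀ {σ} (s : Word σ) c → length (drop 1 (s ++ [ c ])) ≡ length s
length-shift []      c = refl
length-shift (a ∷ s) c = trans (List.length-++ s) (ℕ.+-comm (length s) 1)

-- Charging symbols to their contexts

opaque
  unfolding _⊕_

  ⊘-inverse : ∀ a b .{{_ : ℕ.NonZero a}} .{{_ : ℕ.NonZero b}} → (b ⊘ a) ⊗ (a ⊘ b) ≡ 1ℚ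
  ⊘-inverse (suc a) (suc b) = trans (÷-* (suc b) (suc a) (suc a) (suc b))
    (÷-≡ {suc b * suc a} {suc a * suc b} {1} {1} (solve 2 (λ a b → b :* a :* con 1 := con 1 :* (a :* b)) refl (suc a) (suc b)))
    where open ℕ.+-*-Solver

module CodeLength {σ : ℕ} {{σ≢0 : ℕ.NonZero σ}} (T : Word σ) (m k : ℕ) where

  open Markov T

  e : ℚ
  e = 1 ⊘ suc m

  0≤e : 0ℚ ≼ e
  0≤e = ⊘-nonNeg 1 (suc m)

  -- Subadditivity applied to y = (b/a) (y a/b): moving a probability factor a/b into the argument
  -- costs its surprise log (b/a). With y arbitrary the step can be iterated over all factors of a
  -- probability.
  lg-split : ∀ a b {y} → 1 ≤ a → 1 ≤ b → 0ℚ ≼ y → lg m y ≼ lg m (b ⊘ a) ⊕ lg m (y ⊗ (a ⊘ b)) ⊕ e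
  lg-split a b {y} 1≤a 1≤b 0≤y = subst (λ z → lg m z ≼ lg m (b ⊘ a) ⊕ lg m (y ⊗ (a ⊘ b)) ⊕ e) eq
    (lg-* m (⊘-nonNeg b a) (⊗-nonNeg 0≤y (⊘-nonNeg a b)))
    where
    open ⊕-⊗-Solver
    eq : (b ⊘ a) ⊗ (y ⊗ (a ⊘ b)) ≡ y
    eq = trans (solve 3 (λ u y v → u :* (y :* v) := y :* (u :* v)) refl (b ⊘ a) y (a ⊘ b))
      (trans (cong (y ⊗_) (⊘-inverse a b {{ℕ.>-nonZero 1≤a}} {{ℕ.>-nonZero 1≤b}})) (⊗-identityʳ y))

  surprise : Word σ → Fin σ → ℚ
  surprise v c = lg m (length v ⊘ occ c v)

  symbolCost : Word σ → Fin σ → ℚ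
  symbolCost W = surprise (following W T)

  -- Only the prefix of `t` of length `k`, if there is one, contributes, so this is the charge of
  -- the symbol that follows it. The sum over all words allows an exchange with the sum over
  -- suffixes, which leads to the definition of `H`.
  cost : Word σ → ℚ
  cost t = sum (words k) λ W → sum (symbolAfter W t) (symbolCost W)

  symbolCosts-nonNeg : ∀ W t → 0ℚ ≼ sum (symbolAfter W t) (symbolCost W)
  symbolCosts-nonNeg W t = sum-nonNeg (symbolAfter W t) (λ c → lg-nonNeg m _)

  cost-nonNeg : ∀ t → 0ℚ ≼ cost t
  cost-nonNeg t = sum-nonNeg (words k) (λ W → symbolCosts-nonNeg W t)

  symbolCost≤cost : ∀ s c R → length s ≡ k → symbolCost s c ≼ cost (s ++ c ∷ R)
  symbolCost≤cost s c R |s|≡k = ℚ.≤-trans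
    (ℚ.≤-reflexive (sym (trans (cong (λ v → sum v (symbolCost s)) (symbolAfter-++ s c R)) (⊕-identityʳ _))))
    (sum-∈ (λ W → sum (symbolAfter W (s ++ c ∷ R)) (symbolCost W)) (λ W → symbolCosts-nonNeg W _)
      (subst (λ l → s ∈ words l) |s|≡k (∈-words s)))

  -- A charge is booked where its context starts, not at the charged symbol. Consecutive phrases
  -- thus own disjoint charges, although the suffixes read on into `R`.
  costs : Word σ → Word σ → ℚ
  costs []      R = 0ℚ
  costs (c ∷ X) R = cost (c ∷ X ++ R) ⊕ costs X R

  costs-nonNeg : ∀ X R → 0ℚ ≼ costs X R
  costs-nonNeg []      R = ℚ.≤-refl
  costs-nonNeg (c ∷ X) R = ⊕-nonNeg (cost-nonNeg _) (costs-nonNeg X R)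

  costs-++ : ∀ X Y R → costs (X ++ Y) R ≡ costs X (Y ++ R) ⊕ costs Y R
  costs-++ []      Y R = sym (⊕-identityˡ _)
  costs-++ (c ∷ X) Y R = trans (cong₂ _⊕_ (cong (λ z → cost (c ∷ z)) (List.++-assoc X Y R)) (costs-++ X Y R))
    (sym (⊕-assoc _ (costs X (Y ++ R)) (costs Y R)))

  -- Each symbol of `w` pays with the charge booked at the first position of the window, which then
  -- leaves the window and joins `X`. When `w` is used up, the charges booked inside the last
  -- context are surplus and are dropped because they are non-negative.
  lg-probability₀ : ∀ w s X R {y} → length s ≡ k → X ++ (s ++ w) ++ R ≡ T → 0ℚ ≼ y →
    lg m y ≼ costs (s ++ w) R ⊕ ι (length w) ⊗ e ⊕ lg m (y ⊗ probability zero s w)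
  lg-probability₀ [] s X R {y} _ _ _ = subst (λ z → lg m y ≼ costs (s ++ []) R ⊕ ι 0 ⊗ e ⊕ lg m z) (sym (⊗-identityʳ y))
    (b≼a⊕b (⊕-nonNeg (costs-nonNeg (s ++ []) R) (⊗-nonNeg (ι-nonNeg 0) 0≤e)))
  lg-probability₀ (c ∷ w) s X R {y} |s|≡k eqT 0≤y = begin
    lg m y
      ≤⟨ lg-split a b 1≤a (ℕ.≤-trans 1≤a (occ≤length c (following s T))) 0≤y ⟩
    symbolCost s c ⊕ lg m y′ ⊕ e
      ≤⟨ ⊕-mono (⊕-mono head-cost ih) (ℚ.≤-refl {e}) ⟩
    cost (x ∷ (s′ ++ w) ++ R) ⊕ (costs (s′ ++ w) R ⊕ ι (length w) ⊗ e ⊕ lg m (y′ ⊗ Q)) ⊕ e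
      ≡⟨ solve 5 (λ h g n e l → h :+ (g :+ n :* e :+ l) :+ e := h :+ g :+ (con 1 :+ n) :* e :+ l) refl
          (cost (x ∷ (s′ ++ w) ++ R)) (costs (s′ ++ w) R) (ι (length w)) e (lg m (y′ ⊗ Q)) ⟩
    costs (x ∷ s′ ++ w) R ⊕ (1ℚ ⊕ ι (length w)) ⊗ e ⊕ lg m (y′ ⊗ Q)
      ≡⟨ cong₂ _⊕_ (cong₂ _⊕_ (cong (λ z → costs z R) (sym x≡)) (cong (_⊗ e) (sym (ι-suc (length w)))))
                   (cong (lg m) (⊗-assoc y (transition s c) Q)) ⟩
    costs (s ++ c ∷ w) R ⊕ ι (suc (length w)) ⊗ e ⊕ lg m (y ⊗ probability zero s (c ∷ w)) ∎
    where
    open ℚ.≤-Reasoning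
    open ⊕-⊗-Solver
    s′ = drop 1 (s ++ [ c ])
    x = proj₁ (uncons-context s c w)
    x≡ : s ++ c ∷ w ≡ x ∷ (s′ ++ w)
    x≡ = proj₂ (uncons-context s c w)
    a = occ c (following s T)
    b = length (following s T)
    Q = probability zero s′ w
    y′ = y ⊗ transition s c
    1≤a : 1 ≤ a
    1≤a = subst (λ z → 1 ≤ occ c (following s z)) (trans (cong (X ++_) (sym (List.++-assoc s (c ∷ w) R))) eqT)
      (occ-following X s c (w ++ R))
    head-cost : symbolCost s c ≼ cost (x ∷ (s′ ++ w) ++ R)
    head-cost = subst (λ z → symbolCost s c ≼ cost z)
      (trans (sym (List.++-assoc s (c ∷ w) R)) (cong (_++ R) x≡)) (symbolCost≤cost s c (w ++ R) |s|≡k)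
    ih = lg-probability₀ w s′ (X ++ [ x ]) R {y′} (trans (length-shift s c) |s|≡k)
      (trans (List.++-assoc X [ x ] ((s′ ++ w) ++ R)) (trans (cong (λ z → X ++ z ++ R) (sym x≡)) eqT))
      (⊗-nonNeg 0≤y (⊘-nonNeg a b))

  lg-probability : ∀ r w s X R {y} → length s ℕ.+ r ≡ k → X ++ (s ++ w) ++ R ≡ T → 0ℚ ≼ y →
    lg m y ≼ ι r ⊗ lg m (ι σ) ⊕ (costs (s ++ w) R ⊕ ι (length w) ⊗ e ⊕ lg m (y ⊗ probability r s w))
  lg-probability zero    w       s X R {y} |s|≡k eqT 0≤y = ℚ.≤-trans
    (lg-probability₀ w s X R (trans (sym (ℕ.+-identityʳ _)) |s|≡k) eqT 0≤y) (b≼a⊕b (⊗-nonNeg (ι-nonNeg 0) (lg-nonNeg m (ι σ))))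
  lg-probability (suc r) []      s X R {y} _ _ _ =
    subst (λ z → lg m y ≼ ι (suc r) ⊗ lg m (ι σ) ⊕ (costs (s ++ []) R ⊕ ι 0 ⊗ e ⊕ lg m z)) (sym (⊗-identityʳ y))
    (ℚ.≤-trans (b≼a⊕b (⊕-nonNeg (costs-nonNeg (s ++ []) R) (⊗-nonNeg (ι-nonNeg 0) 0≤e)))
      (b≼a⊕b (⊗-nonNeg (ι-nonNeg (suc r)) (lg-nonNeg m (ι σ)))))
  lg-probability (suc r) (c ∷ w) s X R {y} |s|+r≡k eqT 0≤y = begin
    lg m y
      ≤⟨ lg-split 1 σ ℕ.≤-refl (ℕ.>-nonZero⁻¹ σ) 0≤y ⟩
    lg m (σ ⊘ 1) ⊕ lg m y′ ⊕ e
      ≤⟨ ⊕-mono (⊕-mono (ℚ.≤-reflexive (cong (lg m) (⊘-1 σ))) ih) (ℚ.≤-refl {e}) ⟩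
    Λ ⊕ (ι r ⊗ Λ ⊕ (costs (s ++ c ∷ w) R ⊕ ι (length w) ⊗ e ⊕ lg m (y′ ⊗ Q))) ⊕ e
      ≡⟨ solve 6 (λ h r g n e l → h :+ (r :* h :+ (g :+ n :* e :+ l)) :+ e := (con 1 :+ r) :* h :+ (g :+ (con 1 :+ n) :* e :+ l)) refl
          Λ (ι r) (costs (s ++ c ∷ w) R) (ι (length w)) e (lg m (y′ ⊗ Q)) ⟩
    (1ℚ ⊕ ι r) ⊗ Λ ⊕ (costs (s ++ c ∷ w) R ⊕ (1ℚ ⊕ ι (length w)) ⊗ e ⊕ lg m (y′ ⊗ Q))
      ≡⟨ cong₂ _⊕_ (cong (_⊗ Λ) (sym (ι-suc r))) (cong₂ _⊕_ (cong (λ n → costs (s ++ c ∷ w) R ⊕ n ⊗ e) (sym (ι-suc (length w))))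
                   (cong (lg m) (⊗-assoc y (1 ⊘ σ) Q))) ⟩
    ι (suc r) ⊗ Λ ⊕ (costs (s ++ c ∷ w) R ⊕ ι (suc (length w)) ⊗ e ⊕ lg m (y ⊗ probability (suc r) s (c ∷ w))) ∎
    where
    open ℚ.≤-Reasoning
    open ⊕-⊗-Solver
    Λ = lg m (ι σ)
    Q = probability r (s ++ [ c ]) w
    y′ = y ⊗ (1 ⊘ σ)
    s≡ : (s ++ [ c ]) ++ w ≡ s ++ c ∷ w
    s≡ = List.++-assoc s [ c ] w
    ih : lg m y′ ≼ ι r ⊗ Λ ⊕ (costs (s ++ c ∷ w) R ⊕ ι (length w) ⊗ e ⊕ lg m (y′ ⊗ Q))
    ih = subst (λ z → lg m y′ ≼ ι r ⊗ Λ ⊕ (costs z R ⊕ ι (length w) ⊗ e ⊕ lg m (y′ ⊗ Q))) s≡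
      (lg-probability r w (s ++ [ c ]) X R {y′}
        (trans (cong (ℕ._+ r) (trans (List.length-++ s) (ℕ.+-comm (length s) 1))) (trans (sym (ℕ.+-suc (length s) r)) |s|+r≡k))
        (trans (cong (λ z → X ++ z ++ R) s≡) eqT) (⊗-nonNeg 0≤y (⊘-nonNeg 1 σ)))

-- Length weights, and the total charge as entropy

ι-length⊗frequency : ∀ {σ} (c : Fin σ) (w : Word σ) → ι (length w) ⊗ (occ c w ⊘ length w) ≡ ι (occ c w)
ι-length⊗frequency c []        = trans (cong (ι 0 ⊗_) (⊘-zero 0)) (trans (⊗-zeroʳ (ι 0)) (sym ι-0))
ι-length⊗frequency c w@(_ ∷ _) = ι⊗⊘ (occ c w) (length w)

reciprocal-telescope : ∀ a .{{_ : ℕ.NonZero a}} → (1 ⊘ a) ⊗ (1 ⊘ suc a) ⊕ 1 ⊘ suc a ≡ 1 ⊘ a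
reciprocal-telescope a = begin
  (1 ⊘ a) ⊗ (1 ⊘ suc a) ⊕ 1 ⊘ suc a
    ≡⟨ cong ((1 ⊘ a) ⊗ (1 ⊘ suc a) ⊕_) (trans (sym (⊗-identityˡ (1 ⊘ suc a)))
         (cong (_⊗ (1 ⊘ suc a)) (sym (trans (ι⊗⊘ 1 a) ι-1)))) ⟩
  (1 ⊘ a) ⊗ (1 ⊘ suc a) ⊕ ι a ⊗ (1 ⊘ a) ⊗ (1 ⊘ suc a)
    ≡⟨ solve 3 (λ x y n → x :* y :+ n :* x :* y := x :* ((con 1 :+ n) :* y)) refl (1 ⊘ a) (1 ⊘ suc a) (ι a) ⟩
  (1 ⊘ a) ⊗ ((1ℚ ⊕ ι a) ⊗ (1 ⊘ suc a))
    ≡⟨ cong (1 ⊘ a ⊗_) (trans (cong (_⊗ (1 ⊘ suc a)) (sym (ι-suc a))) (trans (ι⊗⊘ 1 (suc a)) ι-1)) ⟩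
  (1 ⊘ a) ⊗ 1ℚ
    ≡⟨ ⊗-identityʳ (1 ⊘ a) ⟩
  1 ⊘ a ∎
  where
  open ≡-Reasoning
  open ⊕-⊗-Solver

1⊘1 : 1 ⊘ 1 ≡ 1ℚ
1⊘1 = trans (⊘-1 1) ι-1

telescope-sum : ∀ N → sum (downFrom N) (λ l → (1 ⊘ suc l) ⊗ (1 ⊘ suc (suc l))) ≼ 1ℚ
telescope-sum N = ℚ.≤-trans (a≼a⊕b (⊘-nonNeg 1 (suc N))) (ℚ.≤-reflexive (go N))
  where
  f : ℕ → ℚ
  f l = (1 ⊘ suc l) ⊗ (1 ⊘ suc (suc l))
  go : ∀ N → sum (downFrom N) f ⊕ 1 ⊘ suc N ≡ 1ℚ
  go zero    = trans (⊕-identityˡ _) 1⊘1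
  go (suc N) = trans (solve 3 (λ a s b → a :+ s :+ b := s :+ (a :+ b)) refl (f N) (sum (downFrom N) f) (1 ⊘ suc (suc N)))
    (trans (cong (sum (downFrom N) f ⊕_) (reciprocal-telescope (suc N))) (go N))
    where open ⊕-⊗-Solver

module PhraseLength {σ : ℕ} {{σ≢0 : ℕ.NonZero σ}} (T : Word σ) (m k : ℕ) where

  open Markov T
  open CodeLength T m k

  -- The terms 1/((l+1)(l+2)) telescope, so their sum over any range of lengths is at most 1, while
  -- their inverses have logarithms of order log l only.
  lengthWeight : ℕ → ℚ
  lengthWeight l = (1 ⊘ suc l) ⊗ (1 ⊘ suc (suc l))

  -- The length is a separate argument so that its factor is constant in a sum over `words l`.
  weight : ℕ → Word σ → ℚ
  weight l w = lengthWeight l ⊗ probability k [] w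

  lengthWeight-nonNeg : ∀ l → 0ℚ ≼ lengthWeight l
  lengthWeight-nonNeg l = ⊗-nonNeg (⊘-nonNeg 1 (suc l)) (⊘-nonNeg 1 (suc (suc l)))

  weight-nonNeg : ∀ l w → 0ℚ ≼ weight l w
  weight-nonNeg l w = ⊗-nonNeg (lengthWeight-nonNeg l) (probability-nonNeg k [] w)

  weight-sum : ∀ N → sum (downFrom N) (λ l → sum (words l) (weight l)) ≼ 1ℚ
  weight-sum N = ℚ.≤-trans (sum-mono (downFrom N) λ l → begin
      sum (words l) (weight l)                             ≡⟨ sum-⊗ (words l) (lengthWeight l) (probability k []) ⟩
      lengthWeight l ⊗ sum (words l) (probability k [])    ≤⟨ ⊗-monoˡ (lengthWeight-nonNeg l) (probability-sum l k []) ⟩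
      lengthWeight l ⊗ 1ℚ                                  ≡⟨ ⊗-identityʳ (lengthWeight l) ⟩
      lengthWeight l                                       ∎)
    (telescope-sum N)
    where open ℚ.≤-Reasoning

  lg-phrase : ∀ P X R {y} → X ++ P ++ R ≡ T → 0ℚ ≼ y → let l = length P in
    lg m y ≼ lg m (ι (suc l)) ⊕ lg m (ι (suc (suc l))) ⊕ ι k ⊗ lg m (ι σ) ⊕ costs P R
               ⊕ ι (suc (suc l)) ⊗ e ⊕ lg m (y ⊗ weight l P)
  lg-phrase P X R {y} eqT 0≤y = begin
    lg m y
      ≤⟨ lg-split 1 (suc l) ℕ.≤-refl (s≤s z≤n) 0≤y ⟩
    lg m (suc l ⊘ 1) ⊕ lg m y₁ ⊕ e
      ≤⟨ ⊕-mono (⊕-mono (ℚ.≤-reflexive (cong (lg m) (⊘-1 (suc l)))) (lg-split 1 (suc (suc l)) ℕ.≤-refl (s≤s z≤n) 0≤y₁)) (ℚ.≤-refl {e}) ⟩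
    a ⊕ (lg m (suc (suc l) ⊘ 1) ⊕ lg m y₂ ⊕ e) ⊕ e
      ≤⟨ ⊕-mono (⊕-mono (ℚ.≤-refl {a}) (⊕-mono (⊕-mono (ℚ.≤-reflexive (cong (lg m) (⊘-1 (suc (suc l)))))
           (lg-probability k P [] X R refl eqT 0≤y₂)) (ℚ.≤-refl {e}))) (ℚ.≤-refl {e}) ⟩
    a ⊕ (b ⊕ (kΛ ⊕ (g ⊕ ι l ⊗ e ⊕ lg m (y₂ ⊗ Q))) ⊕ e) ⊕ e
      ≡⟨ solve 7 (λ a b k g n e z → a :+ (b :+ (k :+ (g :+ n :* e :+ z)) :+ e) :+ e
                     := a :+ b :+ k :+ g :+ (con 1 :+ (con 1 :+ n)) :* e :+ z) refl a b kΛ g (ι l) e (lg m (y₂ ⊗ Q)) ⟩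
    a ⊕ b ⊕ kΛ ⊕ g ⊕ (1ℚ ⊕ (1ℚ ⊕ ι l)) ⊗ e ⊕ lg m (y₂ ⊗ Q)
      ≡⟨ cong₂ _⊕_ (cong (λ n → a ⊕ b ⊕ kΛ ⊕ g ⊕ n ⊗ e) (sym (trans (ι-suc (suc l)) (cong (1ℚ ⊕_) (ι-suc l)))))
           (cong (lg m) (solve 4 (λ y u v q → y :* u :* v :* q := y :* (u :* v :* q)) refl y (1 ⊘ suc l) (1 ⊘ suc (suc l)) Q)) ⟩
    a ⊕ b ⊕ kΛ ⊕ g ⊕ ι (suc (suc l)) ⊗ e ⊕ lg m (y ⊗ weight l P) ∎
    where
    open ℚ.≤-Reasoning
    open ⊕-⊗-Solver
    l = length P
    a = lg m (ι (suc l))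
    b = lg m (ι (suc (suc l)))
    kΛ = ι k ⊗ lg m (ι σ)
    g = costs P R
    Q = probability k [] P
    y₁ = y ⊗ (1 ⊘ suc l)
    y₂ = y₁ ⊗ (1 ⊘ suc (suc l))
    0≤y₁ : 0ℚ ≼ y₁
    0≤y₁ = ⊗-nonNeg 0≤y (⊘-nonNeg 1 (suc l))
    0≤y₂ : 0ℚ ≼ y₂
    0≤y₂ = ⊗-nonNeg 0≤y₁ (⊘-nonNeg 1 (suc (suc l)))

  at-H₀-term : ∀ (w : Word σ) c → (fromℚ (occ c w ÷ length w) *ℝ log₂ (fromℚ (length w ÷ occ c w))) at m
                     ≡ (occ c w ⊘ length w) ⊗ surprise w c
  at-H₀-term w c = trans (at-*ℝ (fromℚ (occ c w ÷ length w)) (log₂ (fromℚ (length w ÷ occ c w))) m)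
    (cong₂ _⊗_ (at-fromℚ (occ c w) (length w) m)
      (trans (at-log₂ (fromℚ (length w ÷ occ c w)) m) (cong (lg m) (at-fromℚ (length w) (occ c w) m))))

  at-H₀ : ∀ w → H₀ w at m ≡ sum (allFin σ) (λ c → (occ c w ⊘ length w) ⊗ surprise w c)
  at-H₀ w = trans (at-∑ (allFin σ) (λ c → fromℚ (occ c w ÷ length w) *ℝ log₂ (fromℚ (length w ÷ occ c w))) m)
    (sum-cong (allFin σ) (at-H₀-term w))

  -- Regrouping by positions: the frequency of `c` times the length counts its occurrences, and each
  -- of them pays the surprise of `c`.
  ι-length⊗H₀ : ∀ v → ι (length v) ⊗ H₀ v at m ≡ sum v (surprise v)
  ι-length⊗H₀ v = begin
    ι (length v) ⊗ H₀ v at m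
      ≡⟨ cong (ι (length v) ⊗_) (at-H₀ v) ⟩
    ι (length v) ⊗ sum (allFin σ) (λ c → (occ c v ⊘ length v) ⊗ surprise v c)
      ≡⟨ sum-⊗ (allFin σ) (ι (length v)) (λ c → (occ c v ⊘ length v) ⊗ surprise v c) ⟨
    sum (allFin σ) (λ c → ι (length v) ⊗ ((occ c v ⊘ length v) ⊗ surprise v c))
      ≡⟨ sum-cong (allFin σ) (λ c → trans (sym (⊗-assoc (ι (length v)) (occ c v ⊘ length v) (surprise v c)))
           (cong (_⊗ surprise v c) (ι-length⊗frequency c v))) ⟩
    sum (allFin σ) (λ c → ι (occ c v) ⊗ surprise v c)
      ≡⟨ sum-occ v (surprise v) ⟨
    sum v (surprise v) ∎
    where open ≡-Reasoning

  sum-tails-cost : ∀ X → sum (tails X) cost ≡ costs X [] ⊕ cost []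
  sum-tails-cost []      = trans (⊕-identityʳ _) (sym (⊕-identityˡ _))
  sum-tails-cost (c ∷ X) = trans (cong₂ _⊕_ (cong (λ z → cost (c ∷ z)) (sym (List.++-identityʳ X))) (sum-tails-cost X))
    (sym (⊕-assoc _ (costs X []) (cost [])))

  at-H-term : ∀ W → (fromℚ (length (following W T) ÷ length T) *ℝ H₀ (following W T)) at m
                    ≡ (length (following W T) ⊘ length T) ⊗ H₀ (following W T) at m
  at-H-term W = trans (at-*ℝ (fromℚ (length (following W T) ÷ length T)) (H₀ (following W T)) m)
    (cong (_⊗ H₀ (following W T) at m) (at-fromℚ (length (following W T)) (length T) m))

  at-H : H k T at m ≡ sum (words k) (λ W → (length (following W T) ⊘ length T) ⊗ H₀ (following W T) at m)
  at-H = trans (at-∑ (words k) (λ W → fromℚ (length (following W T) ÷ length T) *ℝ H₀ (following W T)) m)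
    (sum-cong (words k) at-H-term)

  -- The entropy collects the charges by context and `costs` collects them by starting position;
  -- exchanging the two sums matches them. The gap is `cost []`, because `tails T` also contains the
  -- empty suffix.
  costs≤entropy : .{{_ : ℕ.NonZero (length T)}} → costs T [] ≼ ι (length T) ⊗ H k T at m
  costs≤entropy = ℚ.≤-trans (a≼a⊕b (cost-nonNeg [])) (ℚ.≤-reflexive (sym (begin
    ι n ⊗ H k T at m
      ≡⟨ cong (ι n ⊗_) at-H ⟩
    ι n ⊗ sum (words k) (λ W → (len W ⊘ n) ⊗ h W)
      ≡⟨ sum-⊗ (words k) (ι n) (λ W → (len W ⊘ n) ⊗ h W) ⟨
    sum (words k) (λ W → ι n ⊗ ((len W ⊘ n) ⊗ h W))
      ≡⟨ sum-cong (words k) (λ W → trans (sym (⊗-assoc (ι n) (len W ⊘ n) (h W)))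
           (trans (cong (_⊗ h W) (ι⊗⊘ (len W) n)) (ι-length⊗H₀ (following W T)))) ⟩
    sum (words k) (λ W → sum (following W T) (symbolCost W))
      ≡⟨ sum-cong (words k) (λ W → sum-concatMap (symbolAfter W) (tails T) (symbolCost W)) ⟩
    sum (words k) (λ W → sum (tails T) (λ t → sum (symbolAfter W t) (symbolCost W)))
      ≡⟨ sum-swap (words k) (tails T) (λ W t → sum (symbolAfter W t) (symbolCost W)) ⟩
    sum (tails T) cost
      ≡⟨ sum-tails-cost T ⟩
    costs T [] ⊕ cost [] ∎)))
    where
    open ≡-Reasoning
    n = length T
    len : Word σ → ℕ
    len W = length (following W T)
    h : Word σ → ℚ
    h W = H₀ (following W T) at m

-- Distances of equal phrases

take-length-++ : ∀ (xs ys : List A) → take (length xs) (xs ++ ys) ≡ xs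
take-length-++ []       ys = refl
take-length-++ (x ∷ xs) ys = cong (x ∷_) (take-length-++ xs ys)

drop-length-++ : ∀ (xs ys : List A) → drop (length xs) (xs ++ ys) ≡ ys
drop-length-++ []       ys = refl
drop-length-++ (x ∷ xs) ys = drop-length-++ xs ys

prefix-++ : ∀ (xs ys : List A) → Prefix _≡_ xs (xs ++ ys)
prefix-++ []       ys = []
prefix-++ (x ∷ xs) ys = refl ∷ prefix-++ xs ys

nonEmpty⇒0<length : ∀ {xs : List A} → xs ≢ [] → 0 ℕ.< length xs
nonEmpty⇒0<length {xs = []}     xs≢[] = contradiction refl xs≢[]
nonEmpty⇒0<length {xs = x ∷ xs} _     = s≤s z≤n

length-concat-≥ : ∀ {xss : List (List A)} → All (_≢ []) xss → length xss ≤ length (concat xss)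
length-concat-≥ []                     = z≤n
length-concat-≥ {xss = xs ∷ xss} (xs≢[] ∷ pf) = ℕ.≤-trans (ℕ.+-mono-≤ (nonEmpty⇒0<length xs≢[]) (length-concat-≥ pf))
  (ℕ.≤-reflexive (sym (List.length-++ xs)))

module _ {σ : ℕ} where

  _≟ʷ_ : (v w : Word σ) → Dec (v ≡ w)
  _≟ʷ_ = List.≡-dec Fin._≟_

  remainder : (Ps : List (Word σ)) → Fin (length Ps) → Word σ
  remainder (P ∷ Ps) fzero    = concat Ps
  remainder (P ∷ Ps) (fsuc j) = remainder Ps j

  concat-split : ∀ Ps j → concat (take (toℕ j) Ps) ++ lookup Ps j ++ remainder Ps j ≡ concat Ps
  concat-split (P ∷ Ps) fzero    = refl
  concat-split (P ∷ Ps) (fsuc j) = trans (List.++-assoc P (concat (take (toℕ j) Ps)) _) (cong (P ++_) (concat-split Ps j))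

  start-suc : ∀ (P : Word σ) Ps j → start (P ∷ Ps) (fsuc j) ≡ length P ℕ.+ start Ps j
  start-suc P Ps j = List.length-++ P

  sum-lengths : ∀ (Ps : List (Word σ)) → sum (allFin (length Ps)) (λ j → ι (length (lookup Ps j))) ≡ ι (length (concat Ps))
  sum-lengths []       = sym ι-0
  sum-lengths (P ∷ Ps) = trans (sum-allFin-suc (length Ps) (λ j → ι (length (lookup (P ∷ Ps) j))))
    (trans (cong (ι (length P) ⊕_) (sum-lengths Ps))
      (trans (sym (ι-+ (length P) (length (concat Ps)))) (cong ι (sym (List.length-++ P)))))

  copyDistance literalSpan distance : Code σ → ℕ
  copyDistance (copy d ℓ)  = d
  copyDistance (literal c) = 0
  literalSpan (copy d ℓ)  = 0
  literalSpan (literal c) = σ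
  distance (copy d ℓ)  = d
  distance (literal c) = σ

  distance≡ : ∀ code → distance code ≡ copyDistance code ℕ.+ literalSpan code
  distance≡ (copy d ℓ)  = sym (ℕ.+-identityʳ d)
  distance≡ (literal c) = refl

module Rightmost {σ : ℕ} (T : Word σ) where

  RightmostFrom : ℕ → (Ps : List (Word σ)) → (Fin (length Ps) → Code σ) → Set
  RightmostFrom i Ps code = ∀ j {p} → p ≡ i ℕ.+ start Ps j → RightmostCode T p (lookup Ps j) (code j)

  rightmostFrom-head : ∀ {i P Ps code} → RightmostFrom i (P ∷ Ps) code → RightmostCode T i P (code fzero)
  rightmostFrom-head {i} rm = rm fzero (sym (ℕ.+-identityʳ i))

  rightmostFrom-tail : ∀ X {P Ps code} → RightmostFrom (length X) (P ∷ Ps) code →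
                       RightmostFrom (length (X ++ P)) Ps (code ∘ fsuc)
  rightmostFrom-tail X {P} {Ps} rm j p≡ = rm (fsuc j) (trans p≡ (trans (cong (ℕ._+ start Ps j) (List.length-++ X))
    (trans (ℕ.+-assoc (length X) (length P) (start Ps j)) (cong (length X ℕ.+_) (sym (start-suc P Ps j))))))

  step-++ : ∀ X P Ps → X ++ concat (P ∷ Ps) ≡ T → (X ++ P) ++ concat Ps ≡ T
  step-++ X P Ps eq = trans (List.++-assoc X P (concat Ps)) eq

module Distances {σ : ℕ} (T w : Word σ) where

  open Rightmost T

  -- No copy of w from position i on has its source before Q.
  SourcesFrom : ℕ → ℕ → Set
  SourcesFrom Q i = ∀ p d → i ≤ p → Distance T p w d → (∀ d′ → Distance T p w d′ → d ≤ d′) → Q ℕ.+ d ≤ p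

  sourcesFrom-0 : ∀ i → SourcesFrom 0 i
  sourcesFrom-0 i p d _ (s , _ , s+d≡p) _ = ℕ.≤-trans (ℕ.m≤n+m d s) (ℕ.≤-reflexive s+d≡p)

  sourcesFrom-weaken : ∀ {Q i i′} → i ≤ i′ → SourcesFrom Q i → SourcesFrom Q i′
  sourcesFrom-weaken i≤i′ h p d i′≤p = h p d (ℕ.≤-trans i≤i′ i′≤p)

  -- The occurrence at `Q` is itself an admissible source for every later copy, at distance p - Q,
  -- and the chosen distance is minimal. This is where the rightmost choice enters.
  sourcesFrom-occurrence : ∀ {Q i} → Q ℕ.< i → Prefix _≡_ w (drop Q T) → SourcesFrom Q i
  sourcesFrom-occurrence {Q} Q<i occurs p d i≤p _ min =
    ℕ.≤-trans (ℕ.+-monoʳ-≤ Q (min (p ℕ.∸ Q) (Q , record { earlier = Q<p ; occurs = occurs } , Q+≡))) (ℕ.≤-reflexive Q+≡)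
    where
    Q<p = ℕ.<-≤-trans Q<i i≤p
    Q+≡ : Q ℕ.+ (p ℕ.∸ Q) ≡ p
    Q+≡ = ℕ.m+[n∸m]≡n (ℕ.<⇒≤ Q<p)

  copyDistance-≤ : ∀ {Q i code} → Q ≤ i → SourcesFrom Q i → RightmostCode T i w code → Q ℕ.+ copyDistance code ≤ i
  copyDistance-≤ {Q} {i} Q≤i h (copy dist min) = h i _ ℕ.≤-refl dist min
  copyDistance-≤ {Q} {i} Q≤i h (literal _)     = ℕ.≤-trans (ℕ.≤-reflexive (ℕ.+-identityʳ Q)) Q≤i

  -- Each copy of w reaches back at most to the previous phrase equal to w, so the distances telescope.
  copyDistances-sum : ∀ Ps X Q code → X ++ concat Ps ≡ T → All (_≢ []) Ps → RightmostFrom (length X) Ps code →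
    Q ≤ length X → SourcesFrom Q (length X) →
    sum (allFin (length Ps)) (λ j → indicator (w ≟ʷ lookup Ps j) (ι (copyDistance (code j)))) ⊕ ι Q ≼ ι (length T)
  copyDistances-sum [] X Q code eqT _ _ Q≤X _ = ℚ.≤-trans (ℚ.≤-reflexive (⊕-identityˡ (ι Q)))
    (ι-mono (ℕ.≤-trans Q≤X (ℕ.≤-trans (List.length-++-≤ˡ X) (ℕ.≤-reflexive (cong length eqT)))))
  copyDistances-sum (P ∷ Ps) X Q code eqT (P≢[] ∷ Ps≢[]) rm Q≤X h =
    ℚ.≤-trans (ℚ.≤-reflexive (cong (_⊕ ι Q) (sum-allFin-suc (length Ps) (λ j → indicator (w ≟ʷ lookup (P ∷ Ps) j) (ι (copyDistance (code j)))))))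
      (step (w ≟ʷ P))
    where
    open ℚ.≤-Reasoning
    open ⊕-⊗-Solver
    d = copyDistance (code fzero)
    S = sum (allFin (length Ps)) (λ j → indicator (w ≟ʷ lookup Ps j) (ι (copyDistance (code (fsuc j)))))
    X≤X++P : length X ≤ length (X ++ P)
    X≤X++P = List.length-++-≤ˡ X
    X<X++P : length X ℕ.< length (X ++ P)
    X<X++P = ℕ.<-≤-trans (ℕ.m<m+n (length X) (nonEmpty⇒0<length P≢[])) (ℕ.≤-reflexive (sym (List.length-++ X)))
    ih : ∀ Q′ → Q′ ≤ length (X ++ P) → SourcesFrom Q′ (length (X ++ P)) → S ⊕ ι Q′ ≼ ι (length T)
    ih Q′ = copyDistances-sum Ps (X ++ P) Q′ (code ∘ fsuc) (step-++ X P Ps eqT) Ps≢[] (rightmostFrom-tail X rm)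
    occurs : w ≡ P → Prefix _≡_ w (drop (length X) T)
    occurs refl = subst (Prefix _≡_ P) (trans (sym (drop-length-++ X (concat (P ∷ Ps)))) (cong (drop (length X)) eqT)) (prefix-++ P (concat Ps))
    step : (w≟P : Dec (w ≡ P)) → indicator w≟P (ι d) ⊕ S ⊕ ι Q ≼ ι (length T)
    step (no _)    = ℚ.≤-trans (ℚ.≤-reflexive (cong (_⊕ ι Q) (⊕-identityˡ S)))
      (ih Q (ℕ.≤-trans Q≤X X≤X++P) (sourcesFrom-weaken X≤X++P h))
    step (yes w≡P) = begin
      ι d ⊕ S ⊕ ι Q            ≡⟨ solve 3 (λ d s q → d :+ s :+ q := s :+ (q :+ d)) refl (ι d) S (ι Q) ⟩
      S ⊕ (ι Q ⊕ ι d)          ≡⟨ cong (S ⊕_) (ι-+ Q d) ⟨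
      S ⊕ ι (Q ℕ.+ d)          ≤⟨ ⊕-mono (ℚ.≤-refl {S}) (ι-mono (copyDistance-≤ Q≤X h
                                     (subst (λ v → RightmostCode T (length X) v (code fzero)) (sym w≡P) (rightmostFrom-head rm)))) ⟩
      -- The current phrase becomes the new barrier for sources; being non-empty, it starts strictly
      -- before all later phrases.
      S ⊕ ι (length X)         ≤⟨ ih (length X) X≤X++P (sourcesFrom-occurrence X<X++P (occurs w≡P)) ⟩
      ι (length T)             ∎

  literalSpan-repeated : ∀ X Y {code} → X ++ Y ≡ T → (∀ c → w ≡ [ c ] → c ∈ X) →
                         RightmostCode T (length X) w code → literalSpan code ≡ 0
  literalSpan-repeated X Y eqT h (copy _ _)             = refl
  literalSpan-repeated X Y eqT h (literal {c} (w≡ , c∉)) = contradiction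
    (subst (c ∈_) (trans (sym (take-length-++ X Y)) (cong (take (length X)) eqT)) (h c w≡)) c∉

  literalSpans-repeated : ∀ Ps X code → X ++ concat Ps ≡ T → RightmostFrom (length X) Ps code →
    (∀ c → w ≡ [ c ] → c ∈ X) →
    sum (allFin (length Ps)) (λ j → indicator (w ≟ʷ lookup Ps j) (ι (literalSpan (code j)))) ≡ 0ℚ
  literalSpans-repeated []       X code eqT rm h = refl
  literalSpans-repeated (P ∷ Ps) X code eqT rm h =
    trans (sum-allFin-suc (length Ps) (λ j → indicator (w ≟ʷ lookup (P ∷ Ps) j) (ι (literalSpan (code j)))))
      (trans (cong₂ _⊕_ (head (w ≟ʷ P)) (literalSpans-repeated Ps (X ++ P) (code ∘ fsuc) (step-++ X P Ps eqT)
        (rightmostFrom-tail X rm) (λ c w≡ → ∈-++⁺ˡ (h c w≡)))) (⊕-identityˡ 0ℚ))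
    where
    head : (w≟P : Dec (w ≡ P)) → indicator w≟P (ι (literalSpan (code fzero))) ≡ 0ℚ
    head (no _)     = refl
    head (yes refl) = trans (cong ι (literalSpan-repeated X (concat (P ∷ Ps)) eqT h (rightmostFrom-head rm))) ι-0

  literalSpan-≤ : ∀ (code : Code σ) → ι (literalSpan code) ≼ ι σ
  literalSpan-≤ (copy _ _)  = ι-mono z≤n
  literalSpan-≤ (literal _) = ℚ.≤-refl

  -- At most one phrase equal to `w` is a literal: once such a phrase has passed, its symbol lies in
  -- the processed part of the text, and no later literal may repeat it.
  literalSpans-sum : ∀ Ps X code → X ++ concat Ps ≡ T → RightmostFrom (length X) Ps code →
    sum (allFin (length Ps)) (λ j → indicator (w ≟ʷ lookup Ps j) (ι (literalSpan (code j)))) ≼ ι σ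
  literalSpans-sum []       X code eqT rm = ι-nonNeg σ
  literalSpans-sum (P ∷ Ps) X code eqT rm =
    ℚ.≤-trans (ℚ.≤-reflexive (sum-allFin-suc (length Ps) (λ j → indicator (w ≟ʷ lookup (P ∷ Ps) j) (ι (literalSpan (code j))))))
      (step (w ≟ʷ P))
    where
    S = sum (allFin (length Ps)) (λ j → indicator (w ≟ʷ lookup Ps j) (ι (literalSpan (code (fsuc j)))))
    step : (w≟P : Dec (w ≡ P)) → indicator w≟P (ι (literalSpan (code fzero))) ⊕ S ≼ ι σ
    step (no _)     = ℚ.≤-trans (ℚ.≤-reflexive (⊕-identityˡ S))
      (literalSpans-sum Ps (X ++ P) (code ∘ fsuc) (step-++ X P Ps eqT) (rightmostFrom-tail X rm))
    step (yes refl) = ℚ.≤-trans (⊕-mono (literalSpan-≤ (code fzero)) (ℚ.≤-reflexive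
        (literalSpans-repeated Ps (X ++ P) (code ∘ fsuc) (step-++ X P Ps eqT) (rightmostFrom-tail X rm)
          (λ c w≡ → ∈-++⁺ʳ X (subst (c ∈_) (sym w≡) (here refl))))))
      (ℚ.≤-reflexive (⊕-identityʳ (ι σ)))

  indicator-⊕ : {P : Set} (P? : Dec P) (a b : ℕ) {c : ℕ} → c ≡ a ℕ.+ b →
                indicator P? (ι c) ≡ indicator P? (ι a) ⊕ indicator P? (ι b)
  indicator-⊕ (yes _) a b c≡ = trans (cong ι c≡) (ι-+ a b)
  indicator-⊕ (no _)  a b _  = sym (⊕-identityˡ 0ℚ)

  distances-sum : ∀ Ps code → concat Ps ≡ T → All (_≢ []) Ps → RightmostFrom 0 Ps code →
    sum (allFin (length Ps)) (λ j → indicator (w ≟ʷ lookup Ps j) (ι (distance (code j)))) ≼ ι (length T ℕ.+ σ)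
  distances-sum Ps code eqT Ps≢[] rm = begin
    sum J (λ j → indicator (w ≟ʷ lookup Ps j) (ι (distance (code j))))
      ≡⟨ sum-cong J (λ j → indicator-⊕ (w ≟ʷ lookup Ps j) (copyDistance (code j)) (literalSpan (code j)) (distance≡ (code j))) ⟩
    sum J (λ j → f j ⊕ g j)
      ≡⟨ sum-⊕ J f g ⟩
    sum J f ⊕ sum J g
      ≤⟨ ⊕-mono (ℚ.≤-trans (a≼a⊕b (ι-nonNeg 0)) (copyDistances-sum Ps [] 0 code eqT Ps≢[] rm z≤n (sourcesFrom-0 0)))
                (literalSpans-sum Ps [] code eqT rm) ⟩
    ι (length T) ⊕ ι σ
      ≡⟨ ι-+ (length T) σ ⟨
    ι (length T ℕ.+ σ) ∎
    where
    open ℚ.≤-Reasoning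
    J = allFin (length Ps)
    f g : Fin (length Ps) → ℚ
    f j = indicator (w ≟ʷ lookup Ps j) (ι (copyDistance (code j)))
    g j = indicator (w ≟ʷ lookup Ps j) (ι (literalSpan (code j)))

-- Summing over the phrases of a parsing

indicator-refl : ∀ {σ} (w : Word σ) x → indicator (w ≟ʷ w) x ≡ x
indicator-refl w x with w ≟ʷ w
... | yes _  = refl
... | no w≢w = contradiction refl w≢w

indicator-⊗ : {P : Set} (P? : Dec P) (x y : ℚ) → y ⊗ indicator P? x ≡ indicator P? (x ⊗ y)
indicator-⊗ (yes _) x y = ⊗-comm y x
indicator-⊗ (no _)  x y = ⊗-zeroʳ y

module ParsingLength {σ : ℕ} {{σ≢0 : ℕ.NonZero σ}} (T : Word σ) (m k : ℕ)
  (Ps : List (Word σ)) (code : Fin (length Ps) → Code σ)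
  (factors : concat Ps ≡ T) (nonEmpty : All (_≢ []) Ps) (rightmost : Rightmost.RightmostFrom T 0 Ps code) where

  open CodeLength T m k using (e; costs; costs-++)
  open PhraseLength T m k

  J : List (Fin (length Ps))
  J = allFin (length Ps)

  n : ℕ
  n = length T

  P : Fin (length Ps) → Word σ
  P = lookup Ps

  D : Fin (length Ps) → ℚ
  D j = ι (distance (code j))

  phrase-split : ∀ j → concat (take (toℕ j) Ps) ++ P j ++ remainder Ps j ≡ T
  phrase-split j = trans (concat-split Ps j) factors

  length-phrase≤ : ∀ j → length (P j) ≤ n
  length-phrase≤ j = ℕ.≤-trans (List.length-++-≤ˡ (P j))
    (ℕ.≤-trans (List.length-++-≤ʳ (P j ++ remainder Ps j) {concat (take (toℕ j) Ps)}) (ℕ.≤-reflexive (cong length (phrase-split j))))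

  expected-distances : sum J (λ j → D j ⊗ weight (length (P j)) (P j)) ≼ ι (n ℕ.+ σ)
  expected-distances = begin
    sum J (λ j → D j ⊗ weight (length (P j)) (P j))
      -- Each phrase is one term of a non-negative sum over all words of length at most n. The
      -- enlarged sum no longer ties the word to the phrase, so its order can be exchanged and the
      -- telescoped distances used for each word separately.
      ≤⟨ sum-mono J (λ j → ℚ.≤-trans (ℚ.≤-reflexive (sym (indicator-refl (P j) (D j ⊗ weight (length (P j)) (P j)))))
           (ℚ.≤-trans (sum-∈ (F j (length (P j))) (F-nonNeg j (length (P j))) (∈-words (P j)))
             (sum-∈ (λ l → sum (words l) (F j l)) (λ l → sum-nonNeg (words l) (F-nonNeg j l)) (∈-downFrom⁺ (s≤s (length-phrase≤ j)))))) ⟩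
    sum J (λ j → sum L (λ l → sum (words l) (F j l)))
      ≡⟨ sum-swap J L (λ j l → sum (words l) (F j l)) ⟩
    sum L (λ l → sum J (λ j → sum (words l) (F j l)))
      ≡⟨ sum-cong L (λ l → sum-swap J (words l) (λ j w → F j l w)) ⟩
    sum L (λ l → sum (words l) (λ w → sum J (λ j → F j l w)))
      ≤⟨ sum-mono L (λ l → sum-mono (words l) (per-word l)) ⟩
    sum L (λ l → sum (words l) (λ w → N ⊗ weight l w))
      ≡⟨ trans (sum-cong L (λ l → sum-⊗ (words l) N (weight l))) (sum-⊗ L N (λ l → sum (words l) (weight l))) ⟩
    N ⊗ sum L (λ l → sum (words l) (weight l))
      ≤⟨ ⊗-monoˡ (ι-nonNeg (n ℕ.+ σ)) (weight-sum (suc n)) ⟩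
    N ⊗ 1ℚ
      ≡⟨ ⊗-identityʳ N ⟩
    N ∎
    where
    open ℚ.≤-Reasoning
    L = downFrom (suc n)
    N = ι (n ℕ.+ σ)
    F : Fin (length Ps) → ℕ → Word σ → ℚ
    F j l w = indicator (w ≟ʷ P j) (D j ⊗ weight l w)
    F-nonNeg : ∀ j l w → 0ℚ ≼ F j l w
    F-nonNeg j l w = indicator-nonNeg (w ≟ʷ P j) (⊗-nonNeg (ι-nonNeg (distance (code j))) (weight-nonNeg l w))
    per-word : ∀ l w → sum J (λ j → F j l w) ≼ N ⊗ weight l w
    per-word l w = begin
      sum J (λ j → F j l w)
        ≡⟨ sum-cong J (λ j → indicator-⊗ (w ≟ʷ P j) (D j) (weight l w)) ⟨
      sum J (λ j → weight l w ⊗ indicator (w ≟ʷ P j) (D j))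
        ≡⟨ sum-⊗ J (weight l w) (λ j → indicator (w ≟ʷ P j) (D j)) ⟩
      weight l w ⊗ sum J (λ j → indicator (w ≟ʷ P j) (D j))
        ≤⟨ ⊗-monoˡ (weight-nonNeg l w) (Distances.distances-sum T w Ps code factors nonEmpty rightmost) ⟩
      weight l w ⊗ N
        ≡⟨ ⊗-comm (weight l w) N ⟩
      N ⊗ weight l w ∎

  costs-concat : ∀ (Qs : List (Word σ)) →
                 sum (allFin (length Qs)) (λ j → costs (lookup Qs j) (remainder Qs j)) ≡ costs (concat Qs) []
  costs-concat []       = refl
  costs-concat (Q ∷ Qs) = trans (sum-allFin-suc (length Qs) (λ j → costs (lookup (Q ∷ Qs) j) (remainder (Q ∷ Qs) j)))
    (trans (cong₂ _⊕_ (cong (costs Q) (sym (List.++-identityʳ (concat Qs)))) (costs-concat Qs))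
      (sym (costs-++ Q (concat Qs) [])))

  module Bits (K B : ℕ) (μ C : ℚ) (C≤B : C ≼ ι B) (lgD≤μ : ∀ j → lg m (D j) ≼ μ) where

    θ : ℚ
    θ = 1 ⊘ (2 ℕ.^ K)

    0≤θ : 0ℚ ≼ θ
    0≤θ = ⊘-nonNeg 1 (2 ℕ.^ K)

    l : Fin (length Ps) → ℕ
    l j = length (P j)

    overhead : Fin (length Ps) → ℚ
    overhead j = 1ℚ ⊕ lg m (lg m (D j)) ⊕ lg m (ι (l j))

    -- The linear bound is applied to log d itself, and log d is bounded uniformly by μ, about log
    -- n. Over all phrases the part μ/2ᴷ thus amounts to about c (log n)/2ᴷ, a small multiple of n
    -- log σ.
    overhead-≤ : ∀ j → overhead j ≼ 1ℚ ⊕ (ι K ⊕ μ ⊗ θ) ⊕ (ι K ⊕ ι (l j) ⊗ θ)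
    overhead-≤ j = ⊕-mono (⊕-mono (ℚ.≤-refl {1ℚ})
      (ℚ.≤-trans (lg-≼-linear m K (lg-nonNeg m (D j))) (⊕-mono (ℚ.≤-refl {ι K}) (⊗-monoʳ 0≤θ (lgD≤μ j)))))
      (lg-≼-linear m K (ι-nonNeg (l j)))

    overhead-nonNeg : ∀ j → 0ℚ ≼ overhead j
    overhead-nonNeg j = ⊕-nonNeg (⊕-nonNeg (subst₂ _≼_ ι-0 ι-1 (ι-mono z≤n)) (lg-nonNeg m _)) (lg-nonNeg m _)

    distance-≤ : ∀ j → lg m (D j) ≼ (ι K ⊕ (1ℚ ⊕ ι (l j)) ⊗ θ) ⊕ (ι K ⊕ (1ℚ ⊕ (1ℚ ⊕ ι (l j))) ⊗ θ) ⊕ ι k ⊗ lg m (ι σ)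
                   ⊕ costs (P j) (remainder Ps j) ⊕ (1ℚ ⊕ (1ℚ ⊕ ι (l j))) ⊗ e
                   ⊕ (ι K ⊕ D j ⊗ weight (l j) (P j) ⊗ θ)
    distance-≤ j = ℚ.≤-trans (lg-phrase (P j) (concat (take (toℕ j) Ps)) (remainder Ps j) (phrase-split j) 0≤D)
      (⊕-mono (⊕-mono (⊕-mono (⊕-mono (⊕-mono
        (subst (λ z → lg m (ι (suc (l j))) ≼ ι K ⊕ z ⊗ θ) (ι-suc (l j)) (lg-≼-linear m K (ι-nonNeg (suc (l j)))))
        (subst (λ z → lg m (ι (suc (suc (l j)))) ≼ ι K ⊕ z ⊗ θ) ssl (lg-≼-linear m K (ι-nonNeg (suc (suc (l j)))))))
        ℚ.≤-refl) ℚ.≤-refl) (ℚ.≤-reflexive (cong (_⊗ e) ssl)))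
        (lg-≼-linear m K (⊗-nonNeg 0≤D (weight-nonNeg (l j) (P j)))))
      where
      0≤D = ι-nonNeg (distance (code j))
      ssl : ι (suc (suc (l j))) ≡ 1ℚ ⊕ (1ℚ ⊕ ι (l j))
      ssl = trans (ι-suc (suc (l j))) (cong (1ℚ ⊕_) (ι-suc (l j)))

    -- The three separate `ι K` belong to the logarithms of |P|+1, of |P|+2 and of d q(P). The three
    -- single θ and the two e are the constant parts of (1+l) θ, (2+l) θ and (2+l) e; the parts
    -- linear in l go to `perSymbol`. The factor `ι B` stems from the hidden constant of the
    -- encoding.
    perPhrase perSymbol : ℚ
    perPhrase = (ι K ⊕ ι K ⊕ ι K ⊕ θ ⊕ θ ⊕ θ) ⊕ ι k ⊗ lg m (ι σ) ⊕ (e ⊕ e) ⊕ ι B ⊗ (1ℚ ⊕ (ι K ⊕ ι K) ⊕ μ ⊗ θ)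
    perSymbol = θ ⊕ θ ⊕ e ⊕ ι B ⊗ θ

    bits-≤ : ∀ j → lg m (D j) ⊕ C ⊗ overhead j ≼
      perPhrase ⊕ perSymbol ⊗ ι (l j) ⊕ costs (P j) (remainder Ps j) ⊕ θ ⊗ (D j ⊗ weight (l j) (P j))
    bits-≤ j = ℚ.≤-trans
      (⊕-mono (distance-≤ j) (⊗-mono (ι-nonNeg B) (overhead-nonNeg j) C≤B (overhead-≤ j)))
      (ℚ.≤-reflexive (solve 9
        (λ κ θ l kΛ g e w B μ →
          (κ :+ (con 1 :+ l) :* θ) :+ (κ :+ (con 1 :+ (con 1 :+ l)) :* θ) :+ kΛ :+ g :+ (con 1 :+ (con 1 :+ l)) :* e
            :+ (κ :+ w :* θ) :+ B :* (con 1 :+ (κ :+ μ :* θ) :+ (κ :+ l :* θ))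
          := ((κ :+ κ :+ κ :+ θ :+ θ :+ θ) :+ kΛ :+ (e :+ e) :+ B :* (con 1 :+ (κ :+ κ) :+ μ :* θ))
            :+ (θ :+ θ :+ e :+ B :* θ) :* l :+ g :+ θ :* w) refl
        (ι K) θ (ι (l j)) (ι k ⊗ lg m (ι σ)) (costs (P j) (remainder Ps j)) e (D j ⊗ weight (l j) (P j)) (ι B) μ))
      where open ⊕-⊗-Solver

    bits-sum : .{{_ : ℕ.NonZero n}} → sum J (λ j → lg m (D j) ⊕ C ⊗ overhead j) ≼
      ι (length Ps) ⊗ perPhrase ⊕ perSymbol ⊗ ι n ⊕ ι n ⊗ H k T at m ⊕ θ ⊗ ι (n ℕ.+ σ)
    bits-sum = begin
      sum J (λ j → lg m (D j) ⊕ C ⊗ overhead j)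
        ≤⟨ sum-mono J bits-≤ ⟩
      sum J (λ j → perPhrase ⊕ perSymbol ⊗ ι (l j) ⊕ g j ⊕ θ ⊗ w j)
        ≡⟨ trans (sum-⊕ J (λ j → perPhrase ⊕ perSymbol ⊗ ι (l j) ⊕ g j) (λ j → θ ⊗ w j))
             (cong₂ _⊕_ (trans (sum-⊕ J (λ j → perPhrase ⊕ perSymbol ⊗ ι (l j)) g)
               (cong (_⊕ sum J g) (sum-⊕ J (λ _ → perPhrase) (λ j → perSymbol ⊗ ι (l j))))) (sum-⊗ J θ w)) ⟩
      sum J (λ _ → perPhrase) ⊕ sum J (λ j → perSymbol ⊗ ι (l j)) ⊕ sum J g ⊕ θ ⊗ sum J w
        ≤⟨ ⊕-mono (⊕-mono (ℚ.≤-reflexive (cong₂ _⊕_ (sum-allFin-const (length Ps) perPhrase)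
             (trans (sum-⊗ J perSymbol (λ j → ι (l j))) (cong (perSymbol ⊗_) (trans (sum-lengths Ps) (cong (λ t → ι (length t)) factors))))))
             (ℚ.≤-trans (ℚ.≤-reflexive (trans (costs-concat Ps) (cong (λ t → costs t []) factors))) costs≤entropy))
             (⊗-monoˡ 0≤θ expected-distances) ⟩
      ι (length Ps) ⊗ perPhrase ⊕ perSymbol ⊗ ι n ⊕ ι n ⊗ H k T at m ⊕ θ ⊗ ι (n ℕ.+ σ) ∎
      where
      open ℚ.≤-Reasoning
      g w : Fin (length Ps) → ℚ
      g j = costs (P j) (remainder Ps j)
      w j = D j ⊗ weight (l j) (P j)

-- Asymptotics

opaque
  unfolding _at_ _⊕_

  ≤ℝ-elim : ∀ {x y} → x ≤ℝ y → ∀ t → ∃[ N ] (∀ m → N ≤ m → x at m ≼ y at m ⊕ 1 ⊘ suc t)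
  ≤ℝ-elim x≤y t = x≤y (1 ÷ suc t) (÷-positive (suc t))

  ≤ℝ-intro : ∀ {x y} → (∀ t → ∃[ N ] (∀ m → N ≤ m → x at m ≼ y at m ⊕ 1 ⊘ suc t)) → x ≤ℝ y
  ≤ℝ-intro {x} {y} h ε 0<ε = let t , t≤ε = archimedean ε 0<ε in let N , bound = h t in
    N , λ m N≤m → ℚ.≤-trans (bound m N≤m) (ℚ.+-monoʳ-≤ (seq y m) t≤ε)

  ≤ℝ-trans : ∀ {x y z} → x ≤ℝ y → y ≤ℝ z → x ≤ℝ z
  ≤ℝ-trans {x} {y} {z} x≤y y≤z ε 0<ε =
    let M , xy = x≤y (½ ℚ.* ε) (half-pos 0<ε)
        N , yz = y≤z (½ ℚ.* ε) (half-pos 0<ε) in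
    M ℕ.⊔ N , λ m ≤m → ℚ.≤-trans (xy m (ℕ.m⊔n≤o⇒m≤o M N ≤m))
      (ℚ.≤-trans (ℚ.+-monoˡ-≤ (½ ℚ.* ε) (yz m (ℕ.m⊔n≤o⇒n≤o M N ≤m)))
        (ℚ.≤-reflexive (trans (ℚ.+-assoc (seq z m) (½ ℚ.* ε) (½ ℚ.* ε)) (cong (seq z m ℚ.+_) (half-+ ε)))))

  +ℝ-mono : ∀ {x y u v} → x ≤ℝ y → u ≤ℝ v → (x +ℝ u) ≤ℝ (y +ℝ v)
  +ℝ-mono {x} {y} {u} {v} x≤y u≤v ε 0<ε =
    let M , xy = x≤y (½ ℚ.* ε) (half-pos 0<ε)
        N , uv = u≤v (½ ℚ.* ε) (half-pos 0<ε) in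
    M ℕ.⊔ N , λ m ≤m → ℚ.≤-trans (ℚ.+-mono-≤ (xy m (ℕ.m⊔n≤o⇒m≤o M N ≤m)) (uv m (ℕ.m⊔n≤o⇒n≤o M N ≤m)))
      (ℚ.≤-reflexive (trans (rearrange (seq y m) (seq v m) (½ ℚ.* ε)) (cong (seq y m ⊕ seq v m ⊕_) (half-+ ε))))
    where
    rearrange : ∀ a b h → a ⊕ h ⊕ (b ⊕ h) ≡ a ⊕ b ⊕ (h ⊕ h)
    rearrange a b h = solve 3 (λ a b h → a :+ h :+ (b :+ h) := a :+ b :+ (h :+ h)) refl a b h
      where open ⊕-⊗-Solver

  0<fromℚ : ∀ t → 0ℝ <ℝ fromℚ (1 ÷ suc t)
  0<fromℚ t = 1 ÷ suc t , ÷-positive (suc t) , 0 , λ m _ → ℚ.≤-reflexive (ℚ.+-identityˡ (1 ÷ suc t))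

  0<ℝ-elim : ∀ {x} → 0ℝ <ℝ x → ∃[ t ] ∃[ N ] (∀ m → N ≤ m → 1 ⊘ suc t ≼ x at m)
  0<ℝ-elim (δ , 0<δ , N , h) = let t , t≤δ = archimedean δ 0<δ in
    t , N , λ m N≤m → ℚ.≤-trans t≤δ (ℚ.≤-trans (ℚ.≤-reflexive (sym (ℚ.+-identityˡ δ))) (h m N≤m))

  ≼-ceiling : ∀ q → ∃[ n ] (q ≼ ι n)
  ≼-ceiling q with ℚ.≤-total 0ℚ q
  ... | inj₂ q≤0 = 0 , q≤0
  ... | inj₁ 0≤q = ℤ.∣ ℚ.↥ q ∣ , ℚ.≤-trans (ℚ.≤-reflexive (nonNeg-fraction q 0≤q))
    (÷-mono {ℤ.∣ ℚ.↥ q ∣} {ℚ.↧ₙ q} {ℤ.∣ ℚ.↥ q ∣} {1} (ℕ.*-monoʳ-≤ ℤ.∣ ℚ.↥ q ∣ (ℕ.>-nonZero⁻¹ (ℚ.↧ₙ q))))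

  at-bounded : ∀ x → ∃[ B ] ∃[ N ] (∀ m → N ≤ m → x at m ≼ ι B)
  at-bounded x = let b , _ , N , h = bounded x in let B , b≤B = ≼-ceiling b in
    B , N , λ m N≤m → ℚ.≤-trans (p≤∣p∣ (seq x m)) (ℚ.≤-trans (h m N≤m) b≤B)

  at-recip : ∀ x m → 1ℚ ≼ x at m → x at m ⊗ recip x at m ≡ 1ℚ
  at-recip x m 1≤x = trans (cong (ℚ._* recipApprox 0 (seq x m)) (sym (ℚ.p≥q⇒p⊔q≡p 1≤x))) (recip-inverse (seq x m))

  1⊘≼1 : ∀ n → 1 ⊘ suc n ≼ 1ℚ
  1⊘≼1 n = ÷-mono {1} {suc n} {1} {1} (ℕ.*-monoʳ-≤ 1 (s≤s (z≤n {n})))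

  ι⊗1⊘-≼ : ∀ n m t → n * suc t ≤ suc m → ι n ⊗ (1 ⊘ suc m) ≼ 1 ⊘ suc t
  ι⊗1⊘-≼ n m t nt≤m = subst (_≼ 1 ÷ suc t) (sym (÷-* n 1 1 (suc m))) (÷-mono {n * 1} {1 * suc m} {1} {suc t}
    (ℕ.≤-trans (ℕ.≤-reflexive (cong (_* suc t) (ℕ.*-identityʳ n))) (ℕ.≤-trans nt≤m (ℕ.≤-reflexive (sym (trans (ℕ.*-identityˡ (1 * suc m)) (ℕ.*-identityˡ (suc m))))))))

∑-mono : ∀ (xs : List A) {f g : A → ℝ} → (∀ x → f x ≤ℝ g x) → ∑ xs f ≤ℝ ∑ xs g
∑-mono []       f≤g = ≤ℝ-intro {0ℝ} {0ℝ} λ t → 0 , λ m _ → a≼a⊕b (⊘-nonNeg 1 (suc t))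
∑-mono (x ∷ xs) {f} {g} f≤g = +ℝ-mono {f x} {g x} {∑ xs f} {∑ xs g} (f≤g x) (∑-mono xs {f} {g} f≤g)

-- With error 2⁻ᴷ in log x ≤ K + x/2ᴷ, the lower-order terms cost overhead₁ bits per
-- phrase and 2⁻ᴷ overhead₂ · n log σ bits in total.
overhead₁ : ℕ → ℕ → ℕ
overhead₁ K B = K ℕ.+ K ℕ.+ K ℕ.+ 5 ℕ.+ B * suc (K ℕ.+ K)

overhead₂ : ℕ → ℕ → ℕ → ℕ
overhead₂ B a A = B * (a ℕ.+ a) ℕ.+ (2 ℕ.+ B ℕ.+ A)

ι-overhead₁ : ∀ K B → ι (overhead₁ K B) ≡
  ι K ⊕ ι K ⊕ ι K ⊕ ι 5 ⊕ ι B ⊗ (1ℚ ⊕ (ι K ⊕ ι K))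
ι-overhead₁ K B = trans (ι-+ (K ℕ.+ K ℕ.+ K ℕ.+ 5) (B * suc (K ℕ.+ K)))
  (cong₂ _⊕_ (trans (ι-+ (K ℕ.+ K ℕ.+ K) 5) (cong (_⊕ ι 5) (trans (ι-+ (K ℕ.+ K) K) (cong (_⊕ ι K) (ι-+ K K)))))
    (trans (ι-* B (suc (K ℕ.+ K))) (cong (ι B ⊗_) (trans (ι-suc (K ℕ.+ K)) (cong (1ℚ ⊕_) (ι-+ K K))))))

ι-overhead₂ : ∀ B a A → ι (overhead₂ B a A) ≡ ι B ⊗ (ι a ⊕ ι a) ⊕ (ι 2 ⊕ ι B ⊕ ι A)
ι-overhead₂ B a A = trans (ι-+ (B * (a ℕ.+ a)) (2 ℕ.+ B ℕ.+ A))
  (cong₂ _⊕_ (trans (ι-* B (a ℕ.+ a)) (cong (ι B ⊗_) (ι-+ a a)))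
    (trans (ι-+ (2 ℕ.+ B) A) (cong (_⊕ ι A) (ι-+ 2 B))))

ι-5 : ι 5 ≡ 1ℚ ⊕ (1ℚ ⊕ (1ℚ ⊕ (1ℚ ⊕ 1ℚ)))
ι-5 = trans (ι-suc 4) (cong (1ℚ ⊕_) (trans (ι-suc 3) (cong (1ℚ ⊕_) (trans (ι-suc 2) (cong (1ℚ ⊕_) (trans (ι-suc 1) (cong (1ℚ ⊕_) ι-1)))))))

ι-2 : ι 2 ≡ 1ℚ ⊕ 1ℚ
ι-2 = trans (ι-suc 1) (cong (1ℚ ⊕_) ι-1)

0≤1 : 0ℚ ≼ 1ℚ
0≤1 = subst₂ _≼_ ι-0 ι-1 (ι-mono z≤n)

module _ (K B a A : ℕ) {c n Λ ν κ θ e s : ℚ} (0≤c : 0ℚ ≼ c) (0≤n : 0ℚ ≼ n) (0≤θ : 0ℚ ≼ θ)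
  (θ≤1 : θ ≼ 1ℚ) (e≤1 : e ≼ 1ℚ) (1≤Λ : 1ℚ ≼ Λ) (cν≤ : c ⊗ ν ≼ ι a ⊗ (n ⊗ Λ))
  (s≤ : s ≼ ι A ⊗ n) (cA≤ : c ⊗ ι (suc A) ≼ c ⊗ ν) where

  -- The 5 in `overhead₁` stands for three θ and two e, each at most 1. Everything else with a
  -- factor θ is a multiple of n log σ: c ν and c (A+1) are each at most a n log σ, and n ≤ n log σ.
  -- The term n e is kept apart because e ≤ 1 would leave n bits, which is not small for bounded σ;
  -- it disappears only as the precision grows.
  collect-bits :
    c ⊗ ((ι K ⊕ ι K ⊕ ι K ⊕ θ ⊕ θ ⊕ θ) ⊕ κ ⊕ (e ⊕ e) ⊕ ι B ⊗ (1ℚ ⊕ (ι K ⊕ ι K) ⊕ (ι (suc A) ⊕ ν) ⊗ θ))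
      ⊕ (θ ⊕ θ ⊕ e ⊕ ι B ⊗ θ) ⊗ n ⊕ θ ⊗ s
    ≼ c ⊗ ι (overhead₁ K B) ⊕ c ⊗ κ ⊕ θ ⊗ (ι (overhead₂ B a A) ⊗ (n ⊗ Λ)) ⊕ n ⊗ e
  collect-bits = begin
    c ⊗ ((ι K ⊕ ι K ⊕ ι K ⊕ θ ⊕ θ ⊕ θ) ⊕ κ ⊕ (e ⊕ e) ⊕ ι B ⊗ (1ℚ ⊕ (ι K ⊕ ι K) ⊕ (ι (suc A) ⊕ ν) ⊗ θ))
      ⊕ (θ ⊕ θ ⊕ e ⊕ ι B ⊗ θ) ⊗ n ⊕ θ ⊗ s
      ≡⟨ solve 10 (λ c k θ κ e b A ν n s →
           c :* ((k :+ k :+ k :+ θ :+ θ :+ θ) :+ κ :+ (e :+ e) :+ b :* (con 1 :+ (k :+ k) :+ (A :+ ν) :* θ))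
             :+ (θ :+ θ :+ e :+ b :* θ) :* n :+ θ :* s
           := c :* (k :+ k :+ k :+ (θ :+ (θ :+ (θ :+ (e :+ e)))) :+ b :* (con 1 :+ (k :+ k))) :+ c :* κ
             :+ θ :* (b :* (c :* A :+ c :* ν) :+ ((con 1 :+ con 1 :+ b) :* n :+ s)) :+ n :* e) refl
           c (ι K) θ κ e (ι B) (ι (suc A)) ν n s ⟩
    c ⊗ (ι K ⊕ ι K ⊕ ι K ⊕ (θ ⊕ (θ ⊕ (θ ⊕ (e ⊕ e)))) ⊕ ι B ⊗ (1ℚ ⊕ (ι K ⊕ ι K))) ⊕ c ⊗ κ
      ⊕ θ ⊗ (ι B ⊗ (c ⊗ ι (suc A) ⊕ c ⊗ ν) ⊕ ((1ℚ ⊕ 1ℚ ⊕ ι B) ⊗ n ⊕ s)) ⊕ n ⊗ e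
      ≤⟨ ⊕-mono (⊕-mono (⊕-mono
           (⊗-monoˡ 0≤c (⊕-mono (⊕-mono ℚ.≤-refl (⊕-mono θ≤1 (⊕-mono θ≤1 (⊕-mono θ≤1 (⊕-mono e≤1 e≤1))))) ℚ.≤-refl))
           (ℚ.≤-refl {c ⊗ κ}))
           (⊗-monoˡ 0≤θ (⊕-mono (⊗-monoˡ (ι-nonNeg B) (⊕-mono (ℚ.≤-trans cA≤ cν≤) cν≤))
             (⊕-mono (⊗-monoˡ 0≤2+B n≤X) (ℚ.≤-trans s≤ (⊗-monoˡ (ι-nonNeg A) n≤X))))))
           (ℚ.≤-refl {n ⊗ e}) ⟩
    c ⊗ (ι K ⊕ ι K ⊕ ι K ⊕ (1ℚ ⊕ (1ℚ ⊕ (1ℚ ⊕ (1ℚ ⊕ 1ℚ)))) ⊕ ι B ⊗ (1ℚ ⊕ (ι K ⊕ ι K))) ⊕ c ⊗ κ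
      ⊕ θ ⊗ (ι B ⊗ (ι a ⊗ X ⊕ ι a ⊗ X) ⊕ ((1ℚ ⊕ 1ℚ ⊕ ι B) ⊗ X ⊕ ι A ⊗ X)) ⊕ n ⊗ e
      ≡⟨ cong (_⊕ n ⊗ e) (cong₂ (λ u v → c ⊗ u ⊕ c ⊗ κ ⊕ θ ⊗ v)
           (trans (cong (λ z → ι K ⊕ ι K ⊕ ι K ⊕ z ⊕ ι B ⊗ (1ℚ ⊕ (ι K ⊕ ι K))) (sym ι-5)) (sym (ι-overhead₁ K B)))
           (trans (solve 4 (λ b a x y → b :* (a :* x :+ a :* x) :+ ((con 1 :+ con 1 :+ b) :* x :+ y :* x)
                      := (b :* (a :+ a) :+ (con 1 :+ con 1 :+ b :+ y)) :* x) refl (ι B) (ι a) X (ι A))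
             (cong (_⊗ X) (trans (cong (λ z → ι B ⊗ (ι a ⊕ ι a) ⊕ (z ⊕ ι B ⊕ ι A)) (sym ι-2)) (sym (ι-overhead₂ B a A)))))) ⟩
    c ⊗ ι (overhead₁ K B) ⊕ c ⊗ κ ⊕ θ ⊗ (ι (overhead₂ B a A) ⊗ X) ⊕ n ⊗ e ∎
    where
    open ℚ.≤-Reasoning
    open ⊕-⊗-Solver
    X = n ⊗ Λ
    n≤X : n ≼ X
    n≤X = ℚ.≤-trans (ℚ.≤-reflexive (sym (⊗-identityʳ n))) (⊗-monoˡ 0≤n 1≤Λ)
    0≤2+B : 0ℚ ≼ 1ℚ ⊕ 1ℚ ⊕ ι B
    0≤2+B = ⊕-nonNeg (⊕-nonNeg 0≤1 0≤1) (ι-nonNeg B)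

-- Choice of the constants, and the bound at a fixed precision

third-sum : ∀ E .{{_ : ℕ.NonZero E}} {p q r x} → ι (3 * E) ⊗ p ≼ x → ι (3 * E) ⊗ q ≼ x → ι (3 * E) ⊗ r ≼ x →
            p ⊕ q ⊕ r ≼ (1 ⊘ E) ⊗ x
third-sum E {p} {q} {r} {x} hp hq hr = ι-cancel (3 * E) {{ℕ.m*n≢0 3 E}} (begin
  ι (3 * E) ⊗ (p ⊕ q ⊕ r)
    ≡⟨ solve 4 (λ f p q r → f :* (p :+ q :+ r) := f :* p :+ f :* q :+ f :* r) refl (ι (3 * E)) p q r ⟩
  ι (3 * E) ⊗ p ⊕ ι (3 * E) ⊗ q ⊕ ι (3 * E) ⊗ r
    ≤⟨ ⊕-mono (⊕-mono hp hq) hr ⟩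
  x ⊕ x ⊕ x
    ≡⟨ solve 1 (λ x → x :+ x :+ x := (con 1 :+ (con 1 :+ con 1)) :* x) refl x ⟩
  (1ℚ ⊕ (1ℚ ⊕ 1ℚ)) ⊗ x
    ≡⟨ cong (_⊗ x) (trans (cong (1ℚ ⊕_) (sym ι-2)) (trans (sym (ι-suc 2)) (trans (sym (⊗-identityʳ (ι 3)))
         (cong (ι 3 ⊗_) (sym (trans (ι⊗⊘ 1 E) ι-1)))))) ⟩
  ι 3 ⊗ (ι E ⊗ (1 ⊘ E)) ⊗ x
    ≡⟨ trans (solve 4 (λ t f g x → t :* (f :* g) :* x := t :* f :* (g :* x)) refl (ι 3) (ι E) (1 ⊘ E) x)
         (cong (_⊗ ((1 ⊘ E) ⊗ x)) (sym (ι-* 3 E))) ⟩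
  ι (3 * E) ⊗ ((1 ⊘ E) ⊗ x) ∎)
  where
  open ℚ.≤-Reasoning
  open ⊕-⊗-Solver

distance-bound : ∀ {σ} {T : Word σ} {i P code} → RightmostCode T i P code → i ≤ length T → distance code ≤ length T ℕ.+ σ
distance-bound {σ} {T} (copy (s , _ , s+d≡i) _) i≤n =
  ℕ.≤-trans (ℕ.m≤n+m _ s) (ℕ.≤-trans (ℕ.≤-reflexive s+d≡i) (ℕ.≤-trans i≤n (ℕ.m≤m+n (length T) σ)))
distance-bound {σ} {T} (literal _) _ = ℕ.m≤n+m σ (length T)

lg-1 : ∀ m → lg m (ι 1) ≡ 0ℚ
lg-1 m = ℚ.≤-antisym (ℚ.≤-trans (lg-2^ m 0 ℚ.≤-refl) (ℚ.≤-reflexive ι-0)) (lg-nonNeg m (ι 1))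

at-log₂-fromℕ : ∀ n m → log₂ (fromℕ n) at m ≡ lg m (ι n)
at-log₂-fromℕ n m = trans (at-log₂ (fromℕ n) m) (cong (lg m) (at-fromℕ n m))

at-1ℝ : ∀ m → 1ℝ at m ≡ 1ℚ
at-1ℝ m = trans (at-fromℕ 1 m) ι-1

at-loglog : ∀ n m → log₂ (log₂ (fromℕ n)) at m ≡ lg m (lg m (ι n))
at-loglog n m = trans (at-log₂ (log₂ (fromℕ n)) m) (cong (lg m) (at-log₂-fromℕ n m))

-- A literal has length 1 and log₂ 1 = 0, so both kinds of phrases obey the same formula.
at-maxBits : ∀ {σ} {T : Word σ} {i P code} C m → RightmostCode T i P code →
  maxBits C code at m ≡ lg m (ι (distance code)) ⊕ C at m ⊗ (1ℚ ⊕ lg m (lg m (ι (distance code))) ⊕ lg m (ι (length P)))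
at-maxBits {P = P} C m (copy {d} _ _) = trans (at-+ℝ (log₂ (fromℕ d)) (C *ℝ (1ℝ +ℝ log₂ (log₂ (fromℕ d)) +ℝ log₂ (fromℕ (length P)))) m)
  (cong₂ _⊕_ (at-log₂-fromℕ d m) (trans (at-*ℝ C (1ℝ +ℝ log₂ (log₂ (fromℕ d)) +ℝ log₂ (fromℕ (length P))) m)
    (cong (C at m ⊗_) (trans (at-+ℝ (1ℝ +ℝ log₂ (log₂ (fromℕ d))) (log₂ (fromℕ (length P))) m)
      (cong₂ _⊕_ (trans (at-+ℝ 1ℝ (log₂ (log₂ (fromℕ d))) m) (cong₂ _⊕_ (at-1ℝ m) (at-loglog d m)))
        (at-log₂-fromℕ (length P) m))))))
at-maxBits {σ} C m (literal (refl , _)) = trans (at-+ℝ (log₂ (fromℕ σ)) (C *ℝ (1ℝ +ℝ log₂ (log₂ (fromℕ σ)))) m)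
  (cong₂ _⊕_ (at-log₂-fromℕ σ m) (trans (at-*ℝ C (1ℝ +ℝ log₂ (log₂ (fromℕ σ))) m)
    (cong (C at m ⊗_) (trans (at-+ℝ 1ℝ (log₂ (log₂ (fromℕ σ))) m)
      (trans (cong₂ _⊕_ (at-1ℝ m) (at-loglog σ m)) (sym (trans (cong (1ℚ ⊕ lg m (lg m (ι σ)) ⊕_) (lg-1 m)) (⊕-identityʳ _))))))))

-- With K = 3E · `overhead₂` the crude inequality K < 2ᴷ already gives `overhead₂` / 2ᴷ ≤ 1/(3E),
-- one third of the allowed error.
precision : ℕ → ℕ → ℕ → ℕ → ℕ
precision E B a A = 3 * E * overhead₂ B a A

-- A lower bound for log n. Since c log n ≤ a n log σ, the first summand pushes c · `overhead₁`
-- below n log σ / (3E); the second lets log n absorb the constant A+1 in the bound on log d.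
threshold : ℕ → ℕ → ℕ → ℕ → ℕ
threshold E B a A = 3 * E * overhead₁ (precision E B a A) B * a ℕ.+ suc A

module Pointwise {σ : ℕ} {{σ≢0 : ℕ.NonZero σ}} (T : Word σ) {{n≢0 : ℕ.NonZero (length T)}} (m k : ℕ)
  (Ps : List (Word σ)) (code : Fin (length Ps) → Code σ)
  (factors : concat Ps ≡ T) (nonEmpty : All (_≢ []) Ps) (rightmost : Rightmost.RightmostFrom T 0 Ps code)
  (E B a A : ℕ) {{E≢0 : ℕ.NonZero E}} {{a≢0 : ℕ.NonZero a}} where

  open ParsingLength T m k Ps code factors nonEmpty rightmost

  private
    F K S : ℕ
    F = 3 * E
    K = precision E B a A
    S = threshold E B a A

    c N Λ ν κ e X θ : ℚ
    c = ι (length Ps)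
    N = ι n
    Λ = lg m (ι σ)
    ν = lg m (ι n)
    κ = ι k ⊗ Λ
    e = 1 ⊘ suc m
    X = N ⊗ Λ
    θ = 1 ⊘ (2 ℕ.^ K)

  module _ {ε C : ℚ} (C≤B : C ≼ ι B) (1/E≤ε : 1 ⊘ E ≼ ε) (1≤Λ : 1ℚ ≼ Λ)
    (cν≤ : c ⊗ ν ≼ ι a ⊗ X) (κ≤ : ι (F * suc a) ⊗ κ ≼ ν ⊕ Λ) (S≤ν : ι S ≼ ν) (n+σ≤ : n ℕ.+ σ ≤ A * n) where

    0≤c : 0ℚ ≼ c
    0≤c = ι-nonNeg (length Ps)

    0≤X : 0ℚ ≼ X
    0≤X = ⊗-nonNeg (ι-nonNeg n) (lg-nonNeg m (ι σ))

    c≤n : c ≼ N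
    c≤n = ι-mono (ℕ.≤-trans (length-concat-≥ nonEmpty) (ℕ.≤-reflexive (cong length factors)))

    position≤ : ∀ j → start Ps j ≤ length T
    position≤ j = ℕ.≤-trans (List.length-++-≤ˡ (concat (take (toℕ j) Ps))) (ℕ.≤-reflexive (cong length (phrase-split j)))

    -- Deliberately crude: log A ≤ A, and the additivity error is at most 1, so all logarithms of
    -- distances stay within a constant of log n.
    lg-distance≤ : ∀ j → lg m (D j) ≼ ι (suc A) ⊕ ν
    lg-distance≤ j = begin
      lg m (D j)                 ≤⟨ lg-mono m (ι-mono (ℕ.≤-trans (distance-bound (rightmost j refl) (position≤ j)) n+σ≤)) ⟩
      lg m (ι (A * n))           ≡⟨ cong (lg m) (ι-* A n) ⟩
      lg m (ι A ⊗ N)             ≤⟨ lg-* m (ι-nonNeg A) (ι-nonNeg n) ⟩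
      lg m (ι A) ⊕ ν ⊕ e         ≤⟨ ⊕-mono (⊕-mono (lg-2^ m A (ι-mono (ℕ.<⇒≤ (n<2^n A)))) (ℚ.≤-refl {ν})) (1⊘≼1 m) ⟩
      ι A ⊕ ν ⊕ 1ℚ               ≡⟨ trans (solve 2 (λ a v → a :+ v :+ con 1 := con 1 :+ a :+ v) refl (ι A) ν) (cong (_⊕ ν) (sym (ι-suc A))) ⟩
      ι (suc A) ⊕ ν              ∎
      where
      open ℚ.≤-Reasoning
      open ⊕-⊗-Solver

    P₁≤ : ι F ⊗ (c ⊗ ι (overhead₁ K B)) ≼ X
    P₁≤ = ι-cancel a (begin
      ι a ⊗ (ι F ⊗ (c ⊗ O))          ≡⟨ solve 4 (λ a f c o → a :* (f :* (c :* o)) := c :* (f :* o :* a)) refl (ι a) (ι F) c O ⟩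
      c ⊗ (ι F ⊗ O ⊗ ι a)            ≡⟨ cong (c ⊗_) (trans (cong (_⊗ ι a) (sym (ι-* F (overhead₁ K B)))) (sym (ι-* (F * overhead₁ K B) a))) ⟩
      c ⊗ ι (F * overhead₁ K B * a)  ≤⟨ ⊗-monoˡ 0≤c (ℚ.≤-trans (ι-mono (ℕ.m≤m+n (F * overhead₁ K B * a) (suc A))) S≤ν) ⟩
      c ⊗ ν                          ≤⟨ cν≤ ⟩
      ι a ⊗ X                        ∎)
      where
      open ℚ.≤-Reasoning
      open ⊕-⊗-Solver
      O = ι (overhead₁ K B)

    -- After multiplication by c, the summand log n contributes at most a n log σ by the bound on
    -- the number of phrases, and the summand log σ at most n log σ because c ≤ n. Hence the factor
    -- a+1.
    P₂≤ : ι F ⊗ (c ⊗ κ) ≼ X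
    P₂≤ = ι-cancel (suc a) (begin
      ι (suc a) ⊗ (ι F ⊗ (c ⊗ κ))    ≡⟨ solve 4 (λ a f c o → a :* (f :* (c :* o)) := c :* (f :* a :* o)) refl (ι (suc a)) (ι F) c κ ⟩
      c ⊗ (ι F ⊗ ι (suc a) ⊗ κ)      ≡⟨ cong (λ z → c ⊗ (z ⊗ κ)) (ι-* F (suc a)) ⟨
      c ⊗ (ι (F * suc a) ⊗ κ)        ≤⟨ ⊗-monoˡ 0≤c κ≤ ⟩
      c ⊗ (ν ⊕ Λ)                    ≡⟨ ⊗-distribˡ-⊕ c ν Λ ⟩
      c ⊗ ν ⊕ c ⊗ Λ                  ≤⟨ ⊕-mono cν≤ (⊗-monoʳ (lg-nonNeg m (ι σ)) c≤n) ⟩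
      ι a ⊗ X ⊕ X                    ≡⟨ solve 2 (λ a x → a :* x :+ x := (con 1 :+ a) :* x) refl (ι a) X ⟩
      (1ℚ ⊕ ι a) ⊗ X                 ≡⟨ cong (_⊗ X) (ι-suc a) ⟨
      ι (suc a) ⊗ X                  ∎)
      where
      open ℚ.≤-Reasoning
      open ⊕-⊗-Solver

    P₃≤ : ι F ⊗ (θ ⊗ (ι (overhead₂ B a A) ⊗ X)) ≼ X
    P₃≤ = begin
      ι F ⊗ (θ ⊗ (ι (overhead₂ B a A) ⊗ X))    ≡⟨ solve 4 (λ f t o x → f :* (t :* (o :* x)) := f :* o :* t :* x) refl (ι F) θ (ι (overhead₂ B a A)) X ⟩
      ι F ⊗ ι (overhead₂ B a A) ⊗ θ ⊗ X        ≡⟨ cong (λ z → z ⊗ θ ⊗ X) (ι-* F (overhead₂ B a A)) ⟨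
      ι K ⊗ θ ⊗ X                              ≤⟨ ⊗-monoʳ 0≤X (⊗-monoʳ (⊘-nonNeg 1 (2 ℕ.^ K)) (ι-mono (ℕ.<⇒≤ (n<2^n K)))) ⟩
      ι (2 ℕ.^ K) ⊗ θ ⊗ X                      ≡⟨ trans (cong (_⊗ X) (trans (ι⊗⊘ 1 (2 ℕ.^ K) {{ℕ.m^n≢0 2 K}}) ι-1)) (⊗-identityˡ X) ⟩
      X                                        ∎
      where
      open ℚ.≤-Reasoning
      open ⊕-⊗-Solver

    open Bits K B (ι (suc A) ⊕ ν) C C≤B lg-distance≤ using (overhead; perPhrase; perSymbol; bits-sum)

    bits≤ : sum J (λ j → lg m (D j) ⊕ C ⊗ overhead j) ≼ N ⊗ H k T at m ⊕ ε ⊗ X ⊕ N ⊗ e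
    bits≤ = begin
      sum J (λ j → lg m (D j) ⊕ C ⊗ overhead j)
        ≤⟨ bits-sum ⟩
      c ⊗ perPhrase ⊕ perSymbol ⊗ N ⊕ nH ⊕ θ ⊗ ι (n ℕ.+ σ)
        ≡⟨ solve 4 (λ p s h t → p :+ s :+ h :+ t := h :+ (p :+ s :+ t)) refl (c ⊗ perPhrase) (perSymbol ⊗ N) nH (θ ⊗ ι (n ℕ.+ σ)) ⟩
      nH ⊕ (c ⊗ perPhrase ⊕ perSymbol ⊗ N ⊕ θ ⊗ ι (n ℕ.+ σ))
        ≤⟨ ⊕-mono (ℚ.≤-refl {nH}) (collect-bits K B a A 0≤c (ι-nonNeg n) 0≤θ θ≤1 (1⊘≼1 m) 1≤Λ cν≤
             (ℚ.≤-trans (ι-mono n+σ≤) (ℚ.≤-reflexive (ι-* A n)))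
             (⊗-monoˡ 0≤c (ℚ.≤-trans (ι-mono (ℕ.m≤n+m (suc A) (F * overhead₁ K B * a))) S≤ν))) ⟩
      nH ⊕ (c ⊗ ι (overhead₁ K B) ⊕ c ⊗ κ ⊕ θ ⊗ (ι (overhead₂ B a A) ⊗ X) ⊕ N ⊗ e)
        ≤⟨ ⊕-mono (ℚ.≤-refl {nH}) (⊕-mono (ℚ.≤-trans (third-sum E P₁≤ P₂≤ P₃≤) (⊗-monoʳ 0≤X 1/E≤ε)) (ℚ.≤-refl {N ⊗ e})) ⟩
      nH ⊕ (ε ⊗ X ⊕ N ⊗ e)
        ≡⟨ ⊕-assoc nH (ε ⊗ X) (N ⊗ e) ⟨
      nH ⊕ ε ⊗ X ⊕ N ⊗ e ∎
      where
      open ℚ.≤-Reasoning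
      open ⊕-⊗-Solver
      nH = N ⊗ H k T at m
      0≤θ : 0ℚ ≼ θ
      0≤θ = ⊘-nonNeg 1 (2 ℕ.^ K)
      θ≤1 : θ ≼ 1ℚ
      θ≤1 = subst (λ z → 1 ⊘ z ≼ 1ℚ) (ℕ.suc-pred (2 ℕ.^ K) {{ℕ.m^n≢0 2 K}}) (1⊘≼1 (ℕ.pred (2 ℕ.^ K)))

-- From the real hypotheses to a fixed precision, and back

at-logBase : ∀ b n m → logBase b n at m ≡ lg m (ι n) ⊗ recip (log₂ (fromℕ b)) at m
at-logBase b n m = trans (at-*ℝ (log₂ (fromℕ n)) (recip (log₂ (fromℕ b))) m)
  (cong (_⊗ recip (log₂ (fromℕ b)) at m) (at-log₂-fromℕ n m))

-- Here r is the reciprocal of Λ = log σ. The 1 is the tolerance with which a real inequality holds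
-- at finite precision; N ≥ 1 absorbs it, which raises the constant from a to a+1.
clear-log-phrases : ∀ {c ν r Λ x N} a → 0ℚ ≼ Λ → 0ℚ ≼ N → Λ ⊗ r ≡ 1ℚ → x ≼ ι a → 1ℚ ≼ N →
  c ⊗ (ν ⊗ r) ≼ x ⊗ N ⊕ 1ℚ → c ⊗ ν ≼ ι (suc a) ⊗ (N ⊗ Λ)
clear-log-phrases {c} {ν} {r} {Λ} {x} {N} a 0≤Λ 0≤N Λr≡1 x≤a 1≤N h = begin
  c ⊗ ν                        ≡⟨ trans (sym (⊗-identityˡ (c ⊗ ν))) (cong (_⊗ (c ⊗ ν)) (sym Λr≡1)) ⟩
  Λ ⊗ r ⊗ (c ⊗ ν)              ≡⟨ solve 4 (λ l r c v → l :* r :* (c :* v) := l :* (c :* (v :* r))) refl Λ r c ν ⟩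
  Λ ⊗ (c ⊗ (ν ⊗ r))            ≤⟨ ⊗-monoˡ 0≤Λ (ℚ.≤-trans h (⊕-mono (⊗-monoʳ 0≤N x≤a) 1≤N)) ⟩
  Λ ⊗ (ι a ⊗ N ⊕ N)            ≡⟨ solve 3 (λ l a n → l :* (a :* n :+ n) := (con 1 :+ a) :* (n :* l)) refl Λ (ι a) N ⟩
  (1ℚ ⊕ ι a) ⊗ (N ⊗ Λ)         ≡⟨ cong (_⊗ (N ⊗ Λ)) (ι-suc a) ⟨
  ι (suc a) ⊗ (N ⊗ Λ)          ∎
  where
  open ℚ.≤-Reasoning
  open ⊕-⊗-Solver

-- The tolerance is chosen equal to the factor 1/(g+1), so that clearing the denominators leaves a
-- single extra Λ whatever g is.
clear-log-order : ∀ {κ ν r Λ} g → 0ℚ ≼ κ → 0ℚ ≼ Λ → Λ ⊗ r ≡ 1ℚ →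
  κ ≼ (1 ⊘ suc g) ⊗ (ν ⊗ r) ⊕ 1 ⊘ suc g → ι g ⊗ (κ ⊗ Λ) ≼ ν ⊕ Λ
clear-log-order {κ} {ν} {r} {Λ} g 0≤κ 0≤Λ Λr≡1 h = begin
  ι g ⊗ (κ ⊗ Λ)                                  ≤⟨ ⊗-monoʳ (⊗-nonNeg 0≤κ 0≤Λ) (ι-mono (ℕ.n≤1+n g)) ⟩
  ι (suc g) ⊗ (κ ⊗ Λ)                            ≤⟨ ⊗-monoˡ (ι-nonNeg (suc g)) (⊗-monoʳ 0≤Λ h) ⟩
  ι (suc g) ⊗ ((η ⊗ (ν ⊗ r) ⊕ η) ⊗ Λ)
    ≡⟨ solve 5 (λ g e v r l → g :* ((e :* (v :* r) :+ e) :* l) := g :* e :* (v :* (l :* r) :+ l)) refl (ι (suc g)) η ν r Λ ⟩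
  ι (suc g) ⊗ η ⊗ (ν ⊗ (Λ ⊗ r) ⊕ Λ)
    ≡⟨ cong₂ (λ u v → u ⊗ (ν ⊗ v ⊕ Λ)) (trans (ι⊗⊘ 1 (suc g)) ι-1) Λr≡1 ⟩
  1ℚ ⊗ (ν ⊗ 1ℚ ⊕ Λ)                              ≡⟨ trans (⊗-identityˡ _) (cong (_⊕ Λ) (⊗-identityʳ ν)) ⟩
  ν ⊕ Λ                                          ∎
  where
  open ℚ.≤-Reasoning
  open ⊕-⊗-Solver
  η = 1 ⊘ suc g

lg-≥1 : ∀ m {σ} → 2 ≤ σ → 1ℚ ≼ lg m (ι σ)
lg-≥1 m {σ} 2≤σ = subst (_≼ lg m (ι σ)) ι-1 (lg-2^-≥ m 1 (ι-mono 2≤σ))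

at-recip-log : ∀ m {σ} → 2 ≤ σ → lg m (ι σ) ⊗ recip (log₂ (fromℕ σ)) at m ≡ 1ℚ
at-recip-log m {σ} 2≤σ = trans (cong (_⊗ recip (log₂ (fromℕ σ)) at m) (sym (at-log₂-fromℕ σ m)))
  (at-recip (log₂ (fromℕ σ)) m (subst (1ℚ ≼_) (sym (at-log₂-fromℕ σ m)) (lg-≥1 m 2≤σ)))

phrases-eventually : ∀ {σ n} c α a M → 2 ≤ σ → 1 ≤ n → (∀ m → M ≤ m → α at m ≼ ι a) →
  fromℕ c *ℝ logBase σ n ≤ℝ α *ℝ fromℕ n →
  ∃[ M′ ] (∀ m → M ≤ m → M′ ≤ m → ι c ⊗ lg m (ι n) ≼ ι (suc a) ⊗ (ι n ⊗ lg m (ι σ)))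
phrases-eventually {σ} {n} c α a M 2≤σ 1≤n α≤a c≤ = from (≤ℝ-elim {fromℕ c *ℝ logBase σ n} {α *ℝ fromℕ n} c≤ 0)
  where
  from : ∃[ M′ ] (∀ m → M′ ≤ m → (fromℕ c *ℝ logBase σ n) at m ≼ (α *ℝ fromℕ n) at m ⊕ 1 ⊘ 1) → _
  from (M′ , h) = M′ , λ m M≤m M′≤m →
    clear-log-phrases a (lg-nonNeg m (ι σ)) (ι-nonNeg n) (at-recip-log m 2≤σ) (α≤a m M≤m) (subst (_≼ ι n) ι-1 (ι-mono 1≤n))
      (subst₂ _≼_ (trans (at-*ℝ (fromℕ c) (logBase σ n) m) (cong₂ _⊗_ (at-fromℕ c m) (at-logBase σ n m)))
        (cong₂ _⊕_ (trans (at-*ℝ α (fromℕ n) m) (cong (α at m ⊗_) (at-fromℕ n m))) 1⊘1) (h m M′≤m))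

order-eventually : ∀ {σ n} k g → 2 ≤ σ → fromℕ k ≤ℝ fromℚ (1 ÷ suc g) *ℝ logBase σ n →
  ∃[ M′ ] (∀ m → M′ ≤ m → ι g ⊗ (ι k ⊗ lg m (ι σ)) ≼ lg m (ι n) ⊕ lg m (ι σ))
order-eventually {σ} {n} k g 2≤σ k≤ = from (≤ℝ-elim {fromℕ k} {fromℚ (1 ÷ suc g) *ℝ logBase σ n} k≤ g)
  where
  from : ∃[ M′ ] (∀ m → M′ ≤ m → fromℕ k at m ≼ (fromℚ (1 ÷ suc g) *ℝ logBase σ n) at m ⊕ 1 ⊘ suc g) → _
  from (M′ , h) = M′ , λ m M′≤m → clear-log-order g (ι-nonNeg k) (lg-nonNeg m (ι σ)) (at-recip-log m 2≤σ)
    (subst₂ _≼_ (at-fromℕ k m) (cong (_⊕ 1 ⊘ suc g) (trans (at-*ℝ (fromℚ (1 ÷ suc g)) (logBase σ n) m)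
      (cong₂ _⊗_ (at-fromℚ 1 (suc g) m) (at-logBase σ n m)))) (h m M′≤m))

at-bound : ∀ n σ (h ε : ℝ) m → (fromℕ n *ℝ h +ℝ ε *ℝ (fromℕ n *ℝ log₂ (fromℕ σ))) at m
                               ≡ ι n ⊗ h at m ⊕ ε at m ⊗ (ι n ⊗ lg m (ι σ))
at-bound n σ h ε m = trans (at-+ℝ (fromℕ n *ℝ h) (ε *ℝ (fromℕ n *ℝ log₂ (fromℕ σ))) m)
  (cong₂ _⊕_ (trans (at-*ℝ (fromℕ n) h m) (cong (_⊗ h at m) (at-fromℕ n m)))
    (trans (at-*ℝ ε (fromℕ n *ℝ log₂ (fromℕ σ)) m) (cong (ε at m ⊗_)
      (trans (at-*ℝ (fromℕ n) (log₂ (fromℕ σ)) m) (cong₂ _⊗_ (at-fromℕ n m) (at-log₂-fromℕ σ m))))))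

maxBits-at : ∀ {C ε : ℝ} {t B a A m σ k n u} →
  1 ⊘ suc t ≼ ε at m → C at m ≼ ι B →
  2 ≤ σ → σ ≤ A * n → 2 ℕ.^ threshold (suc t) B (suc a) (suc A) ≤ n → n * suc u ≤ m →
  (T : Word σ) → length T ≡ n → (𝒫 : LZParsing T) →
  ι (LZParsing.#phrases 𝒫) ⊗ lg m (ι n) ≼ ι (suc a) ⊗ (ι n ⊗ lg m (ι σ)) →
  ι (3 * suc t * suc (suc a)) ⊗ (ι k ⊗ lg m (ι σ)) ≼ lg m (ι n) ⊕ lg m (ι σ) →
  (code : Fin (LZParsing.#phrases 𝒫) → Code σ) → IsRightmostEncoding 𝒫 code →
  ∑ (allFin (LZParsing.#phrases 𝒫)) (λ j → maxBits C (code j)) at m ≼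
    (ι n ⊗ H k T at m ⊕ ε at m ⊗ (ι n ⊗ lg m (ι σ))) ⊕ 1 ⊘ suc u
maxBits-at {C} {ε} {t} {B} {a} {A} {m} {σ} {k} {n} {u} ε≥ C≤ 2≤σ σ≤An 2^S≤n nu≤m T refl 𝒫 cν≤ κ≤ code enc = ℚ.≤-trans
  (ℚ.≤-reflexive (trans (at-∑ (allFin (LZParsing.#phrases 𝒫)) (λ j → maxBits C (code j)) m) (sum-cong (allFin (LZParsing.#phrases 𝒫)) (λ j → at-maxBits C m (enc j)))))
  -- Adding n to σ ≤ A n gives n + σ ≤ (A+1) n; hence `suc A` among the constants.
  (ℚ.≤-trans (bits≤ C≤ ε≥ (lg-≥1 m 2≤σ) cν≤ κ≤ (lg-2^-≥ m S (ι-mono 2^S≤n)) (ℕ.+-monoʳ-≤ n σ≤An))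
    -- The remaining error n/(m+1) fits into the tolerance 1/(u+1) because m ≥ n (u+1).
    (⊕-mono ℚ.≤-refl (ι⊗1⊘-≼ n m u (ℕ.m≤n⇒m≤1+n nu≤m))))
  where
  open LZParsing 𝒫 using (phrases; factors; nonEmpty; phrase)
  S = threshold (suc t) B (suc a) (suc A)
  instance
    σ≢0 : ℕ.NonZero σ
    σ≢0 = ℕ.>-nonZero (ℕ.≤-trans (s≤s z≤n) 2≤σ)
    n≢0 : ℕ.NonZero (length T)
    n≢0 = ℕ.>-nonZero (ℕ.≤-trans (ℕ.m^n>0 2 S) 2^S≤n)
  rightmost : Rightmost.RightmostFrom T 0 phrases code
  rightmost j p≡ = subst (λ p → RightmostCode T p (phrase j) (code j)) (sym p≡) (enc j)
  open Pointwise T m k phrases code factors nonEmpty rightmost (suc t) B (suc a) (suc A)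

-- The index from which the rational bound holds may depend on n, k, the parsing and the tolerance,
-- since an inequality of reals is asserted for each text separately. The requirement on n involves
-- only the fixed constants.
maxBits-eventually : ∀ {C ε : ℝ} {t B a A M} →
  (∀ m → M ≤ m → 1 ⊘ suc t ≼ ε at m × C at m ≼ ι B) →
  ∀ {σ k n} → 2 ≤ σ → σ ≤ A * n → 2 ℕ.^ threshold (suc t) B (suc a) (suc A) ≤ n →
  (T : Word σ) → length T ≡ n → (𝒫 : LZParsing T) →
  ∃[ M₁ ] (∀ m → M₁ ≤ m → ι (3 * suc t * suc (suc a)) ⊗ (ι k ⊗ lg m (ι σ)) ≼ lg m (ι n) ⊕ lg m (ι σ)) →
  ∃[ M₂ ] (∀ m → M ≤ m → M₂ ≤ m → ι (LZParsing.#phrases 𝒫) ⊗ lg m (ι n) ≼ ι (suc a) ⊗ (ι n ⊗ lg m (ι σ))) →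
  (code : Fin (LZParsing.#phrases 𝒫) → Code σ) → IsRightmostEncoding 𝒫 code →
  ∑ (allFin (LZParsing.#phrases 𝒫)) (λ j → maxBits C (code j)) ≤ℝ fromℕ n *ℝ H k T +ℝ ε *ℝ (fromℕ n *ℝ log₂ (fromℕ σ))
maxBits-eventually {C} {ε} {t} {B} {a} {A} {M} consts {σ} {k} {n} 2≤σ σ≤An 2^S≤n T |T|≡n 𝒫 (M₁ , order) (M₂ , count) code enc =
  ≤ℝ-intro {∑ (allFin (LZParsing.#phrases 𝒫)) (λ j → maxBits C (code j))}
      {fromℕ n *ℝ H k T +ℝ ε *ℝ (fromℕ n *ℝ log₂ (fromℕ σ))} λ u →
    (M ℕ.⊔ M₁) ℕ.⊔ (M₂ ℕ.⊔ n * suc u) , λ m ≤m →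
    let ≤₁ = ℕ.m⊔n≤o⇒m≤o (M ℕ.⊔ M₁) (M₂ ℕ.⊔ n * suc u) ≤m
        ≤₂ = ℕ.m⊔n≤o⇒n≤o (M ℕ.⊔ M₁) (M₂ ℕ.⊔ n * suc u) ≤m
        M≤m = ℕ.m⊔n≤o⇒m≤o M M₁ ≤₁
        ε≥ , C≤ = consts m M≤m in
    ℚ.≤-trans (maxBits-at {C} {ε} {t} {B} {a} {A} {m} {σ} {k} {n} {u} ε≥ C≤ 2≤σ σ≤An 2^S≤n
        (ℕ.m⊔n≤o⇒n≤o M₂ (n * suc u) ≤₂) T |T|≡n 𝒫 (count m M≤m (ℕ.m⊔n≤o⇒m≤o M₂ (n * suc u) ≤₂)) (order m (ℕ.m⊔n≤o⇒n≤o M M₁ ≤₁)) code enc) (ℚ.≤-reflexive (cong (_⊕ 1 ⊘ suc u) (sym (at-bound n σ (H k T) ε m))))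

-- g is a variable because comparing terms that contain 1 ÷ suc g for a closed form of
-- g would normalise that fraction.
maxBits-sum : ∀ {α C ε : ℝ} {t B a A M g : ℕ} → 3 * suc t * suc (suc a) ≡ g →
  (∀ m → M ≤ m → 1 ⊘ suc t ≼ ε at m × C at m ≼ ι B) → (∀ m → M ≤ m → α at m ≼ ι a) →
  ∀ {σ k n} → 2 ≤ σ → σ ≤ A * n → 2 ℕ.^ threshold (suc t) B (suc a) (suc A) ≤ n →
  fromℕ k ≤ℝ fromℚ (1 ÷ suc g) *ℝ logBase σ n →
  (T : Word σ) → length T ≡ n → (𝒫 : LZParsing T) →
  fromℕ (LZParsing.#phrases 𝒫) *ℝ logBase σ n ≤ℝ α *ℝ fromℕ n →
  (code : Fin (LZParsing.#phrases 𝒫) → Code σ) → IsRightmostEncoding 𝒫 code →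
  ∑ (allFin (LZParsing.#phrases 𝒫)) (λ j → maxBits C (code j)) ≤ℝ fromℕ n *ℝ H k T +ℝ ε *ℝ (fromℕ n *ℝ log₂ (fromℕ σ))
maxBits-sum {α} {C} {ε} {t} {B} {a} {A} {M} {g} g≡ consts α≤a {σ} {k} {n} 2≤σ σ≤An 2^S≤n k≤ T |T|≡n 𝒫 c≤ code enc =
  maxBits-eventually {C} {ε} {t} {B} {a} {A} {M} consts {σ} {k} {n} 2≤σ σ≤An 2^S≤n T |T|≡n 𝒫
    (subst (λ z → ∃[ M₁ ] (∀ m → M₁ ≤ m → ι z ⊗ (ι k ⊗ lg m (ι σ)) ≼ lg m (ι n) ⊕ lg m (ι σ))) (sym g≡)
      (order-eventually {σ} {n} k g 2≤σ k≤))
    (phrases-eventually {σ} {n} (LZParsing.#phrases 𝒫) α a M 2≤σ (ℕ.≤-trans (ℕ.m^n>0 2 (threshold (suc t) B (suc a) (suc A))) 2^S≤n) α≤a c≤)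
    code enc

lemma3 : (α : ℝ) → 0ℝ <ℝ α → (C : ℝ) →
    (σ : ℕ → ℕ) → (∀ n → 2 ≤ σ n) → (∀ {m n} → m ≤ n → σ m ≤ σ n) →
    (∃[ A ] ∃[ N ] (∀ n → N ≤ n → σ n ≤ A * n)) →
    (k : ℕ → ℕ) → (λ n → fromℕ (k n)) ∈o (λ n → logBase (σ n) n) →
    (ε : ℝ) → 0ℝ <ℝ ε →
    ∃[ N ] (∀ n → N ≤ n →
    (T : Word (σ n)) → length T ≡ n →
    (𝒫 : LZParsing T) → let open LZParsing 𝒫 in
    fromℕ #phrases *ℝ logBase (σ n) n ≤ℝ α *ℝ fromℕ n →
    (code : Fin #phrases → Code (σ n)) → IsRightmostEncoding 𝒫 code →
    (bits : Fin #phrases → ℝ) → (∀ j → bits j ≤ℝ maxBits C (code j)) →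
    ∑ (allFin #phrases) bits
    ≤ℝ fromℕ n *ℝ H (k n) T +ℝ ε *ℝ (fromℕ n *ℝ log₂ (fromℕ (σ n))))
lemma3 α _ C σ 2≤σ _ (A , N₁ , σ≤) k k∈o ε 0<ε =
  from (0<ℝ-elim {ε} 0<ε) (at-bounded C) (at-bounded α)
  where
  from : ∃[ t ] ∃[ N ] (∀ m → N ≤ m → 1 ⊘ suc t ≼ ε at m) → ∃[ B ] ∃[ N ] (∀ m → N ≤ m → C at m ≼ ι B) →
         ∃[ a ] ∃[ N ] (∀ m → N ≤ m → α at m ≼ ι a) → _
  from (t , Mε , ε≥) (B , MC , C≤) (a , Mα , α≤) = (N₁ ℕ.⊔ N₂) ℕ.⊔ 2 ℕ.^ S , λ n N≤n T |T|≡n 𝒫 c≤ code enc bits bits≤ →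
    let ≤₁ = ℕ.m⊔n≤o⇒m≤o (N₁ ℕ.⊔ N₂) (2 ℕ.^ S) N≤n
        J = allFin (LZParsing.#phrases 𝒫) in
    ≤ℝ-trans {∑ J bits} {∑ J (λ j → maxBits C (code j))} {fromℕ n *ℝ H (k n) T +ℝ ε *ℝ (fromℕ n *ℝ log₂ (fromℕ (σ n)))}
      (∑-mono J {bits} {λ j → maxBits C (code j)} bits≤)
      (maxBits-sum {α} {C} {ε} {t} {B} {a} {A} {M} {g} refl consts α≤a {σ n} {k n} {n} (2≤σ n) (σ≤ n (ℕ.m⊔n≤o⇒m≤o N₁ N₂ ≤₁))
        (ℕ.m⊔n≤o⇒n≤o (N₁ ℕ.⊔ N₂) (2 ℕ.^ S) N≤n)
        (proj₂ order n (ℕ.m⊔n≤o⇒n≤o N₁ N₂ ≤₁)) T |T|≡n 𝒫 c≤ code enc)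
    where
    -- The 3 splits ε into three shares and `suc t` bounds 1/ε. Of `suc (suc a)`, one unit comes
    -- from the tolerance in the bound on the number of phrases and one from c log σ ≤ n log σ.
    g = 3 * suc t * suc (suc a)
    -- From n ≥ 2^S it follows that log n ≥ S at every precision, the approximation being monotone
    -- and exact at 2^S.
    S = threshold (suc t) B (suc a) (suc A)
    order = k∈o (fromℚ (1 ÷ suc g)) (0<fromℚ g)
    N₂ = proj₁ order
    M = (Mε ℕ.⊔ MC) ℕ.⊔ Mα
    consts : ∀ m → M ≤ m → 1 ⊘ suc t ≼ ε at m × C at m ≼ ι B
    consts m M≤m = ε≥ m (ℕ.m⊔n≤o⇒m≤o Mε MC ≤₁) , C≤ m (ℕ.m⊔n≤o⇒n≤o Mε MC ≤₁)
      where ≤₁ = ℕ.m⊔n≤o⇒m≤o (Mε ℕ.⊔ MC) Mα M≤m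
    α≤a : ∀ m → M ≤ m → α at m ≼ ι a
    α≤a m M≤m = α≤ m (ℕ.m⊔n≤o⇒n≤o (Mε ℕ.⊔ MC) Mα M≤m)
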